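{- Consider the following setting. There is a deterministic algorithm $\mathcal{A}$ which, when executed by every agent in the model described in the context, with the agents having no a priori knowledge about the graph (in particular no upper bound on its number of nodes), solves both the gathering problem and the leader election problem; moreover, at the end of its execution of $\mathcal{A}$, each agent knows the number of nodes of the graph.
   Context: Model: the network is an undirected connected graph with $n$ nodes whose nodes are anonymous (unlabeled); at each node $v$ of degree $d$, the incident edges carry distinct port numbers $0,\dots,d-1$ (port numbering is local, with no relation between the two port numbers of an edge). A team of at least two mobile agents starts at pairwise distinct nodes. Agents have distinct labels which are positive integers; each agent knows its own label but not the labels of others, and all agents execute the same deterministic algorithm, parameterized by the agent's label. Time proceeds in synchronous rounds. An adversary wakes up some agents in possibly different rounds; a dormant agent is woken up when another agent first visits its starting node. Starting from its wake-up round, in each round an agent performs local computation and then either stays at its current node or moves to a neighbor through a chosen port. Upon entering a node, an agent learns its degree and the port of entry. Agents cannot mark nodes or edges, and agents crossing each other on an edge do not notice it. Agents have unlimited memory. Crucially, agents cannot communicate: co-located agents cannot see each other's labels nor exchange any information; the only information an agent gets about other agents is, in every round, the number of agents (including itself) present at the node it currently occupies. Agents see nothing outside their current node. Gathering problem: all agents must be at the same node and declare that they have all met (gathering is achieved). Leader election problem: one agent is elected as leader and all agents learn its label. -}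

module Defs where

open import Data.Nat using (ℕ; zero; suc; _≤_; _<?_; _≡ᵇ_; _≤ᵇ_)
open import Data.Fin using (Fin; toℕ; fromℕ<)
open import Data.Fin.Properties using (_≟_)
open import Data.Bool using (Bool; true; false; if_then_else_; _∨_)
open import Data.List using (List; []; _∷ʳ_; filter; length; allFin)
open import Data.Maybe using (Maybe; just; nothing; Is-just)
open import Data.Product using (Σ; ∃; _×_; _,_; proj₁; proj₂)
open import Relation.Nullary using (¬_; yes; no)
open import Relation.Binary.PropositionalEquality using (_≡_)
open import Function.Definitions using (Injective)

-- Port-labelled anonymous graphs.
-- Nodes are Fin n (names invisible to agents).  A "dart" (v , p) is the
-- edge end at node v with local port p ∈ {0..deg v - 1}.  `opp` maps an
-- edge end to the other end of the same edge; it is an involution.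
-- The graph is simple: no loops, no multiple edges.

record PortGraph (n : ℕ) : Set where
  field
    deg : Fin n → ℕ
  Dart : Set
  Dart = Σ (Fin n) (λ v → Fin (deg v))
  field
    opp        : Dart → Dart
    opp-invol  : ∀ d → opp (opp d) ≡ d
    no-loop    : ∀ d → ¬ (proj₁ (opp d) ≡ proj₁ d)
    no-multi   : ∀ d e → proj₁ d ≡ proj₁ e → proj₁ (opp d) ≡ proj₁ (opp e) → d ≡ e

module _ {n : ℕ} (G : PortGraph n) where
  open PortGraph G

  data Reach (u : Fin n) : Fin n → Set where
    here : Reach u u
    step : ∀ {v} → Reach u v → (p : Fin (deg v)) → Reach u (proj₁ (opp (v , p)))

  Connected : Set
  Connected = ∀ u v → Reach u v

-- What an agent perceives in a round at its current node: the degree,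
-- the port by which it entered (nothing if it did not just move / just
-- woke up), and the number of agents (including itself) at the node.
record Obs : Set where
  constructor obs
  field
    degree : ℕ
    entry  : Maybe ℕ
    count  : ℕ

-- stop L m : declare gathering achieved, output leader label L and
-- node count m; the agent then stays forever.
data Action : Set where
  stay : Action
  move : ℕ → Action
  stop : ℕ → ℕ → Action

-- A deterministic algorithm parameterised by the agent's label; it maps
-- the agent's own history of observations since its wake-up
-- (chronological, last = current round) to an action.  It knows nothing
-- about the graph.
Algorithm : Set
Algorithm = ℕ → List Obs → Action

data Status : Set where
  dormant : Status
  active  : List Obs → Status
  done    : ℕ → ℕ → Status

IsDone : Status → Set
IsDone (done _ _) = Data.Unit.⊤ where import Data.Unit
IsDone _ = Data.Empty.⊥ where import Data.Empty

record AgentState (n : ℕ) : Set where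
  constructor ast
  field
    pos    : Fin n
    entry  : Maybe ℕ
    status : Status

open AgentState public

module Execution {n : ℕ} (G : PortGraph n) (A : Algorithm)
                 (k : ℕ) (lab : Fin k → ℕ) (start : Fin k → Fin n)
                 (wake : Fin k → Maybe ℕ) where
  open PortGraph G

  Config : Set
  Config = Fin k → AgentState n

  countAt : Config → Fin n → ℕ
  countAt c v = length (filter (λ i → pos (c i) ≟ v) (allFin k))

  adversaryWakes : Maybe ℕ → ℕ → Bool
  adversaryWakes (just r) t = r ≡ᵇ t
  adversaryWakes nothing  t = false

  act : Config → Fin k → Fin n → Maybe ℕ → List Obs → AgentState n
  act c i v e h with A (lab i) h'
    where h' = h ∷ʳ obs (deg v) e (countAt c v)
  ... | stay     = ast v nothing (active (h ∷ʳ obs (deg v) e (countAt c v)))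
  ... | stop L m = ast v nothing (done L m)
  ... | move p with p <? deg v
  ...   | no _  = ast v nothing (active (h ∷ʳ obs (deg v) e (countAt c v)))
  ...   | yes q = ast (proj₁ (opp (v , fromℕ< q)))
                      (just (toℕ (proj₂ (opp (v , fromℕ< q)))))
                      (active (h ∷ʳ obs (deg v) e (countAt c v)))

  stepAgent : ℕ → Config → Fin k → AgentState n
  stepAgent t c i with c i
  ... | ast v e (done L m)  = ast v e (done L m)
  ... | ast v e (active h)  = act c i v e h
  ... | ast v e dormant =
        if adversaryWakes (wake i) t ∨ (2 ≤ᵇ countAt c v)
        then act c i v nothing []
        else ast v e dormant

  config : ℕ → Config
  config zero    i = ast (start i) nothing dormant
  config (suc t) = stepAgent t (config t)

Solves : Algorithm → Set
Solves A =
  ∀ (n : ℕ) (G : PortGraph n) → Connected G →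
  ∀ (k : ℕ) → 2 ≤ k →
  ∀ (lab : Fin k → ℕ) → Injective _≡_ _≡_ lab → (∀ i → 1 ≤ lab i) →
  ∀ (start : Fin k → Fin n) → Injective _≡_ _≡_ start →
  ∀ (wake : Fin k → Maybe ℕ) → ∃ (λ i → Is-just (wake i)) →
  let open Execution G A k lab start wake in
    (Σ ℕ λ T → ∀ i → IsDone (status (config T i)))
    -- declarations are correct: once an agent has declared (in the round
    -- leading to time suc t), all agents are at its node at t and suc t
  × (∀ t i j → IsDone (status (config (suc t) i)) →
       (pos (config t j) ≡ pos (config t i)) ×
       (pos (config (suc t) j) ≡ pos (config (suc t) i)))
  × (Σ (Fin k) λ ℓ → ∀ t i L m → status (config t i) ≡ done L m →
       (L ≡ lab ℓ) × (m ≡ n))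

{-# OPTIONS --safe #-}
-- Agents move only at local times 2 * 4 ^ y and compare counts only at local times 4 ^ y.  The
-- possible moves form one fixed sequence of slots, each of which names a label, a trace of degrees
-- and entry ports, and a port: the agent with that label takes the port if it has seen exactly that
-- trace.  So trajectories do not depend on counts, and since the scale is exponential any two
-- agents are synchronised up to a few exceptional slots.
--
-- The sequence tests, one after another, all hypotheses (port graph, labels, homes).  Under a
-- hypothesis every named agent first traverses a ball so large that all agents it could meet later
-- are awake, then goes to a common centre.  There each agent in turn "blinks" many times (leaves
-- and comes back), and each agent in turn walks along every edge of the conjectured map and back to
-- the centre, with blinking before and after.  An agent accepts if its trace and all its counts are
-- as in the simulated run.
--
-- An accepted hypothesis is true.  A drop of the count in a blink has to come from some agent that
-- leaves; an agent not synchronised with the observer can do this only a bounded number of times,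
-- and only boundedly many such agents are around, so by the pigeonhole principle some drop comes
-- from the agent whose turn it is.  Labels are unique, hence that agent is a reliable token for the
-- centre, and the closed walks prove that the map is a covering.  Seeing nobody at the other nodes
-- excludes proper coverings and further agents.  Conversely, under a true hypothesis all agents are
-- synchronised after the traversals, so all of them accept, standing together at the centre.
module Submission where

open import Defs using (PortGraph; Connected; Reach; here; step; Obs; obs; Action; stay; move; stop; Algorithm; Status; dormant; active; done; IsDone; AgentState; ast; module Execution; Solves)
open import Data.Bool using (Bool; true; false; if_then_else_; _∨_)
open import Data.Bool.Properties using (∨-zeroʳ)
open import Data.Empty using (⊥; ⊥-elim)
open import Data.Fin using (Fin; zero; suc; toℕ; fromℕ<; join; combine; splitAt)
import Data.Fin.Properties as Fin
open import Data.List using (List; []; _∷_; [_]; _++_; _∷ʳ_; length; lookup; filter; map; concatMap; foldl; take; drop; upTo; allFin)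
open import Data.List.Membership.Propositional using (_∈_)
open import Data.List.Membership.Propositional.Properties using (∈-filter⁺; ∈-filter⁻; ∈-lookup; ∈-allFin; ∈-∃++; ∈-++⁻; ∈-++⁺ˡ; ∈-++⁺ʳ; ∈-map⁻; ∈-map⁺; ∈-upTo⁺; ∈-upTo⁻; ∈-concatMap⁺; ∈-concatMap⁻)
open import Data.List.Properties using (≡-dec; ∷-injective; ++-assoc; ++-identityʳ; ++-cancelˡ; length-++; length-drop; length-filter; length-tabulate; length-take; take++drop≡id; map-++; concatMap-++; foldl-++)
open import Data.List.Relation.Unary.All using (All; []; _∷_)
import Data.List.Relation.Unary.All as All
open import Data.List.Relation.Unary.AllPairs using (_∷_)
open import Data.List.Relation.Unary.Any using (here; there; index)
import Data.List.Relation.Unary.Any as Any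
open import Data.List.Relation.Unary.Any.Properties using (lookup-index)
open import Data.List.Relation.Unary.Unique.Propositional using (Unique)
open import Data.List.Relation.Unary.Unique.Propositional.Properties using (filter⁺; allFin⁺)
open import Data.Maybe using (Maybe; just; nothing; _>>=_; Is-just)
import Data.Maybe.Properties as Maybe
open import Data.Nat hiding (_≟_)
import Data.Nat as ℕ
open import Data.Nat.Properties hiding (_≟_)
open import Data.Nat.Tactic.RingSolver using (solve-∀)
open import Data.Product using (Σ; ∃; ∃₂; _×_; _,_; proj₁; proj₂)
import Data.Product.Properties as Product
open import Data.Sum using (_⊎_; inj₁; inj₂; [_,_]′)
open import Data.Sum.Properties using (inj₁-injective; inj₂-injective)
open import Data.Unit using (⊤; tt)
open import Data.Vec using (Vec; tabulate; toList; fromList) renaming ([] to []ᵛ; _∷_ to _∷ᵛ_; lookup to lookupᵛ)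
open import Data.Vec.Properties using (lookup∘tabulate; toList∘fromList)
open import Function using (_∘_)
open import Relation.Binary using (DecidableEquality)
open import Relation.Binary.PropositionalEquality using (_≡_; _≢_; refl; sym; trans; cong; cong₂; subst; subst₂)
open import Relation.Nullary using (¬_; Dec; yes; no; ¬?)
open import Relation.Nullary.Decidable using (_×-dec_; _→-dec_; decidable-stable; map′; toSum)
open import Relation.Unary using (Decidable)

-- Counting

-- A count is anonymous, the number of agents is unknown, and the adversary may separate wake-ups
-- arbitrarily, so one expected change of a count proves nothing. The exponential scale limits what
-- an unsynchronised agent can imitate. Once two agents are awake, the difference of their clocks is
-- constant, while the distance between slots grows fourfold. Hence an awake agent that is not ahead
-- of the observer has passed exactly the same slots from the next sample on, and one that is ahead
-- is so far ahead, on the observer's scale, that it has passed at most one slot since any given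
-- earlier sample. Agents outside the hypothesis cannot be bounded in number, but those that matter
-- are bounded by the count that the observer itself reads where it stands. Acceptance turns out to
-- be equivalent to truth, a property of the network that mentions no observer. So all agents stop
-- at the same hypothesis, the first true one, without communicating. An agent that stops early
-- disturbs nobody: until the last one stops, the program would have kept everybody at the same node
-- anyway.

lookup-injective : ∀ {A : Set} {xs : List A} → Unique xs → ∀ i j → lookup xs i ≡ lookup xs j → i ≡ j
lookup-injective (x∉ ∷ u) zero zero eq = refl
lookup-injective {xs = x ∷ xs} (x∉ ∷ u) zero (suc j) eq = ⊥-elim (All.lookup x∉ (∈-lookup {xs = xs} j) eq)
lookup-injective {xs = x ∷ xs} (x∉ ∷ u) (suc i) zero eq = ⊥-elim (All.lookup x∉ (∈-lookup {xs = xs} i) (sym eq))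
lookup-injective (x∉ ∷ u) (suc i) (suc j) eq = cong suc (lookup-injective u i j eq)

opaque
  ♯ : ∀ {m} {P : Fin m → Set} → Decidable P → ℕ
  ♯ {m} P? = length (filter P? (allFin m))

  ♯≤ : ∀ {m} {P : Fin m → Set} (P? : Decidable P) → ♯ P? ≤ m
  ♯≤ {m} P? = ≤-trans (length-filter P? (allFin m)) (≤-reflexive (length-tabulate (λ i → i)))

  ♯-length : ∀ {m} {P : Fin m → Set} (P? : Decidable P) → ♯ P? ≡ length (filter P? (allFin m))
  ♯-length P? = refl

module _ {m : ℕ} {P : Fin m → Set} (P? : Decidable P) where

  opaque
    unfolding ♯

    member : Fin (♯ P?) → Fin m
    member = lookup (filter P? (allFin m))

    member-holds : ∀ j → P (member j)
    member-holds j = proj₂ (∈-filter⁻ P? {xs = allFin m} (∈-lookup {xs = filter P? (allFin m)} j))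

    member-injective : ∀ i j → member i ≡ member j → i ≡ j
    member-injective = lookup-injective (filter⁺ P? (allFin⁺ m))

    member-index : ∀ i → P i → Fin (♯ P?)
    member-index i p = index (∈-filter⁺ P? (∈-allFin i) p)

    member-member-index : ∀ i p → member (member-index i p) ≡ i
    member-member-index i p = sym (lookup-index (∈-filter⁺ P? (∈-allFin i) p))

    ≤♯ : ∀ {n} (f : Fin n → Fin m) → (∀ j → P (f j)) → (∀ i j → f i ≡ f j → i ≡ j) → n ≤ ♯ P?
    ≤♯ f Pf inj = Fin.injective⇒≤ {f = λ j → member-index (f j) (Pf j)} λ {i} {j} eq → inj i j
      (trans (sym (member-member-index (f i) (Pf i))) (trans (cong member eq) (member-member-index (f j) (Pf j))))

module _ {m n : ℕ} {P : Fin m → Set} {Q : Fin n → Set} (P? : Decidable P) (Q? : Decidable Q)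
         (f : Fin m → Fin n) (into : ∀ {i} → P i → Q (f i)) (inj : ∀ {i j} → P i → P j → f i ≡ f j → i ≡ j) where

  ♯-inject : ♯ P? ≤ ♯ Q?
  ♯-inject = ≤♯ Q? (λ j → f (member P? j)) (λ j → into (member-holds P? j))
    λ i j eq → member-injective P? i j (inj (member-holds P? i) (member-holds P? j) eq)

  -- The strict form turns one unaccounted agent into a wrong count: the blinking agent in a blink,
  -- or a stranger at a visited node.
  ♯-inject-extra : ∀ z → Q z → (∀ {i} → P i → ¬ (f i ≡ z)) → suc (♯ P?) ≤ ♯ Q?
  ♯-inject-extra z qz z∉ = ≤♯ Q? g gQ ginj
    where
    g : Fin (suc (♯ P?)) → Fin n
    g zero = z
    g (suc j) = f (member P? j)
    gQ : ∀ j → Q (g j)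
    gQ zero = qz
    gQ (suc j) = into (member-holds P? j)
    ginj : ∀ i j → g i ≡ g j → i ≡ j
    ginj zero zero eq = refl
    ginj zero (suc j) eq = ⊥-elim (z∉ (member-holds P? j) (sym eq))
    ginj (suc i) zero eq = ⊥-elim (z∉ (member-holds P? i) eq)
    ginj (suc i) (suc j) eq = cong suc (member-injective P? i j (inj (member-holds P? i) (member-holds P? j) eq))

♯-two : ∀ {m} {P : Fin m → Set} (P? : Decidable P) i j → ¬ (i ≡ j) → P i → P j → 2 ≤ ♯ P?
♯-two {m} {P} P? i j i≢j pi pj = ≤♯ P? g gP ginj
  where
  g : Fin 2 → Fin m
  g zero = i
  g (suc zero) = j
  gP : ∀ x → P (g x)
  gP zero = pi
  gP (suc zero) = pj
  ginj : ∀ x y → g x ≡ g y → x ≡ y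
  ginj zero zero eq = refl
  ginj zero (suc zero) eq = ⊥-elim (i≢j eq)
  ginj (suc zero) zero eq = ⊥-elim (i≢j (sym eq))
  ginj (suc zero) (suc zero) eq = refl

♯-single : ∀ {m} {P : Fin m → Set} (P? : Decidable P) i → (∀ j → P j → j ≡ i) → ♯ P? ≤ 1
♯-single P? i only = Fin.injective⇒≤ {n = 1} {f = λ _ → zero} λ {x} {y} _ → member-injective P? x y
  (trans (only _ (member-holds P? x)) (sym (only _ (member-holds P? y))))

♯-drop : ∀ {m} {P Q : Fin m → Set} (P? : Decidable P) (Q? : Decidable Q) → ♯ Q? < ♯ P? → ∃ λ i → P i × ¬ Q i
♯-drop P? Q? lt with Fin.any? (λ i → P? i ×-dec ¬? (Q? i))
... | yes r = r
... | no ¬r = ⊥-elim (<⇒≱ lt (♯-inject P? Q? (λ i → i)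
        (λ {i} pi → decidable-stable (Q? i) (λ nq → ¬r (i , pi , nq))) (λ _ _ eq → eq)))

-- Local time and slots

slotTime : ℕ → ℕ
slotTime y = 2 * 4 ^ y

-- The number of slots whose move lies strictly before local time `s`. Slot times increase strictly,
-- so only slot `σ s` can be due at `s`.
σ : ℕ → ℕ
σ zero = 0
σ (suc s) with s ℕ.≟ slotTime (σ s)
... | yes _ = suc (σ s)
... | no  _ = σ s

4^-pos : ∀ x → 1 ≤ 4 ^ x
4^-pos x = m^n>0 4 x

4^-mono : ∀ {x y} → x ≤ y → 4 ^ x ≤ 4 ^ y
4^-mono = ^-monoʳ-≤ 4

slotTime-mono : ∀ {x y} → x ≤ y → slotTime x ≤ slotTime y
slotTime-mono p = *-monoʳ-≤ 2 (4^-mono p)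

slotTime-suc : ∀ x → slotTime (suc x) ≡ 8 * 4 ^ x
slotTime-suc x = sym (*-assoc 2 4 (4 ^ x))

slotTime-< : ∀ x → slotTime x < slotTime (suc x)
slotTime-< x = subst (slotTime x <_) (sym (slotTime-suc x)) (*-monoˡ-< (4 ^ x) {{m^n≢0 4 x}} {2} {8} (s≤s (s≤s (s≤s z≤n))))

σ-upper : ∀ s → s ≤ slotTime (σ s)
σ-upper zero = z≤n
σ-upper (suc s) with s ℕ.≟ slotTime (σ s)
... | yes eq = subst (λ u → suc u ≤ slotTime (suc (σ s))) (sym eq) (slotTime-< (σ s))
... | no neq = ≤∧≢⇒< (σ-upper s) neq

σ-after : ∀ {y s} → slotTime y < s → y < σ s
σ-after {y} {s} lt = ≰⇒> λ σ≤y → <⇒≱ lt (≤-trans (σ-upper s) (slotTime-mono σ≤y))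

σ-lower : ∀ {y} s → y < σ s → slotTime y < s
σ-lower {y} (suc s) lt with s ℕ.≟ slotTime (σ s)
... | yes eq = s≤s (subst (slotTime y ≤_) (sym eq) (slotTime-mono {y} (s≤s⁻¹ lt)))
... | no neq = m<n⇒m<1+n (σ-lower s lt)

σ-before : ∀ {y s} → s ≤ slotTime y → σ s ≤ y
σ-before {y} {s} le = ≮⇒≥ λ y<σ → <⇒≱ (σ-lower s y<σ) le

σ-mono : ∀ {s s'} → s ≤ s' → σ s ≤ σ s'
σ-mono {s} {s'} le = σ-before (≤-trans le (σ-upper s'))

σ-slotTime : ∀ y → σ (slotTime y) ≡ y
σ-slotTime zero = refl
σ-slotTime (suc y) = ≤-antisym (σ-before ≤-refl) (σ-after (slotTime-< y))

-- Slot `x - 1` lies at half of `4 ^ x` and slot `x` at twice `4 ^ x`. This factor of two on either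
-- side of a sample is the slack for all later estimates on clocks.
σ-sample : ∀ y → σ (4 ^ y) ≡ y
σ-sample zero = refl
σ-sample (suc y) = ≤-antisym (σ-before (m≤m+n (4 ^ suc y) _))
  (σ-after (*-monoˡ-< (4 ^ y) {{m^n≢0 4 y}} {2} {4} (s≤s (s≤s (s≤s z≤n)))))

-- Port graphs and walks

-- `to v p` is meaningful only for p < deg v.
record Graph (n : ℕ) : Set where
  field
    deg : Fin n → ℕ
    to  : Fin n → ℕ → Fin n × ℕ

  go : Fin n → ℕ → Fin n
  go v p = proj₁ (to v p)

  en : Fin n → ℕ → ℕ
  en v p = proj₂ (to v p)

  Lawful : Set
  Lawful = ∀ v p → p < deg v → en v p < deg (go v p) × to (go v p) (en v p) ≡ (v , p)

  end : Fin n → List ℕ → Fin n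
  end v [] = v
  end v (p ∷ ps) = end (go v p) ps

  back : Fin n → List ℕ → List ℕ
  back v [] = []
  back v (p ∷ ps) = back (go v p) ps ++ [ en v p ]

  Valid : Fin n → List ℕ → Set
  Valid v [] = ⊤
  Valid v (p ∷ ps) = p < deg v × Valid (go v p) ps

  end-++ : ∀ v ps qs → end v (ps ++ qs) ≡ end (end v ps) qs
  end-++ v [] qs = refl
  end-++ v (p ∷ ps) qs = end-++ (go v p) ps qs

  back-++ : ∀ v ps qs → back v (ps ++ qs) ≡ back (end v ps) qs ++ back v ps
  back-++ v [] qs = sym (++-identityʳ _)
  back-++ v (p ∷ ps) qs = trans (cong (_++ [ en v p ]) (back-++ (go v p) ps qs)) (++-assoc (back (end (go v p) ps) qs) _ _)

  valid-++ : ∀ v ps {qs} → Valid v ps → Valid (end v ps) qs → Valid v (ps ++ qs)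
  valid-++ v [] _ r = r
  valid-++ v (p ∷ ps) (l , ls) r = l , valid-++ (go v p) ps ls r

  valid-++⁻ : ∀ v ps {qs} → Valid v (ps ++ qs) → Valid v ps × Valid (end v ps) qs
  valid-++⁻ v [] r = tt , r
  valid-++⁻ v (p ∷ ps) (l , ls) = (l , proj₁ (valid-++⁻ (go v p) ps ls)) , proj₂ (valid-++⁻ (go v p) ps ls)

  module _ (law : Lawful) where

    go-en : ∀ {v p} → p < deg v → go (go v p) (en v p) ≡ v
    go-en lt = cong proj₁ (proj₂ (law _ _ lt))

    en-en : ∀ {v p} → p < deg v → en (go v p) (en v p) ≡ p
    en-en lt = cong proj₂ (proj₂ (law _ _ lt))

    back-valid : ∀ v ps → Valid v ps → Valid (end v ps) (back v ps)
    end-back : ∀ v ps → Valid v ps → end (end v ps) (back v ps) ≡ v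
    back-valid v [] _ = tt
    back-valid v (p ∷ ps) (l , ls) = valid-++ _ (back (go v p) ps) (back-valid (go v p) ps ls)
      (subst (λ w → en v p < deg w) (sym (end-back (go v p) ps ls)) (proj₁ (law v p l)) , tt)
    end-back v [] _ = refl
    end-back v (p ∷ ps) (l , ls) = trans (end-++ _ (back (go v p) ps) _)
      (trans (cong (λ w → go w (en v p)) (end-back (go v p) ps ls)) (go-en l))

    back-back : ∀ v ps → Valid v ps → back (end v ps) (back v ps) ≡ ps
    back-back v [] _ = refl
    back-back v (p ∷ ps) (l , ls) = trans (back-++ _ (back (go v p) ps) _)
      (cong₂ _∷_ (trans (cong (λ w → en w (en v p)) (end-back (go v p) ps ls)) (en-en l)) (back-back (go v p) ps ls))

  back-length : ∀ v ps → length (back v ps) ≡ length ps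
  back-length v [] = refl
  back-length v (p ∷ ps) = trans (length-++ (back (go v p) ps)) (trans (+-comm _ 1) (cong suc (back-length (go v p) ps)))

  -- Depth-first traversal of all walks of length at most `ρ`, undoing each step. Nodes are visited
  -- repeatedly, since an agent cannot recognise them.
  tour : Fin n → ℕ → List ℕ
  loops : Fin n → ℕ → List ℕ → List ℕ
  tour u zero = []
  tour u (suc ρ) = loops u ρ (upTo (deg u))
  loops u ρ [] = []
  loops u ρ (p ∷ qs) = p ∷ tour (go u p) ρ ++ en u p ∷ loops u ρ qs

  module _ (law : Lawful) where

    tour-closed : ∀ u ρ → Valid u (tour u ρ) × end u (tour u ρ) ≡ u
    loops-closed : ∀ u ρ qs → (∀ p → p ∈ qs → p < deg u) → Valid u (loops u ρ qs) × end u (loops u ρ qs) ≡ u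
    tour-closed u zero = tt , refl
    tour-closed u (suc ρ) = loops-closed u ρ (upTo (deg u)) (λ p → ∈-upTo⁻)
    loops-closed u ρ [] lt = tt , refl
    loops-closed u ρ (p ∷ qs) lt =
      (p< , valid-++ u' (tour u' ρ) (proj₁ ih) (subst (λ w → Valid w (en u p ∷ loops u ρ qs)) (sym (proj₂ ih))
              (proj₁ (law u p p<) , subst (λ w → Valid w (loops u ρ qs)) (sym (go-en law p<)) (proj₁ rest))))
      , trans (end-++ u' (tour u' ρ) _) (trans (cong (λ w → end w (en u p ∷ loops u ρ qs)) (proj₂ ih))
          (trans (cong (λ w → end w (loops u ρ qs)) (go-en law p<)) (proj₂ rest)))
      where
      u' = go u p
      p< = lt p (here refl)
      ih = tour-closed u' ρ
      rest = loops-closed u ρ qs (λ q q∈ → lt q (there q∈))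

open Graph public

-- Walks that look alike in the real graph and in the map

module _ {n m : ℕ} (G : Graph n) (H : Graph m) where

  Match : Fin n → Fin m → List ℕ → Set
  Match v u [] = deg G v ≡ deg H u
  Match v u (p ∷ ps) = deg G v ≡ deg H u × p < deg G v × en G v p ≡ en H u p × Match (go G v p) (go H u p) ps

  match-deg : ∀ v u ps → Match v u ps → deg G v ≡ deg H u
  match-deg v u [] d = d
  match-deg v u (p ∷ ps) (d , _) = d

  match-++⁻ : ∀ v u ps {qs} → Match v u (ps ++ qs) → Match v u ps × Match (end G v ps) (end H u ps) qs
  match-++⁻ v u [] {qs} M = match-deg v u qs M , M
  match-++⁻ v u (p ∷ ps) (d , l , e , M) = (d , l , e , proj₁ (match-++⁻ _ _ ps M)) , proj₂ (match-++⁻ _ _ ps M)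

  match-valid : ∀ v u ps → Match v u ps → Valid G v ps
  match-valid v u [] _ = tt
  match-valid v u (p ∷ ps) (_ , l , _ , M) = l , match-valid _ _ ps M

  match-back : ∀ v u ps → Match v u ps → back G v ps ≡ back H u ps
  match-back v u [] _ = refl
  match-back v u (p ∷ ps) (_ , l , e , M) = cong₂ (λ a b → a ++ [ b ]) (match-back _ _ ps M) e

  module _ (lawG : Lawful G) (lawH : Lawful H) where

    Covers : Fin n → List ℕ → ℕ → Set
    Covers v τ ρ = ∀ π → length π ≤ ρ → Valid G v π → ∃₂ λ τ₁ τ₂ → τ ≡ τ₁ ++ τ₂ × end G v τ₁ ≡ end G v π

    -- The tour is computed on the map `H`, but equal degrees mean that every port of `G` was tried,
    -- so it explores a ball of the real graph. Equal entry ports make each backtracking step undo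
    -- the real one.
    match-tour : ∀ ρ v u → Match v u (tour H u ρ) → end G v (tour H u ρ) ≡ v × Covers v (tour H u ρ) ρ
    match-loops : ∀ ρ qs v u → (∀ p → p ∈ qs → p < deg H u) → Match v u (loops H u ρ qs) →
      end G v (loops H u ρ qs) ≡ v × (∀ p → p ∈ qs → ∀ π → length π ≤ ρ → Valid G (go G v p) π →
        ∃₂ λ τ₁ τ₂ → loops H u ρ qs ≡ τ₁ ++ τ₂ × end G v τ₁ ≡ end G (go G v p) π)
    match-tour zero v u M = refl , λ { [] _ _ → [] , _ , refl , refl }
    match-tour (suc ρ) v u M = proj₁ r , cover
      where
      r = match-loops ρ (upTo (deg H u)) v u (λ p → ∈-upTo⁻) M
      cover : Covers v (tour H u (suc ρ)) (suc ρ)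
      cover [] _ _ = [] , _ , refl , refl
      cover (p ∷ π) (s≤s l) (p< , val) = proj₂ r p (∈-upTo⁺ (subst (p <_) (match-deg v u (tour H u (suc ρ)) M) p<)) π l val
    match-loops ρ [] v u lt M = refl , λ p ()
    match-loops ρ (p ∷ qs) v u lt (d , p<G , e , M) = closed , cover
      where
      p<H = lt p (here refl)
      v' = go G v p
      u' = go H u p
      q = en H u p
      split = match-++⁻ v' u' (tour H u' ρ) M
      ih = match-tour ρ v' u' (proj₁ split)
      home : go G (end G v' (tour H u' ρ)) q ≡ v
      home = trans (cong₂ (go G) (proj₁ ih) (sym e)) (go-en G lawG p<G)
      rest = match-loops ρ qs v u (λ p' p∈ → lt p' (there p∈))
        (subst₂ (λ a b → Match a b (loops H u ρ qs)) home
          (trans (cong (λ w → go H w q) (proj₂ (tour-closed H lawH u' ρ))) (go-en H lawH p<H))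
          (proj₂ (proj₂ (proj₂ (proj₂ split)))))
      closed : end G v (loops H u ρ (p ∷ qs)) ≡ v
      closed = trans (end-++ G v' (tour H u' ρ) _) (trans (cong (λ w → end G w (loops H u ρ qs)) home) (proj₁ rest))
      cover : ∀ p' → p' ∈ p ∷ qs → ∀ π → length π ≤ ρ → Valid G (go G v p') π →
        ∃₂ λ τ₁ τ₂ → loops H u ρ (p ∷ qs) ≡ τ₁ ++ τ₂ × end G v τ₁ ≡ end G (go G v p') π
      cover p' (here refl) π l val with proj₂ ih π l val
      ... | τ₁ , τ₂ , eq , ends = p ∷ τ₁ , τ₂ ++ q ∷ loops H u ρ qs ,
            cong (p ∷_) (trans (cong (_++ q ∷ loops H u ρ qs) eq) (++-assoc τ₁ τ₂ _)) , ends
      cover p' (there p∈) π l val with proj₂ rest p' p∈ π l val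
      ... | τ₁ , τ₂ , eq , ends = (p ∷ tour H u' ρ ++ q ∷ τ₁) , τ₂ ,
            cong (p ∷_) (trans (cong (λ z → tour H u' ρ ++ q ∷ z) eq) (sym (++-assoc (tour H u' ρ) (q ∷ τ₁) τ₂))) ,
            trans (end-++ G v' (tour H u' ρ) _) (trans (cong (λ w → end G w τ₁) home) ends)

-- Traces and slot programs

-- One (degree, entry port) record per slot, newest first.
Trace : Set
Trace = List (ℕ × Maybe ℕ)

_≟ᵗ_ : DecidableEquality Trace
_≟ᵗ_ = ≡-dec (Product.≡-dec ℕ._≟_ (Maybe.≡-dec ℕ._≟_))

-- In its slot, the agent labelled `who` leaves through `port`, provided its trace is `expect`.
record Slot : Set where
  constructor mkSlot
  field
    who    : ℕ
    expect : Trace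
    port   : ℕ
open Slot public

module _ {n : ℕ} (G : Graph n) (ℓ : ℕ) where

  moves? : ∀ sl (v : Fin n) (tr : Trace) → Dec (who sl ≡ ℓ × expect sl ≡ tr × port sl < deg G v)
  moves? sl v tr = (who sl ℕ.≟ ℓ) ×-dec ((expect sl ≟ᵗ tr) ×-dec (port sl <? deg G v))

  advance : Slot → Fin n × Trace → Fin n × Trace
  advance sl (v , tr) with moves? sl v tr
  ... | yes _ = go G v (port sl) , (deg G (go G v (port sl)) , just (en G v (port sl))) ∷ tr
  ... | no  _ = v , (deg G v , nothing) ∷ tr

  run : Fin n → List Slot → Fin n × Trace
  run v [] = v , (deg G v , nothing) ∷ []
  run v (sl ∷ B) = advance sl (run v B)

  advance-moves : ∀ sl v tr → who sl ≡ ℓ → expect sl ≡ tr → port sl < deg G v →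
    advance sl (v , tr) ≡ (go G v (port sl) , (deg G (go G v (port sl)) , just (en G v (port sl))) ∷ tr)
  advance-moves sl v tr a b c with moves? sl v tr
  ... | yes _ = refl
  ... | no ¬m = ⊥-elim (¬m (a , b , c))

  advance-stays : ∀ sl v tr → ¬ (who sl ≡ ℓ × expect sl ≡ tr × port sl < deg G v) → advance sl (v , tr) ≡ (v , (deg G v , nothing) ∷ tr)
  advance-stays sl v tr ¬m with moves? sl v tr
  ... | yes m = ⊥-elim (¬m m)
  ... | no _  = refl

  advance-other : ∀ sl st → who sl ≢ ℓ → advance sl st ≡ (proj₁ st , (deg G (proj₁ st) , nothing) ∷ proj₂ st)
  advance-other sl (v , tr) a = advance-stays sl v tr (λ m → a (proj₁ m))

  -- The slot names a label and a full trace, so a departure in it identifies the agent and its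
  -- whole past.
  advance-departs : ∀ sl st → proj₁ (advance sl st) ≢ proj₁ st → who sl ≡ ℓ × expect sl ≡ proj₂ st
  advance-departs sl (v , tr) d with moves? sl v tr
  ... | yes m = proj₁ m , proj₁ (proj₂ m)
  ... | no _  = ⊥-elim (d refl)

  advance-just : ∀ sl st {d e tr} → proj₂ (advance sl st) ≡ (d , just e) ∷ tr →
    port sl < deg G (proj₁ st) × proj₁ (advance sl st) ≡ go G (proj₁ st) (port sl) ×
    en G (proj₁ st) (port sl) ≡ e × proj₂ st ≡ tr
  advance-just sl (v , tr) eq with moves? sl v tr
  advance-just sl (v , tr) refl | yes m = proj₂ (proj₂ m) , refl , refl , refl
  advance-just sl (v , tr) ()   | no _

  advance-nothing : ∀ sl st {d tr} → proj₂ (advance sl st) ≡ (d , nothing) ∷ tr →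
    proj₁ (advance sl st) ≡ proj₁ st × proj₂ st ≡ tr
  advance-nothing sl (v , tr) eq with moves? sl v tr
  advance-nothing sl (v , tr) ()   | yes m
  advance-nothing sl (v , tr) refl | no _ = refl , refl

  advance-shape : ∀ sl st → ∃ λ e → proj₂ (advance sl st) ≡ (deg G (proj₁ (advance sl st)) , e) ∷ proj₂ st
  advance-shape sl (v , tr) with moves? sl v tr
  ... | yes _ = _ , refl
  ... | no  _ = _ , refl

  run-shape : ∀ v B → ∃₂ λ e tr → proj₂ (run v B) ≡ (deg G (proj₁ (run v B)) , e) ∷ tr
  run-shape v [] = _ , _ , refl
  run-shape v (sl ∷ B) = _ , _ , proj₂ (advance-shape sl (run v B))

  run-reach-from : ∀ v new B → ∃ λ π → Valid G (proj₁ (run v B)) π × end G (proj₁ (run v B)) π ≡ proj₁ (run v (new ++ B)) × length π ≤ length new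
  run-reach-from v [] B = [] , tt , refl , z≤n
  run-reach-from v (sl ∷ new) B with run v (new ++ B) | run-reach-from v new B
  ... | w , tr | π , val , ends , len with moves? sl w tr
  ...   | no _ = π , val , ends , m≤n⇒m≤1+n len
  ...   | yes m = π ++ [ port sl ] , valid-++ G _ π val (subst (λ x → port sl < deg G x) (sym ends) (proj₂ (proj₂ m)) , tt) ,
          trans (end-++ G _ π _) (cong (λ x → go G x (port sl)) ends) ,
          ≤-trans (≤-reflexive (trans (length-++ π) (+-comm _ 1))) (s≤s len)

  run-reach : ∀ v B → ∃ λ π → Valid G v π × end G v π ≡ proj₁ (run v B) × length π ≤ length B
  run-reach v B with run-reach-from v B []
  ... | π , val , ends , len = π , val , trans ends (cong (λ L → proj₁ (run v L)) (++-identityʳ B)) , len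

-- Port-preserving maps of graphs

record Morphism {m n : ℕ} (H : Graph m) (G : Graph n) (f : Fin m → Fin n) : Set where
  field
    deg-f : ∀ u → deg G (f u) ≡ deg H u
    go-f  : ∀ u p → p < deg H u → go G (f u) p ≡ f (go H u p)
    en-f  : ∀ u p → p < deg H u → en G (f u) p ≡ en H u p

  match-f : ∀ u ps → Valid H u ps → Match G H (f u) u ps
  match-f u [] _ = deg-f u
  match-f u (p ∷ ps) (l , ls) = deg-f u , subst (p <_) (sym (deg-f u)) l , en-f u p l ,
    subst (λ w → Match G H w (go H u p) ps) (sym (go-f u p l)) (match-f (go H u p) ps ls)

  end-f : ∀ u ps → Valid H u ps → end G (f u) ps ≡ f (end H u ps)
  end-f u [] _ = refl
  end-f u (p ∷ ps) (l , ls) = trans (cong (λ w → end G w ps) (go-f u p l)) (end-f (go H u p) ps ls)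

  valid-f : ∀ u ps → Valid G (f u) ps → Valid H u ps
  valid-f u [] _ = tt
  valid-f u (p ∷ ps) (l , ls) = l' , valid-f (go H u p) ps (subst (λ w → Valid G w ps) (go-f u p l') ls)
    where l' = subst (p <_) (deg-f u) l

  -- Traces record only degrees and entry ports, so they never distinguish a graph from its image
  -- under such a map; only counts can.
  run-f : ∀ ℓ u B → run G ℓ (f u) B ≡ (f (proj₁ (run H ℓ u B)) , proj₂ (run H ℓ u B))
  run-f ℓ u [] = cong (λ d → f u , (d , nothing) ∷ []) (deg-f u)
  run-f ℓ u (sl ∷ B) = trans (cong (advance G ℓ sl) (run-f ℓ u B)) (lemma (run H ℓ u B))
    where
    lemma : ∀ st → advance G ℓ sl (f (proj₁ st) , proj₂ st) ≡ (f (proj₁ (advance H ℓ sl st)) , proj₂ (advance H ℓ sl st))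
    lemma (w , tr) with moves? H ℓ sl w tr
    ... | yes (a , b , c) = trans (advance-moves G ℓ sl (f w) tr a b (subst (port sl <_) (sym (deg-f w)) c))
            (cong₂ _,_ (go-f w (port sl) c)
              (cong₂ (λ x y → (x , just y) ∷ tr) (trans (cong (deg G) (go-f w (port sl) c)) (deg-f _)) (en-f w (port sl) c)))
    ... | no ¬m with moves? G ℓ sl (f w) tr
    ...   | yes (a , b , c) = ⊥-elim (¬m (a , b , subst (port sl <_) (deg-f w) c))
    ...   | no _ = cong (λ d → f w , (d , nothing) ∷ tr) (deg-f w)

  -- Equal traces make the two runs reversible in parallel, so they also started at corresponding nodes.
  run-f-start : Lawful G → Lawful H → ∀ ℓ v u B → proj₂ (run G ℓ v B) ≡ proj₂ (run H ℓ u B) →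
    proj₁ (run G ℓ v B) ≡ f (proj₁ (run H ℓ u B)) → v ≡ f u
  run-f-start lawG lawH ℓ v u [] _ eq = eq
  run-f-start lawG lawH ℓ v u (sl ∷ B) tr eq with run H ℓ u B | run-f-start lawG lawH ℓ v u B
  ... | w , tr' | ih with moves? H ℓ sl w tr'
  ...   | yes (_ , _ , c) = ih (proj₂ (proj₂ (proj₂ inv)))
            (trans (sym (go-en G lawG (proj₁ inv)))
              (trans (cong₂ (go G) (trans (sym (proj₁ (proj₂ inv))) eq) (proj₁ (proj₂ (proj₂ inv))))
                (trans (go-f _ _ (proj₁ (lawH w _ c))) (cong f (go-en H lawH c)))))
          where inv = advance-just G ℓ sl (run G ℓ v B) tr
  ...   | no _ = ih (proj₂ inv) (trans (sym (proj₁ inv)) eq)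
          where inv = advance-nothing G ℓ sl (run G ℓ v B) tr

-- Schedules simulated on the map, and the slots they emit

module Simulation {m k : ℕ} (H : Graph m) (label : Fin k → ℕ) (home : Fin k → Fin m) where

  sim : Fin k → List Slot → Fin m × Trace
  sim r B = run H (label r) (home r) B

  at : Fin k → List Slot → Fin m
  at r B = proj₁ (sim r B)

  -- Expecting the full simulated trace freezes an agent, for the rest of the hypothesis, at its
  -- first deviation: traces only grow, so a deviation is never repaired.
  emit : List Slot → Fin k × ℕ → List Slot
  emit B (r , p) = mkSlot (label r) (proj₂ (sim r B)) p ∷ B

  emits : List Slot → List (Fin k × ℕ) → List Slot
  emits = foldl emit

  ports : Fin k → List (Fin k × ℕ) → List ℕ
  ports r [] = []
  ports r ((r' , p) ∷ cs) with r Fin.≟ r'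
  ... | yes _ = p ∷ ports r cs
  ... | no  _ = ports r cs

  by : Fin k → List ℕ → List (Fin k × ℕ)
  by r = map (r ,_)

  ports-++ : ∀ r cs ds → ports r (cs ++ ds) ≡ ports r cs ++ ports r ds
  ports-++ r [] ds = refl
  ports-++ r ((r' , p) ∷ cs) ds with r Fin.≟ r'
  ... | yes _ = cong (p ∷_) (ports-++ r cs ds)
  ... | no  _ = ports-++ r cs ds

  ports-by : ∀ r ps → ports r (by r ps) ≡ ps
  ports-by r [] = refl
  ports-by r (p ∷ ps) with r Fin.≟ r
  ... | yes _ = cong (p ∷_) (ports-by r ps)
  ... | no ¬e = ⊥-elim (¬e refl)

  ports-by-other : ∀ {r r'} → r ≢ r' → ∀ ps → ports r (by r' ps) ≡ []
  ports-by-other r≢ [] = refl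
  ports-by-other {r} {r'} r≢ (p ∷ ps) with r Fin.≟ r'
  ... | yes e = ⊥-elim (r≢ e)
  ... | no _ = ports-by-other r≢ ps

  ports-length : ∀ r cs → length (ports r cs) ≤ length cs
  ports-length r [] = z≤n
  ports-length r ((r' , p) ∷ cs) with r Fin.≟ r'
  ... | yes _ = s≤s (ports-length r cs)
  ... | no  _ = m≤n⇒m≤1+n (ports-length r cs)

  emits-++ : ∀ B cs ds → emits B (cs ++ ds) ≡ emits (emits B cs) ds
  emits-++ B cs ds = foldl-++ emit B cs ds

  emits-suffix : ∀ B cs → ∃ λ new → emits B cs ≡ new ++ B × length new ≡ length cs
  emits-suffix B [] = [] , refl , refl
  emits-suffix B (c ∷ cs) with emits-suffix (emit B c) cs
  ... | new , eq , len = new ∷ʳ _ , trans eq (sym (++-assoc new _ B)) , trans (length-++ new) (trans (+-comm _ 1) (cong suc len))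

  emits-length : ∀ B cs → length (emits B cs) ≡ length B + length cs
  emits-length B cs with emits-suffix B cs
  ... | new , eq , len = trans (cong length eq) (trans (length-++ new) (trans (+-comm _ (length B)) (cong (length B +_) len)))

  Distinct : Set
  Distinct = ∀ r r' → label r ≡ label r' → r ≡ r'

  at-emits : Distinct → ∀ r B cs → Valid H (at r B) (ports r cs) → at r (emits B cs) ≡ end H (at r B) (ports r cs)
  at-emits label-inj r B [] _ = refl
  at-emits label-inj r B ((r' , p) ∷ cs) val with r Fin.≟ r'
  ... | yes refl = trans (at-emits label-inj r _ cs (subst (λ w → Valid H w (ports r cs)) (sym moved) (proj₂ val)))
                     (cong (λ w → end H w (ports r cs)) moved)
    where moved = cong proj₁ (advance-moves H (label r) (mkSlot (label r) (proj₂ (sim r B)) p) (at r B) _ refl refl (proj₁ val))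
  ... | no r≢ = trans (at-emits label-inj r _ cs (subst (λ w → Valid H w (ports r cs)) (sym stays) val))
                     (cong (λ w → end H w (ports r cs)) stays)
    where stays = cong proj₁ (advance-other H (label r) (mkSlot (label r') (proj₂ (sim r' B)) p) (sim r B) (λ e → r≢ (label-inj _ _ (sym e))))

  module _ {n : ℕ} (G : Graph n) where

    outsider-stays : ∀ ℓ v → (∀ r → label r ≢ ℓ) → ∀ B cs → proj₁ (run G ℓ v (emits B cs)) ≡ proj₁ (run G ℓ v B)
    outsider-stays ℓ v out B [] = refl
    outsider-stays ℓ v out B ((r , p) ∷ cs) = trans (outsider-stays ℓ v out _ cs) (cong proj₁ (advance-other G ℓ _ (run G ℓ v B) (out r)))

    module _ (r : Fin k) (v : Fin n) where

      real : List Slot → Fin n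
      real B = proj₁ (run G (label r) v B)

      Agree : List Slot → Set
      Agree B = proj₂ (run G (label r) v B) ≡ proj₂ (sim r B)

      agree-deg : ∀ B → Agree B → deg G (real B) ≡ deg H (at r B)
      agree-deg B eq with run-shape G (label r) v B | run-shape H (label r) (home r) B
      ... | _ , _ , e | _ , _ , e' = cong proj₁ (proj₁ (∷-injective (trans (sym e) (trans eq e'))))

      agree-pred : ∀ sl B → Agree (sl ∷ B) → Agree B
      agree-pred sl B eq = proj₂ (∷-injective (trans (sym (proj₂ (advance-shape G (label r) sl (run G (label r) v B))))
        (trans eq (proj₂ (advance-shape H (label r) sl (sim r B))))))

      agree-suffix : ∀ new B → Agree (new ++ B) → Agree B
      agree-suffix [] B eq = eq
      agree-suffix (sl ∷ new) B eq = agree-suffix new B (agree-pred sl (new ++ B) eq)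

      agree-emits : ∀ B cs → Agree (emits B cs) → Agree B
      agree-emits B cs eq with emits-suffix B cs
      ... | new , e , _ = agree-suffix new B (subst Agree e eq)

      -- A recorded entry port arises only from a move, and a trace contains all its predecessors.
      -- So equality of the final traces forces the real agent through every step of the simulated
      -- walk.
      agree-match : Distinct → ∀ B cs → Valid H (at r B) (ports r cs) → Agree (emits B cs) →
        Match G H (real B) (at r B) (ports r cs) × real (emits B cs) ≡ end G (real B) (ports r cs)
      agree-match label-inj B [] _ eq = agree-deg B eq , refl
      agree-match label-inj B ((r' , p) ∷ cs) val eq with r Fin.≟ r'
      ... | yes refl = (agree-deg B (agree-pred sl B here') , proj₁ inv , proj₁ (proj₂ (proj₂ inv)) ,
                         subst₂ (λ a b → Match G H a b (ports r cs)) (proj₁ (proj₂ inv)) (cong proj₁ simulated) (proj₁ ih)) ,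
                       trans (proj₂ ih) (cong (λ w → end G w (ports r cs)) (proj₁ (proj₂ inv)))
        where
        sl = mkSlot (label r) (proj₂ (sim r B)) p
        simulated = advance-moves H (label r) sl (at r B) _ refl refl (proj₁ val)
        here' = agree-emits (sl ∷ B) cs eq
        inv = advance-just G (label r) sl (run G (label r) v B) (trans here' (cong proj₂ simulated))
        ih = agree-match label-inj (sl ∷ B) cs (subst (λ w → Valid H w (ports r cs)) (sym (cong proj₁ simulated)) (proj₂ val)) eq
      ... | no r≢ = subst₂ (λ a b → Match G H a b (ports r cs)) stays stays' (proj₁ ih) ,
                       trans (proj₂ ih) (cong (λ w → end G w (ports r cs)) stays)
        where
        other : label r' ≢ label r
        other e = r≢ (label-inj _ _ (sym e))
        sl = mkSlot (label r') (proj₂ (sim r' B)) p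
        stays' = cong proj₁ (advance-other H (label r) sl (sim r B) other)
        stays = cong proj₁ (advance-other G (label r) sl (run G (label r) v B) other)
        ih = agree-match label-inj (sl ∷ B) cs (subst (λ w → Valid H w (ports r cs)) (sym stays') val) eq

-- Enumeration of the hypotheses

-- One step along the antidiagonals of the grid: Cantor's enumeration of pairs.
next : ℕ × ℕ → ℕ × ℕ
next (zero  , b) = suc b , zero
next (suc a , b) = a , suc b

unpair : ℕ → ℕ × ℕ
unpair zero = 0 , 0
unpair (suc n) = next (unpair n)

unpair-onto : ∀ s b a → a + b ≡ s → ∃ λ n → unpair n ≡ (a , b)
unpair-onto s zero zero _ = 0 , refl
unpair-onto s (suc b) a eq with unpair-onto s b (suc a) (trans (sym (+-suc a b)) eq)
... | n , e = suc n , cong next e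
unpair-onto (suc s) zero (suc a) eq with unpair-onto s a zero (trans (sym (+-identityʳ a)) (suc-injective eq))
... | n , e = suc n , cong next e

-- A partial enumeration: `Maybe` admits empty types such as `Fin 0`.
Enumerable : Set → Set
Enumerable A = Σ (ℕ → Maybe A) λ e → ∀ a → ∃ λ n → e n ≡ just a

enum-ℕ : Enumerable ℕ
enum-ℕ = just , λ n → n , refl

enum-Fin : ∀ n → Enumerable (Fin n)
enum-Fin n = e , λ i → toℕ i , lemma i
  where
  e : ℕ → Maybe (Fin n)
  e m with m <? n
  ... | yes lt = just (fromℕ< lt)
  ... | no _ = nothing
  lemma : ∀ i → e (toℕ i) ≡ just i
  lemma i with toℕ i <? n
  ... | yes lt = cong just (Fin.fromℕ<-toℕ i lt)
  ... | no ¬lt = ⊥-elim (¬lt (Fin.toℕ<n i))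

enum-Σ : ∀ {A : Set} {B : A → Set} → Enumerable A → (∀ a → Enumerable (B a)) → Enumerable (Σ A B)
enum-Σ {A} {B} (e , onto) f = g , λ { (a , b) → surj a b }
  where
  at₂ : ℕ × ℕ → Maybe (Σ A B)
  at₂ (i , j) = e i >>= λ a → proj₁ (f a) j >>= λ b → just (a , b)
  g : ℕ → Maybe (Σ A B)
  g n = at₂ (unpair n)
  surj : ∀ a b → ∃ λ n → g n ≡ just (a , b)
  surj a b with onto a | proj₂ (f a) b
  ... | i , ei | j , ej with unpair-onto (i + j) j i refl
  ...   | n , en = n , trans (cong at₂ en) (trans (cong (_>>= λ a → proj₁ (f a) j >>= λ b → just (a , b)) ei)
                         (cong (_>>= λ b → just (a , b)) ej))

enum-Vec : ∀ {A : Set} → Enumerable A → ∀ n → Enumerable (Vec A n)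
enum-Vec E zero = (λ _ → just []ᵛ) , λ { []ᵛ → 0 , refl }
enum-Vec {A} E (suc n) with enum-Σ E (λ _ → enum-Vec E n)
... | e , onto = (λ m → e m >>= cons) , λ { (x ∷ᵛ xs) → proj₁ (onto (x , xs)) , cong (_>>= cons) (proj₂ (onto (x , xs))) }
  where
  cons : A × Vec A n → Maybe (Vec A (suc n))
  cons (x , xs) = just (x ∷ᵛ xs)

record Hyp : Set where
  field
    nodes agents : ℕ
    graph  : Graph nodes
    label  : Fin agents → ℕ
    home   : Fin agents → Fin nodes
    path   : Fin nodes → List ℕ
    centre : Fin nodes
    leader : Fin agents

Row : ℕ → Set
Row n = Σ ℕ (Vec (Fin n × ℕ))

-- A hypothesis contains functions; to be enumerated it is represented by finite tables.
Code : Set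
Code = Σ ℕ λ n → Σ ℕ λ k → Vec (Row n) n × Vec ℕ k × Vec (Fin n) k × Vec (Σ ℕ (Vec ℕ)) n × Fin n × Fin k

enum-Code : Enumerable Code
enum-Code = enum-Σ enum-ℕ λ n → enum-Σ enum-ℕ λ k →
  enum-Σ (enum-Vec (enum-Σ enum-ℕ (enum-Vec (enum-Σ (enum-Fin n) λ _ → enum-ℕ))) n) λ _ →
  enum-Σ (enum-Vec enum-ℕ k) λ _ → enum-Σ (enum-Vec (enum-Fin n) k) λ _ →
  enum-Σ (enum-Vec (enum-Σ enum-ℕ (enum-Vec enum-ℕ)) n) λ _ → enum-Σ (enum-Fin n) λ _ → enum-Fin k

entry-of : ∀ {n} → Fin n → Row n → ℕ → Fin n × ℕ
entry-of v (m , row) p with p <? m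
... | yes lt = lookupᵛ row (fromℕ< lt)
... | no _ = v , 0

decode : Code → Hyp
decode (n , k , table , labels , homes , paths , c , l) = record
  { nodes = n ; agents = k
  ; graph = record { deg = λ v → proj₁ (lookupᵛ table v) ; to = λ v → entry-of v (lookupᵛ table v) }
  ; label = lookupᵛ labels ; home = lookupᵛ homes ; path = λ u → toList (proj₂ (lookupᵛ paths u))
  ; centre = c ; leader = l }

fallback : Hyp
fallback = decode (1 , 1 , (0 , []ᵛ) ∷ᵛ []ᵛ , 0 ∷ᵛ []ᵛ , zero ∷ᵛ []ᵛ , (0 , []ᵛ) ∷ᵛ []ᵛ , zero , zero)

orFallback : Maybe Code → Hyp
orFallback (just c) = decode c
orFallback nothing = fallback

opaque
  hyp : ℕ → Hyp
  hyp h = orFallback (proj₁ enum-Code h)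

  hyp-onto : ∀ c → ∃ λ h → hyp h ≡ decode c
  hyp-onto c = proj₁ (proj₂ enum-Code c) , cong orFallback (proj₂ (proj₂ enum-Code c))

-- `path-end` makes the map connected, and `no-loop` guarantees that a blink through port 0 really
-- leaves the centre. All fields are decidable, so every agent can sort out bad hypotheses alone.
record WellFormed (h : Hyp) : Set where
  open Hyp h
  field
    two        : 2 ≤ agents
    label-inj  : ∀ r r' → label r ≡ label r' → r ≡ r'
    path-valid : ∀ u → Valid graph centre (path u)
    path-end   : ∀ u → end graph centre (path u) ≡ u
    lawful     : Lawful graph
    centre-deg : 0 < deg graph centre
    no-loop    : go graph centre 0 ≢ centre

valid? : ∀ {n} (G : Graph n) v ps → Dec (Valid G v ps)
valid? G v [] = yes tt
valid? G v (p ∷ ps) = (p <? deg G v) ×-dec valid? G (go G v p) ps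

lawful? : ∀ {n} (G : Graph n) → Dec (Lawful G)
lawful? G = Fin.all? λ v → map′ (λ all p lt → all lt) (λ all {p} lt → all p lt)
  (allUpTo? (λ p → (en G v p <? deg G (go G v p)) ×-dec Product.≡-dec Fin._≟_ ℕ._≟_ (to G (go G v p) (en G v p)) (v , p)) (deg G v))

wellFormed? : ∀ h → Dec (WellFormed h)
wellFormed? h = map′
  (λ { (a , b , c , d , e , f , g) → record { two = a ; label-inj = b ; path-valid = c ; path-end = d ; lawful = e ; centre-deg = f ; no-loop = g } })
  (λ w → let open WellFormed w in two , label-inj , path-valid , path-end , lawful , centre-deg , no-loop)
  ((2 ≤? agents) ×-dec (Fin.all? λ r → Fin.all? λ r' → (label r ℕ.≟ label r') →-dec (r Fin.≟ r'))
   ×-dec Fin.all? (λ u → valid? graph centre (path u)) ×-dec Fin.all? (λ u → end graph centre (path u) Fin.≟ u)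
   ×-dec lawful? graph ×-dec (0 <? deg graph centre) ×-dec ¬? (go graph centre 0 Fin.≟ centre))
  where open Hyp h

-- The test of one hypothesis

module Plan (h : Hyp) where
  open Hyp h public
  open Simulation graph label home public

  ret : Fin nodes → List ℕ
  ret u = back graph centre (path u)

  flip : List ℕ
  flip = 0 ∷ en graph centre 0 ∷ []

  blinks : Fin agents → ℕ → List (Fin agents × ℕ)
  blinks r zero = []
  blinks r (suc N) = by r flip ++ blinks r N

  opaque
    -- More than the number of codes of Excuse below.
    repeats : ℕ
    repeats = suc (3 * agents + agents)

    roll : List (Fin agents × ℕ)
    roll = concatMap (λ r → blinks r repeats) (allFin agents)

    -- The walks to nodes let an agent stand alone at each node of the map; the walks over edges
    -- check how the nodes are glued together.
    tests : List (List ℕ)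
    tests = map (λ u → path u ++ ret u) (allFin nodes)
         ++ concatMap (λ u → map (λ p → path u ++ p ∷ ret (go graph u p)) (upTo (deg graph u))) (allFin nodes)

  -- The two rolls show that the walker stands beside the same other agent before and after `ω`,
  -- hence that `ω` closes up in the real graph.
  trial : Fin agents → List ℕ → List (Fin agents × ℕ)
  trial i ω = roll ++ by i ω ++ roll

  opaque
    explore : Fin agents → List (Fin agents × ℕ)
    explore i = concatMap (trial i) tests

    exploreAll : List (Fin agents × ℕ)
    exploreAll = concatMap explore (allFin agents)

    spread : ℕ
    spread = length (concatMap path (allFin nodes))

  -- The first roll only keeps the others two slots away from the tours.  There are two explorations
  -- because an agent outside the hypothesis moves at most once meanwhile, so it rests during one of them.
  trials : List (Fin agents × ℕ)
  trials = roll ++ roll ++ exploreAll ++ exploreAll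

  module _ (B : List Slot) where

    opaque
      routes : List (Fin agents × ℕ)
      routes = concatMap (λ r → by r (ret (at r B))) (allFin agents)

      -- An outsider makes at most length B moves before this test, a rank at most length (routes ++ trials) after its tour.
      radius : ℕ
      radius = length B + length (routes ++ trials) + (spread + spread)

      tours : List (Fin agents × ℕ)
      tours = concatMap (λ r → by r (tour graph (at r B) radius)) (allFin agents)

    toured : List Slot
    toured = emits B tours

    gathered : List Slot
    gathered = emits toured routes

    finished : List Slot
    finished = emits gathered trials

extend : Hyp → List Slot → List Slot
extend h B with wellFormed? h
... | yes _ = Plan.finished h B
-- A filler: no trace is empty, so nobody moves. The program still grows, which keeps `finish`
-- injective.
... | no _ = mkSlot 0 [] 0 ∷ B

opaque
  prog : ℕ → List Slot
  prog zero = []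
  prog (suc h) = extend (hyp h) (prog h)

  prog-suc : ∀ h → prog (suc h) ≡ extend (hyp h) (prog h)
  prog-suc h = refl

-- The infinite program and its prefixes

keep : ∀ {A : Set} → ℕ → List A → List A
keep n xs = drop (length xs ∸ n) xs

drop-++ : ∀ {A : Set} (xs ys : List A) m → drop (length xs + m) (xs ++ ys) ≡ drop m ys
drop-++ [] ys m = refl
drop-++ (x ∷ xs) ys m = drop-++ xs ys m

keep-++ : ∀ {A : Set} n (xs ys : List A) → n ≤ length ys → keep n (xs ++ ys) ≡ keep n ys
keep-++ n xs ys le = trans (cong (λ l → drop l (xs ++ ys)) (trans (cong (_∸ n) (length-++ xs)) (+-∸-assoc (length xs) le))) (drop-++ xs ys _)

keep-all : ∀ {A : Set} (xs : List A) → keep (length xs) xs ≡ xs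
keep-all xs = cong (λ l → drop l xs) (n∸n≡0 (length xs))

concatMap-split : ∀ {A B : Set} (f : A → List B) {x xs} → x ∈ xs →
  ∃₂ λ ys zs → xs ≡ ys ++ x ∷ zs × concatMap f xs ≡ concatMap f ys ++ f x ++ concatMap f zs
concatMap-split f {x} x∈ with ∈-∃++ x∈
... | ys , zs , refl = ys , zs , refl , concatMap-++ f ys (x ∷ zs)

length-∈-concatMap : ∀ {A B : Set} (f : A → List B) {x xs} → x ∈ xs → length (f x) ≤ length (concatMap f xs)
length-∈-concatMap f {x} x∈ with concatMap-split f x∈
... | ys , zs , _ , eq = ≤-trans (m≤m+n (length (f x)) (length (concatMap f zs))) (≤-trans (m≤n+m _ (length (concatMap f ys))) (≤-reflexive (sym
    (trans (cong length eq) (trans (length-++ (concatMap f ys)) (cong (length (concatMap f ys) +_) (length-++ (f x))))))))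

prog-extends : ∀ h → ∃ λ new → prog (suc h) ≡ new ++ prog h × 1 ≤ length new
prog-extends h = subst (λ L → ∃ λ new → L ≡ new ++ prog h × 1 ≤ length new) (sym (prog-suc h)) (lemma (hyp h) (prog h))
  where
  opaque
    unfolding Plan.roll
    nonempty : ∀ H → 1 ≤ length (Plan.trials H)
    nonempty H = ≤-trans (≤-trans (s≤s z≤n) (length-∈-concatMap (λ r → blinks r repeats) (∈-allFin leader)))
        (≤-trans (m≤m+n _ _) (≤-reflexive (sym (length-++ roll))))
      where open Plan H
  lemma : ∀ H B → ∃ λ new → extend H B ≡ new ++ B × 1 ≤ length new
  lemma H B with wellFormed? H
  ... | no _ = _ ∷ [] , refl , s≤s z≤n
  ... | yes wf with emits-suffix B (tours B) | emits-suffix (toured B) (routes B) | emits-suffix (gathered B) trials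
    where open Plan H
  ...   | n₁ , e₁ , _ | n₂ , e₂ , _ | n₃ , e₃ , l₃ = n₃ ++ n₂ ++ n₁ ,
            trans e₃ (trans (cong (n₃ ++_) (trans e₂ (trans (cong (n₂ ++_) e₁) (sym (++-assoc n₂ n₁ B))))) (sym (++-assoc n₃ (n₂ ++ n₁) B))) ,
            ≤-trans (≤-trans (nonempty H) (≤-reflexive (sym l₃))) (≤-trans (m≤m+n (length n₃) _) (≤-reflexive (sym (length-++ n₃))))

prog-extends* : ∀ h d → ∃ λ new → prog (d + h) ≡ new ++ prog h
prog-extends* h zero = [] , refl
prog-extends* h (suc d) with prog-extends (d + h) | prog-extends* h d
... | n₁ , e₁ , _ | n₂ , e₂ = n₁ ++ n₂ , trans e₁ (trans (cong (n₁ ++_) e₂) (sym (++-assoc n₁ n₂ _)))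

prog-grows : ∀ h → length (prog h) < length (prog (suc h))
prog-grows h with prog-extends h
... | new , e , l = ≤-trans (+-monoˡ-≤ _ l) (≤-reflexive (sym (trans (cong length e) (length-++ new))))

prog-long : ∀ h → h ≤ length (prog h)
prog-long zero = z≤n
prog-long (suc h) = ≤-trans (s≤s (prog-long h)) (prog-grows h)

opaque
  -- Lists are newest first, so each `prog h` is a suffix of the next one, and the first `x` slots
  -- are the last `x` entries of any program that is long enough; `prog x` is.
  pre : ℕ → List Slot
  pre x = keep x (prog x)

  pre-of : ∀ h new L → prog h ≡ new ++ L → pre (length L) ≡ L
  pre-of h new L eq with ≤-total h (length L)
  ... | inj₁ le with prog-extends* h (length L ∸ h)
  ...   | n₂ , e = trans (cong (keep (length L)) (trans (cong prog (sym (m∸n+n≡m le))) (trans e (trans (cong (n₂ ++_) eq) (sym (++-assoc n₂ new L))))))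
                     (trans (keep-++ (length L) (n₂ ++ new) L ≤-refl) (keep-all L))
  pre-of h new L eq | inj₂ le with prog-extends* (length L) (h ∸ length L)
  ...   | n₂ , e = trans (sym (keep-++ (length L) n₂ _ (prog-long (length L))))
                     (trans (cong (keep (length L)) (trans (sym e) (trans (cong prog (m∸n+n≡m le)) eq)))
                       (trans (keep-++ (length L) new L ≤-refl) (keep-all L)))

  pre-length : ∀ x → length (pre x) ≡ x
  pre-length x = trans (length-drop (length (prog x) ∸ x) (prog x)) (m∸[m∸n]≡n (prog-long x))

  pre-zero : pre 0 ≡ []
  pre-zero = keep-zero (prog 0)
    where
    keep-zero : ∀ (xs : List Slot) → keep 0 xs ≡ []
    keep-zero [] = refl
    keep-zero (x ∷ xs) = keep-zero xs

  slotAt : ℕ → Slot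
  slotAt x = first (pre (suc x))
    where
    first : List Slot → Slot
    first [] = mkSlot 0 [] 0
    first (sl ∷ _) = sl

  pre-suc : ∀ x → pre (suc x) ≡ slotAt x ∷ pre x
  pre-suc x with pre (suc x) in eq | pre-length (suc x)
  ... | sl ∷ L | len = cong (sl ∷_) (trans (sym (pre-of (suc x) (take d (prog (suc x)) ++ [ sl ]) L
          (trans (sym (take++drop≡id d (prog (suc x)))) (trans (cong (take d (prog (suc x)) ++_) eq) (sym (++-assoc (take d (prog (suc x))) [ sl ] L))))))
        (cong pre (suc-injective len)))
    where
    d : ℕ
    d = length (prog (suc x)) ∸ suc x

-- Schedules that lead back to the centre

module PlanFacts (h : Hyp) (wf : WellFormed h) where
  open Plan h public
  open WellFormed wf public

  -- Lifts a cut of one agent's walk to a cut of the interleaved schedule, that is, to a slot at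
  -- which the walk is at that point.
  ports-split : ∀ r cs {τ₁ τ₂} → ports r cs ≡ τ₁ ++ τ₂ → ∃₂ λ cs₁ cs₂ → cs ≡ cs₁ ++ cs₂ × ports r cs₁ ≡ τ₁
  ports-split r cs {[]} eq = [] , cs , refl , refl
  ports-split r ((r' , p) ∷ cs) {q ∷ τ₁} eq with r Fin.≟ r' in eq'
  ... | no _ with ports-split r cs {q ∷ τ₁} eq
  ...   | cs₁ , cs₂ , e , e' = (r' , p) ∷ cs₁ , cs₂ , cong ((r' , p) ∷_) e , skip
    where
    skip : ports r ((r' , p) ∷ cs₁) ≡ q ∷ τ₁
    skip rewrite eq' = e'
  ports-split r ((r' , p) ∷ cs) {q ∷ τ₁} eq | yes _ with ports-split r cs {τ₁} (proj₂ (∷-injective eq))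
  ...   | cs₁ , cs₂ , e , e' = (r' , p) ∷ cs₁ , cs₂ , cong ((r' , p) ∷_) e , take-one
    where
    take-one : ports r ((r' , p) ∷ cs₁) ≡ q ∷ τ₁
    take-one rewrite eq' = cong₂ _∷_ (proj₁ (∷-injective eq)) e'

  module _ (F : Fin agents → List ℕ) where

    private
      each : List (Fin agents) → List (Fin agents × ℕ)
      each = concatMap (λ r → by r (F r))

    ports-each-∉ : ∀ r xs → All (r ≢_) xs → ports r (each xs) ≡ []
    ports-each-∉ r [] [] = refl
    ports-each-∉ r (x ∷ xs) (r≢ ∷ ps) = trans (ports-++ r (by x (F x)) (each xs))
      (cong₂ _++_ (ports-by-other r≢ (F x)) (ports-each-∉ r xs ps))

    ports-each-∈ : ∀ r {xs} → Unique xs → r ∈ xs → ports r (each xs) ≡ F r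
    ports-each-∈ r {x ∷ xs} (x∉ ∷ u) (here refl) = trans (ports-++ r (by r (F r)) (each xs))
      (trans (cong₂ _++_ (ports-by r (F r)) (ports-each-∉ r xs x∉)) (++-identityʳ (F r)))
    ports-each-∈ r {x ∷ xs} (x∉ ∷ u) (there r∈) = trans (ports-++ r (by x (F x)) (each xs))
      (cong₂ _++_ (ports-by-other (λ e → All.lookup x∉ r∈ (sym e)) (F x)) (ports-each-∈ r u r∈))

    ports-each : ∀ r → ports r (each (allFin agents)) ≡ F r
    ports-each r = ports-each-∈ r (allFin⁺ agents) (∈-allFin r)

  Closed : List (Fin agents × ℕ) → Set
  Closed cs = ∀ r → Valid graph centre (ports r cs) × end graph centre (ports r cs) ≡ centre

  closed-[] : Closed []
  closed-[] r = tt , refl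

  closed-++ : ∀ cs ds → Closed cs → Closed ds → Closed (cs ++ ds)
  closed-++ cs ds c d r rewrite ports-++ r cs ds =
    valid-++ graph centre (ports r cs) (proj₁ (c r)) (subst (λ w → Valid graph w (ports r ds)) (sym (proj₂ (c r))) (proj₁ (d r))) ,
    trans (end-++ graph centre (ports r cs) _) (trans (cong (λ w → end graph w (ports r ds)) (proj₂ (c r))) (proj₂ (d r)))

  closed-concatMap : ∀ {A : Set} (f : A → List (Fin agents × ℕ)) xs → (∀ x → x ∈ xs → Closed (f x)) → Closed (concatMap f xs)
  closed-concatMap f [] c = closed-[]
  closed-concatMap f (x ∷ xs) c = closed-++ (f x) (concatMap f xs) (c x (here refl)) (closed-concatMap f xs (λ y y∈ → c y (there y∈)))

  closed-by : ∀ i ps → Valid graph centre ps → end graph centre ps ≡ centre → Closed (by i ps)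
  closed-by i ps val ends r with r Fin.≟ i
  ... | yes refl = subst (λ qs → Valid graph centre qs × end graph centre qs ≡ centre) (sym (ports-by i ps)) (val , ends)
  ... | no r≢ = subst (λ qs → Valid graph centre qs × end graph centre qs ≡ centre) (sym (ports-by-other r≢ ps)) (tt , refl)

  closed-blinks : ∀ r N → Closed (blinks r N)
  closed-blinks r zero = closed-[]
  closed-blinks r (suc N) = closed-++ (by r flip) (blinks r N)
    (closed-by r flip (centre-deg , proj₁ (lawful centre 0 centre-deg) , tt) (go-en graph lawful centre-deg)) (closed-blinks r N)

  opaque
    unfolding roll
    closed-roll : Closed roll
    closed-roll = closed-concatMap _ (allFin agents) (λ r _ → closed-blinks r repeats)

  ret-valid : ∀ u → Valid graph u (ret u)
  ret-valid u = subst (λ w → Valid graph w (ret u)) (path-end u) (back-valid graph lawful centre (path u) (path-valid u))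

  ret-end : ∀ u → end graph u (ret u) ≡ centre
  ret-end u = trans (cong (λ w → end graph w (ret u)) (sym (path-end u))) (end-back graph lawful centre (path u) (path-valid u))

  opaque
    unfolding tests
    test-node : ∀ u → path u ++ ret u ∈ tests
    test-node u = ∈-++⁺ˡ (∈-map⁺ (λ u → path u ++ ret u) (∈-allFin u))

    test-edge : ∀ u p → p < deg graph u → path u ++ p ∷ ret (go graph u p) ∈ tests
    test-edge u p lt = ∈-++⁺ʳ (map (λ u → path u ++ ret u) (allFin nodes)) (∈-concatMap⁺ (λ u → map (λ p → path u ++ p ∷ ret (go graph u p)) (upTo (deg graph u)))
      (Any.map (λ { refl → ∈-map⁺ (λ p → path u ++ p ∷ ret (go graph u p)) (∈-upTo⁺ lt) }) (∈-allFin u)))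

    tests-closed : ∀ ω → ω ∈ tests → Valid graph centre ω × end graph centre ω ≡ centre
    tests-closed ω ω∈ with ∈-++⁻ (map (λ u → path u ++ ret u) (allFin nodes)) ω∈
    ... | inj₁ m with ∈-map⁻ (λ u → path u ++ ret u) m
    ...   | u , _ , refl = valid-++ graph centre (path u) (path-valid u) (subst (λ w → Valid graph w (ret u)) (sym (path-end u)) (ret-valid u)) ,
              trans (end-++ graph centre (path u) _) (trans (cong (λ w → end graph w (ret u)) (path-end u)) (ret-end u))
    tests-closed ω ω∈ | inj₂ m with Any.satisfied (∈-concatMap⁻ (λ u → map (λ p → path u ++ p ∷ ret (go graph u p)) (upTo (deg graph u))) {xs = allFin nodes} m)
    ...   | u , m' with ∈-map⁻ (λ p → path u ++ p ∷ ret (go graph u p)) m'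
    ...     | p , p∈ , refl = valid-++ graph centre (path u) (path-valid u)
                  (subst (λ w → Valid graph w (p ∷ ret (go graph u p))) (sym (path-end u)) (∈-upTo⁻ p∈ , ret-valid (go graph u p))) ,
                trans (end-++ graph centre (path u) _) (trans (cong (λ w → end graph w (p ∷ ret (go graph u p))) (path-end u)) (ret-end (go graph u p)))

  closed-trial : ∀ i ω → ω ∈ tests → Closed (trial i ω)
  closed-trial i ω ω∈ = closed-++ roll _ closed-roll (closed-++ (by i ω) roll
    (closed-by i ω (proj₁ (tests-closed ω ω∈)) (proj₂ (tests-closed ω ω∈))) closed-roll)

  opaque
    unfolding explore exploreAll roll
    closed-explore : ∀ i → Closed (explore i)
    closed-explore i = closed-concatMap (trial i) tests (closed-trial i)

    closed-exploreAll : Closed exploreAll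
    closed-exploreAll = closed-concatMap explore (allFin agents) (λ i _ → closed-explore i)

    two≤roll : 2 ≤ length roll
    two≤roll = ≤-trans (s≤s (s≤s z≤n)) (length-∈-concatMap (λ r → blinks r repeats) (∈-allFin leader))

  module _ (B : List Slot) where

    opaque
      unfolding tours routes radius spread

      ports-tours : ∀ r → ports r (tours B) ≡ tour graph (at r B) (radius B)
      ports-tours = ports-each (λ r → tour graph (at r B) (radius B))

      ports-routes : ∀ r → ports r (routes B) ≡ ret (at r B)
      ports-routes = ports-each (λ r → ret (at r B))

      radius-ops : length B + length (routes B ++ trials) ≤ radius B
      radius-ops = m≤m+n _ _

      radius-paths : ∀ u v → length (ret u) + length (path v) ≤ radius B
      radius-paths u v = ≤-trans (+-mono-≤ (≤-trans (≤-reflexive (back-length graph centre (path u))) (length-∈-concatMap path (∈-allFin u)))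
        (length-∈-concatMap path (∈-allFin v))) (m≤n+m _ (length B + length (routes B ++ trials)))

    at-toured : ∀ r → at r (toured B) ≡ at r B
    at-toured r = trans (at-emits label-inj r B (tours B) (subst (Valid graph (at r B)) (sym (ports-tours r)) (proj₁ closed)))
                      (trans (cong (end graph (at r B)) (ports-tours r)) (proj₂ closed))
      where closed = tour-closed graph lawful (at r B) (radius B)

    at-gathered : ∀ r → at r (gathered B) ≡ centre
    at-gathered r = trans (at-emits label-inj r (toured B) (routes B)
        (subst₂ (Valid graph) (sym (at-toured r)) (sym (ports-routes r)) (ret-valid (at r B))))
        (trans (cong₂ (end graph) (at-toured r) (ports-routes r)) (ret-end (at r B)))

  at-centre : ∀ r L cs → at r L ≡ centre → Valid graph centre (ports r cs) → at r (emits L cs) ≡ end graph centre (ports r cs)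
  at-centre r L cs e val = trans (at-emits label-inj r L cs (subst (λ w → Valid graph w (ports r cs)) (sym e) val))
    (cong (λ w → end graph w (ports r cs)) e)

  module _ {n : ℕ} (G : Graph n) where

    -- The counterpart of `Closed` in the real graph, where the map is not yet trusted. Ports alone
    -- give it for blinks and for agents that are not walking; the walker's own tests need a token.
    Returns : Fin agents → List (Fin agents × ℕ) → Set
    Returns r cs = ∀ v → Match G graph v centre (ports r cs) → end G v (ports r cs) ≡ v

    returns-++ : ∀ r cs ds → Closed cs → Returns r cs → Returns r ds → Returns r (cs ++ ds)
    returns-++ r cs ds c a b v M rewrite ports-++ r cs ds with match-++⁻ G graph v centre (ports r cs) M
    ... | M₁ , M₂ = trans (end-++ G v (ports r cs) _) (trans (cong (λ w → end G w (ports r ds)) (a v M₁))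
           (b v (subst₂ (λ x y → Match G graph x y (ports r ds)) (a v M₁) (proj₂ (c r)) M₂)))

    returns-concatMap : ∀ {A : Set} r (f : A → List (Fin agents × ℕ)) xs → (∀ x → x ∈ xs → Closed (f x)) →
      (∀ x → x ∈ xs → Returns r (f x)) → Returns r (concatMap f xs)
    returns-concatMap r f [] c a v M = refl
    returns-concatMap r f (x ∷ xs) c a = returns-++ r (f x) (concatMap f xs) (c x (here refl)) (a x (here refl))
      (returns-concatMap r f xs (λ y y∈ → c y (there y∈)) (λ y y∈ → a y (there y∈)))

    returns-by-other : ∀ {r i} → r ≢ i → ∀ ps → Returns r (by i ps)
    returns-by-other r≢ ps v M rewrite ports-by-other r≢ ps = refl

    module _ (lawG : Lawful G) where

      -- The second port of a blink is the entry port just recorded, and by lawfulness it leads back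
      -- in any graph.
      returns-blinks : ∀ r i N → Returns r (blinks i N)
      returns-blinks r i zero v M = refl
      returns-blinks r i (suc N) = returns-++ r (by i flip) (blinks i N)
          (closed-by i flip (centre-deg , proj₁ (lawful centre 0 centre-deg) , tt) (go-en graph lawful centre-deg)) one (returns-blinks r i N)
        where
        self : Returns i (by i flip)
        self v M rewrite ports-by i flip = let (_ , lt , e , _) = M in trans (cong (go G (go G v 0)) (sym e)) (go-en G lawG lt)
        one : Returns r (by i flip)
        one = [ (λ { refl → self }) , (λ r≢ → returns-by-other r≢ flip) ]′ (toSum (r Fin.≟ i))

      opaque
        unfolding roll

        returns-roll : ∀ r → Returns r roll
        returns-roll r = returns-concatMap r _ (allFin agents) (λ i _ → closed-blinks i repeats) (λ i _ → returns-blinks r i repeats)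

        roll-split : ∀ j → ∃₂ λ R₁ R₂ → roll ≡ R₁ ++ blinks j repeats ++ R₂ × Closed R₁ × (∀ r → Returns r R₁)
        roll-split j with concatMap-split (λ r → blinks r repeats) (∈-allFin j)
        ... | ys , zs , _ , eq = concatMap (λ r → blinks r repeats) ys , concatMap (λ r → blinks r repeats) zs , eq , closed-concatMap (λ r → blinks r repeats) ys (λ i _ → closed-blinks i repeats) ,
              λ r → returns-concatMap r (λ r → blinks r repeats) ys (λ i _ → closed-blinks i repeats) (λ i _ → returns-blinks r i repeats)

      returns-trial : ∀ {r i} → r ≢ i → ∀ ω → ω ∈ tests → Returns r (trial i ω)
      returns-trial {r} {i} r≢ ω ω∈ = returns-++ r roll _ closed-roll (returns-roll r)
        (returns-++ r (by i ω) roll (closed-by i ω (proj₁ (tests-closed ω ω∈)) (proj₂ (tests-closed ω ω∈))) (returns-by-other r≢ ω) (returns-roll r))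

      opaque
        unfolding explore exploreAll

        explore-split : ∀ i {ω} → ω ∈ tests → ∃₂ λ T₁ T₂ → explore i ≡ T₁ ++ trial i ω ++ T₂ × Closed T₁ × (∀ {r} → r ≢ i → Returns r T₁)
        explore-split i ω∈ with concatMap-split (trial i) ω∈
        ... | ys , zs , eq' , eq = concatMap (trial i) ys , concatMap (trial i) zs , eq , closed-concatMap (trial i) ys (λ ω → closed-trial i ω ∘ sub) ,
              λ {r} r≢ → returns-concatMap r (trial i) ys (λ ω → closed-trial i ω ∘ sub) (λ ω → returns-trial r≢ ω ∘ sub)
          where
          sub : ∀ {ω} → ω ∈ ys → ω ∈ tests
          sub ω∈ = subst (_ ∈_) (sym eq') (∈-++⁺ˡ ω∈)

        exploreAll-split : ∀ i → ∃₂ λ E₁ E₂ → exploreAll ≡ E₁ ++ explore i ++ E₂ × Closed E₁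
        exploreAll-split i with concatMap-split explore (∈-allFin i)
        ... | ys , zs , _ , eq = concatMap explore ys , concatMap explore zs , eq , closed-concatMap explore ys (λ i _ → closed-explore i)

  opaque
    unfolding repeats
    repeats-def : repeats ≡ suc (3 * agents + agents)
    repeats-def = refl

-- Clock 0 means dormant and `b` is the wake-up condition; a positive clock never pauses.
tick : Bool → ℕ → ℕ
tick b zero = if b then 1 else 0
tick b (suc s) = suc (suc s)

tick-≤ : ∀ b s → tick b s ≤ suc s
tick-≤ true zero = s≤s z≤n
tick-≤ false zero = z≤n
tick-≤ b (suc s) = ≤-refl

tick-suc : ∀ b s → 1 ≤ s → tick b s ≡ suc s
tick-suc b (suc s) _ = refl

-- Clocks

-- The world in which agents follow the program and never stop: trajectories do not depend on
-- the observed counts, so the configuration is determined by the vector of local clocks.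
module World {n : ℕ} (G : Graph n) {K : ℕ} (lab : Fin K → ℕ) (start : Fin K → Fin n) (wk : Fin K → ℕ → Bool) where

  opaque
    X : Fin K → ℕ → Fin n
    X z x = proj₁ (run G (lab z) (start z) (pre x))

    X-def : ∀ z x → X z x ≡ proj₁ (run G (lab z) (start z) (pre x))
    X-def z x = refl

    X-start : ∀ z → X z 0 ≡ start z
    X-start z = cong (λ B → proj₁ (run G (lab z) (start z) B)) pre-zero

    crowd : (Fin K → ℕ) → Fin n → ℕ
    crowd c v = ♯ (λ z → X z (σ (c z)) Fin.≟ v)

    crowd-def : ∀ c v → crowd c v ≡ ♯ (λ z → X z (σ (c z)) Fin.≟ v)
    crowd-def c v = refl

    clock : ℕ → Fin K → ℕ
    clock zero z = 0
    clock (suc t) z = tick (wk z t ∨ (2 ≤ᵇ crowd (clock t) (X z (σ (clock t z))))) (clock t z)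

    clock-zero : ∀ z → clock 0 z ≡ 0
    clock-zero z = refl

    clock-suc : ∀ t z → clock (suc t) z ≡ tick (wk z t ∨ (2 ≤ᵇ crowd (clock t) (X z (σ (clock t z))))) (clock t z)
    clock-suc t z = refl

  pos : ℕ → Fin K → Fin n
  pos t z = X z (σ (clock t z))

  clock-step : ∀ t z → clock (suc t) z ≤ suc (clock t z)
  clock-step t z = ≤-trans (≤-reflexive (clock-suc t z)) (tick-≤ _ (clock t z))

  clock-next : ∀ t z → 1 ≤ clock t z → clock (suc t) z ≡ suc (clock t z)
  clock-next t z pos = trans (clock-suc t z) (tick-suc _ (clock t z) pos)

  clock-≤ : ∀ d t z → clock (d + t) z ≤ d + clock t z
  clock-≤ zero t z = ≤-refl
  clock-≤ (suc d) t z = ≤-trans (clock-step (d + t) z) (s≤s (clock-≤ d t z))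

  clock-≡ : ∀ d t z → 1 ≤ clock t z → clock (d + t) z ≡ d + clock t z
  clock-≡ zero t z _ = refl
  clock-≡ (suc d) t z pos = trans (clock-next (d + t) z (≤-trans pos (≤-trans (m≤n+m _ d) (≤-reflexive (sym ih))))) (cong suc ih)
    where ih = clock-≡ d t z pos

  clock-mono : ∀ {t t'} z → t ≤ t' → clock t z ≤ clock t' z
  clock-mono {t} {t'} z le with clock t z in e
  ... | zero = z≤n
  ... | suc s = subst₂ _≤_ e (cong (λ u → clock u z) (m∸n+n≡m le))
        (≤-trans (m≤n+m _ (t' ∸ t)) (≤-reflexive (sym (clock-≡ (t' ∸ t) t z (subst (1 ≤_) (sym e) (s≤s z≤n))))))

  clock-reach : ∀ t z s → s ≤ clock t z → ∃ λ t' → t' ≤ t × clock t' z ≡ s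
  clock-reach zero z s le = 0 , z≤n , trans (clock-zero z) (sym (n≤0⇒n≡0 (≤-trans le (≤-reflexive (clock-zero z)))))
  clock-reach (suc t) z s le with s ℕ.≟ clock (suc t) z
  ... | yes eq = suc t , ≤-refl , sym eq
  ... | no neq with clock-reach t z s (s≤s⁻¹ (≤-trans (≤∧≢⇒< le neq) (clock-step t z)))
  ...   | t' , le' , eq = t' , m≤n⇒m≤1+n le' , eq

  -- A dormant `z` still stands at its start, so the visitor raises the count there to two.
  clock-wakes : ∀ t z a → z ≢ a → pos t a ≡ start z → 1 ≤ clock (suc t) z
  clock-wakes t z a z≢a eq = subst (1 ≤_) (sym (clock-suc t z)) (lemma (clock t z) refl)
    where
    lemma : ∀ s → clock t z ≡ s → 1 ≤ tick (wk z t ∨ (2 ≤ᵇ crowd (clock t) (X z (σ s)))) s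
    lemma (suc s) e = s≤s z≤n
    lemma zero e = subst (λ b → 1 ≤ (if b then 1 else 0)) (sym (trans (cong (wk z t ∨_) (seen _ both)) (∨-zeroʳ (wk z t)))) ≤-refl
      where
      both : 2 ≤ crowd (clock t) (X z 0)
      both = subst (2 ≤_) (sym (crowd-def (clock t) (X z 0)))
        (♯-two (λ y → X y (σ (clock t y)) Fin.≟ X z 0) z a z≢a (cong (λ s → X z (σ s)) e) (trans eq (sym (X-start z))))
      seen : ∀ c → 2 ≤ c → (2 ≤ᵇ c) ≡ true
      seen (suc (suc c)) _ = refl
      seen (suc zero) (s≤s ())

  -- Other agents at the samples of one observer

  module Watch (a : Fin K) (w : ℕ) (awake : clock w a ≡ 1) where

    -- The round in which the clock of `a` reads `4 ^ x`; it reads 1, not 0, in round `w`.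
    τ : ℕ → ℕ
    τ x = (4 ^ x ∸ 1) + w

    S : Fin K → ℕ → ℕ
    S z x = clock (τ x) z

    Y : Fin K → ℕ → ℕ
    Y z x = σ (S z x)

    P : Fin K → ℕ → Fin n
    P z x = pos (τ x) z

    τ-+ : ∀ {x x'} → x ≤ x' → ∃ λ d → τ x' ≡ d + τ x × d + 4 ^ x ≡ 4 ^ x'
    τ-+ {x} {x'} le = 4 ^ x' ∸ 4 ^ x ,
      trans (cong (_+ w) (trans (cong (_∸ 1) (sym (m∸n+n≡m (4^-mono le)))) (+-∸-assoc (4 ^ x' ∸ 4 ^ x) (4^-pos x)))) (+-assoc (4 ^ x' ∸ 4 ^ x) _ w) ,
      m∸n+n≡m (4^-mono le)

    S-self : ∀ x → S a x ≡ 4 ^ x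
    S-self x = trans (clock-≡ (4 ^ x ∸ 1) w a (≤-reflexive (sym awake))) (trans (cong (4 ^ x ∸ 1 +_) awake) (m∸n+n≡m (4^-pos x)))

    Y-self : ∀ x → Y a x ≡ x
    Y-self x = trans (cong σ (S-self x)) (σ-sample x)

    S-≤ : ∀ z {x x'} → x ≤ x' → S z x' + 4 ^ x ≤ S z x + 4 ^ x'
    S-≤ z {x} {x'} le with τ-+ le
    ... | d , e , e' = ≤-trans (+-monoˡ-≤ (4 ^ x) (≤-trans (≤-reflexive (cong (λ t → clock t z) e)) (clock-≤ d (τ x) z)))
                        (≤-reflexive (trans (cong (_+ 4 ^ x) (+-comm d (S z x))) (trans (+-assoc (S z x) d _) (cong (S z x +_) e'))))

    S-≡ : ∀ z {x x'} → x ≤ x' → 1 ≤ S z x → S z x' + 4 ^ x ≡ S z x + 4 ^ x'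
    S-≡ z {x} {x'} le pos with τ-+ le
    ... | d , e , e' = trans (cong (_+ 4 ^ x) (trans (cong (λ t → clock t z) e) (clock-≡ d (τ x) z pos)))
                         (trans (cong (_+ 4 ^ x) (+-comm d (S z x))) (trans (+-assoc (S z x) d _) (cong (S z x +_) e')))

    S-mono : ∀ z {x x'} → x ≤ x' → S z x ≤ S z x'
    S-mono z {x} {x'} le with 1 ≤? S z x
    ... | no ¬pos = subst (_≤ S z x') (sym (n<1⇒n≡0 (≰⇒> ¬pos))) z≤n
    ... | yes pos = +-cancelʳ-≤ (4 ^ x) _ _ (≤-trans (+-monoʳ-≤ (S z x) (4^-mono le)) (≤-reflexive (sym (S-≡ z le pos))))

    Y-mono : ∀ z {x x'} → x ≤ x' → Y z x ≤ Y z x'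
    Y-mono z le = σ-mono (S-mono z le)

    -- From sample `x` to `x'` an awake clock gains at least three quarters of `4 ^ x'`, while slot
    -- `x' - 1` lies at one half of it.
    not-young : ∀ z {x x'} → x < x' → 1 ≤ S z x → x' ≤ Y z x'
    not-young z {x} {suc m} (s≤s le) pos = σ-after (+-cancelʳ-< (4 ^ m) _ _ (begin-strict
      2 * 4 ^ m + 4 ^ m       <⟨ s≤s (≤-reflexive (lemma (4 ^ m))) ⟩
      1 + 3 * 4 ^ m           ≤⟨ +-monoˡ-≤ (3 * 4 ^ m) pos ⟩
      S z x + 3 * 4 ^ m       ≤⟨ +-cancelʳ-≤ (4 ^ x) _ _ (≤-trans (≤-reflexive (+-assoc (S z x) (3 * 4 ^ m) (4 ^ x)))
                                   (≤-trans (+-monoʳ-≤ (S z x) (≤-trans (+-monoʳ-≤ (3 * 4 ^ m) (4^-mono le)) (≤-reflexive (lemma' (4 ^ m)))))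
                                     (≤-reflexive (sym (S-≡ z (m≤n⇒m≤1+n le) pos))))) ⟩
      S z (suc m)             ≤⟨ m≤m+n _ _ ⟩
      S z (suc m) + 4 ^ m     ∎))
      where
      open ≤-Reasoning
      lemma : ∀ q → 2 * q + q ≡ 3 * q
      lemma = solve-∀
      lemma' : ∀ q → 3 * q + q ≡ 4 * q
      lemma' = solve-∀

    -- Not having passed slot `x`, the agent leads by at most `4 ^ x`, too little to pass slot `x'`
    -- by sample `x'`. The other bound is `not-young`.
    catch-up : ∀ z {x x'} → x < x' → 1 ≤ S z x → Y z x ≤ x → Y z x' ≡ x'
    catch-up z {x} {x'} lt pos le = ≤-antisym (σ-before (+-cancelʳ-≤ (4 ^ x) _ _ (begin
        S z x' + 4 ^ x            ≡⟨ S-≡ z (<⇒≤ lt) pos ⟩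
        S z x + 4 ^ x'            ≤⟨ +-monoˡ-≤ (4 ^ x') (≤-trans (σ-upper (S z x)) (slotTime-mono le)) ⟩
        2 * 4 ^ x + 4 ^ x'        ≡⟨ lemma (4 ^ x) (4 ^ x') ⟩
        4 ^ x + (4 ^ x' + 4 ^ x)  ≤⟨ +-monoˡ-≤ _ (4^-mono (<⇒≤ lt)) ⟩
        4 ^ x' + (4 ^ x' + 4 ^ x) ≡⟨ lemma' (4 ^ x) (4 ^ x') ⟩
        2 * 4 ^ x' + 4 ^ x        ∎))) (not-young z lt pos)
      where
      open ≤-Reasoning
      lemma : ∀ q r → 2 * q + r ≡ q + (r + q)
      lemma = solve-∀
      lemma' : ∀ q r → r + (r + q) ≡ 2 * r + q
      lemma' = solve-∀

    Aligned : Fin K → ℕ → Set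
    Aligned z x = 1 ≤ S z x × Y z x ≡ x

    aligned-later : ∀ z {x x'} → x ≤ x' → Aligned z x → Aligned z x'
    aligned-later z le (pos , al) with m≤n⇒m<n∨m≡n le
    ... | inj₂ refl = pos , al
    ... | inj₁ lt = ≤-trans pos (S-mono z le) , catch-up z lt pos (≤-reflexive al)

    dormant-slow : ∀ z {x x'} → x ≤ x' → S z x ≡ 0 → Y z x' ≤ x'
    dormant-slow z {x} {x'} le d = σ-before (≤-trans (m≤m+n _ (4 ^ x)) (≤-trans (S-≤ z le)
      (≤-trans (≤-reflexive (cong (_+ 4 ^ x') d)) (m≤m+n _ _))))

    -- An agent ahead of `a` at sample `x` was already on a scale `4 ^ Y z y` of at least `4 ^ x` at
    -- sample `y`. Until sample `x + 1` its clock gains at most four such units, not enough for two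
    -- slots.
    old-moves-once : ∀ z {y x} → y ≤ x → x < Y z x → Y z (suc x) ≤ suc (Y z y)
    old-moves-once z {y} {x} le old = σ-before (begin
        S z (suc x)                       ≤⟨ +-cancelʳ-≤ (4 ^ y) _ _ (≤-trans (S-≤ z (m≤n⇒m≤1+n le)) (m≤m+n _ (4 ^ y))) ⟩
        S z y + 4 ^ suc x                 ≤⟨ +-mono-≤ (σ-upper (S z y)) (*-monoʳ-≤ 4 (4^-mono x≤Y)) ⟩
        2 * 4 ^ Y z y + 4 * 4 ^ Y z y     ≤⟨ m≤m+n _ (2 * 4 ^ Y z y) ⟩
        2 * 4 ^ Y z y + 4 * 4 ^ Y z y + 2 * 4 ^ Y z y ≡⟨ lemma (4 ^ Y z y) ⟩
        8 * 4 ^ Y z y                     ≡⟨ slotTime-suc (Y z y) ⟨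
        slotTime (suc (Y z y))            ∎)
      where
      open ≤-Reasoning
      lemma : ∀ q → 2 * q + 4 * q + 2 * q ≡ 8 * q
      lemma = solve-∀
      lemma₂ : ∀ q → q + q ≡ 2 * q
      lemma₂ = solve-∀
      -- The lead over `a` never grows with time, and it exceeds `4 ^ x` at sample `x`; so it
      -- already did at sample `y`.
      big : 4 ^ x < S z y
      big = +-cancelʳ-< (4 ^ x) _ _ (begin-strict
        4 ^ x + 4 ^ x   ≡⟨ lemma₂ (4 ^ x) ⟩
        2 * 4 ^ x       <⟨ σ-lower (S z x) old ⟩
        S z x           ≤⟨ m≤m+n _ _ ⟩
        S z x + 4 ^ y   ≤⟨ S-≤ z le ⟩
        S z y + 4 ^ x   ∎)
      x≤Y : x ≤ Y z y
      x≤Y = ≮⇒≥ λ lt → <⇒≱ big (begin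
        S z y                 ≤⟨ σ-upper (S z y) ⟩
        2 * 4 ^ Y z y         ≤⟨ *-monoˡ-≤ (4 ^ Y z y) {2} {4} (s≤s (s≤s z≤n)) ⟩
        4 ^ suc (Y z y)       ≤⟨ 4^-mono lt ⟩
        4 ^ x                 ∎)

    wakes-before : ∀ z {x x'} → z ≢ a → P a x ≡ start z → x < x' → 1 ≤ S z x'
    wakes-before z {x} {x'} z≢a eq lt = ≤-trans (clock-wakes (τ x) z a z≢a eq) (clock-mono z (+-monoˡ-≤ w (begin
      suc (4 ^ x ∸ 1)   ≡⟨ +-∸-assoc 1 (4^-pos x) ⟨
      4 ^ x             ≤⟨ m≤m+n _ _ ⟩
      4 ^ x + (2 * 4 ^ x) ≡⟨ lemma (4 ^ x) ⟩
      3 * 4 ^ x + 0     ≤⟨ +-monoʳ-≤ (3 * 4 ^ x) z≤n ⟩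
      3 * 4 ^ x + (4 ^ x ∸ 1)   ≡⟨ +-∸-assoc (3 * 4 ^ x) (4^-pos x) ⟨
      3 * 4 ^ x + 4 ^ x ∸ 1     ≡⟨ cong (_∸ 1) (lemma' (4 ^ x)) ⟩
      4 ^ suc x ∸ 1     ≤⟨ ∸-monoˡ-≤ 1 (4^-mono lt) ⟩
      4 ^ x' ∸ 1        ∎)))
      where
      open ≤-Reasoning
      lemma : ∀ q → q + 2 * q ≡ 3 * q + 0
      lemma = solve-∀
      lemma' : ∀ q → 3 * q + q ≡ 4 * q
      lemma' = solve-∀

    -- What can make an unaligned agent change slot between the samples x and x + 1:
    -- waking up, catching up, or (an agent ahead of a) its only move since sample y.
    Event : ℕ → Fin 3 → Fin K → ℕ → Set
    Event y zero z x = S z x ≡ 0 × 1 ≤ S z (suc x)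
    Event y (suc zero) z x = ¬ Aligned z x × Aligned z (suc x)
    Event y (suc (suc zero)) z x = Y z x ≡ Y z y × Y z (suc x) ≢ Y z y

    -- Each kind of event crosses a threshold that is never crossed back: clocks and slot numbers
    -- are monotone and alignment persists.
    event-once : ∀ y e z {x x'} → y ≤ x → x < x' → Event y e z x → Event y e z x' → ⊥
    event-once y zero z le lt (_ , pos) (dorm , _) = 1+n≰n (≤-trans (≤-trans pos (S-mono z lt)) (≤-reflexive dorm))
    event-once y (suc zero) z le lt (_ , al) (¬al , _) = ¬al (aligned-later z lt al)
    event-once y (suc (suc zero)) z le lt (_ , ≢y) (≡y , _) =
      ≢y (≤-antisym (≤-trans (Y-mono z lt) (≤-reflexive ≡y)) (Y-mono z (m≤n⇒m≤1+n le)))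

    old-event : ∀ y z {x} → y ≤ x → x < Y z x → Y z x ≢ Y z (suc x) → Event y (suc (suc zero)) z x
    old-event y z {x} le old ch = ≤-antisym (s≤s⁻¹ (≤-trans grows (old-moves-once z le old))) (Y-mono z le) ,
      λ eq → <⇒≱ grows (≤-trans (≤-reflexive eq) (Y-mono z le))
      where
      grows : Y z x < Y z (suc x)
      grows = ≤∧≢⇒< (Y-mono z (n≤1+n x)) ch

    event : ∀ y z {x} → y ≤ x → Y z x ≢ Y z (suc x) → ¬ Aligned z x → ∃ λ e → Event y e z x
    event y z {x} le ch ¬al with 1 ≤? S z x | 1 ≤? S z (suc x) | Y z x ≤? x
    ... | no ¬pos | no ¬pos' | _ = ⊥-elim (ch (cong σ (trans (n<1⇒n≡0 (≰⇒> ¬pos)) (sym (n<1⇒n≡0 (≰⇒> ¬pos'))))))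
    ... | no ¬pos | yes pos' | _ = zero , n<1⇒n≡0 (≰⇒> ¬pos) , pos'
    ... | yes pos | no ¬pos' | _ = ⊥-elim (¬pos' (≤-trans pos (S-mono z (n≤1+n x))))
    ... | yes pos | yes pos' | yes young = suc zero , ¬al , pos' , catch-up z ≤-refl pos young
    ... | yes pos | yes pos' | no old = suc (suc zero) , old-event y z le (≰⇒> old) ch

-- Soundness

choose : ∀ N {A B : Fin N → Set} → (∀ m → A m ⊎ B m) → ∃ A ⊎ (∀ m → B m)
choose zero f = inj₂ λ ()
choose (suc N) {A} {B} f with f zero | choose N {λ m → A (suc m)} {λ m → B (suc m)} (λ m → f (suc m))
... | inj₁ a | _ = inj₁ (zero , a)
... | inj₂ b | inj₁ (m , a) = inj₁ (suc m , a)
... | inj₂ b | inj₂ bs = inj₂ λ { zero → b ; (suc m) → bs m }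

no-injective-codes : ∀ {N M} {E : ℕ → Set} → M < N → (code : ∀ {m} → E m → Fin M) →
  (∀ {m m'} → m < m' → (p : E m) (q : E m') → code p ≢ code q) → (∀ (m : Fin N) → E (toℕ m)) → ⊥
no-injective-codes few code once es with Fin.pigeonhole few (λ m → code (es m))
... | p , q , p<q , eq = once p<q (es p) (es q) eq

join-injective : ∀ {k l} {p q : Fin k ⊎ Fin l} → join k l p ≡ join k l q → p ≡ q
join-injective {k} {l} {p} {q} eq = trans (sym (Fin.splitAt-join k l p)) (trans (cong (splitAt k) eq) (Fin.splitAt-join k l q))

match-end : ∀ {n m} (G : Graph n) (H : Graph m) v u ps → Match G H v u ps → deg G (end G v ps) ≡ deg H (end H u ps)
match-end G H v u [] d = d
match-end G H v u (p ∷ ps) (_ , _ , _ , M) = match-end G H _ _ ps M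

-- From closed walks to an isomorphism

module Cover {m n : ℕ} (H : Graph m) (G : Graph n) (lawH : Lawful H) (lawG : Lawful G) (c : Fin m) (c* : Fin n)
  (path : Fin m → List ℕ) (path-valid : ∀ u → Valid H c (path u)) (path-end : ∀ u → end H c (path u) ≡ u)
  (conn : ∀ v w → ∃ λ π → Valid G v π × end G v π ≡ w)
  (node : ∀ u → Match G H c* c (path u))
  (edge : ∀ u p → p < deg H u → Match G H c* c (path u ++ p ∷ back H c (path (go H u p)))
                              × end G c* (path u ++ p ∷ back H c (path (go H u p))) ≡ c*)
  (fibre : ∀ u → end G c* (path u) ≡ c* → u ≡ c) where

  f : Fin m → Fin n
  f u = end G c* (path u)

  private
    ret : Fin m → List ℕ
    ret u = back H c (path u)

    ret-valid : ∀ u → Valid H u (ret u)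
    ret-valid u = subst (λ w → Valid H w (ret u)) (path-end u) (back-valid H lawH c (path u) (path-valid u))

    ret-end : ∀ u → end H u (ret u) ≡ c
    ret-end u = trans (cong (λ w → end H w (ret u)) (sym (path-end u))) (end-back H lawH c (path u) (path-valid u))

    ret-back : ∀ u → back H u (ret u) ≡ path u
    ret-back u = trans (cong (λ w → back H w (ret u)) (sym (path-end u))) (back-back H lawH c (path u) (path-valid u))

    -- Behind the edge, the rest of the test is the return route of `go H u p`. It ends at `c*`, and
    -- reversed from there it is the path to `go H u p`; so the node behind the edge is the image of
    -- that node.
    crossing : ∀ u p → p < deg H u → en G (f u) p ≡ en H u p × go G (f u) p ≡ f (go H u p)
    crossing u p lt = en≡ , trans (sym (end-back G lawG y (ret u') (match-valid G H y u' (ret u') M)))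
        (cong₂ (end G) closes (trans (match-back G H y u' (ret u') M) (ret-back u')))
      where
      u' = go H u p
      y = go G (f u) p
      whole : Match G H (f u) u (p ∷ ret u')
      whole = subst (λ w → Match G H (f u) w (p ∷ ret u')) (path-end u) (proj₂ (match-++⁻ G H c* c (path u) (proj₁ (edge u p lt))))
      en≡ : en G (f u) p ≡ en H u p
      en≡ = proj₁ (proj₂ (proj₂ whole))
      M : Match G H y u' (ret u')
      M = proj₂ (proj₂ (proj₂ whole))
      closes : end G y (ret u') ≡ c*
      closes = trans (sym (end-++ G c* (path u) (p ∷ ret u'))) (proj₂ (edge u p lt))

  morphism : Morphism H G f
  morphism = record
    { deg-f = λ u → trans (match-end G H c* c (path u) (node u)) (cong (deg H) (path-end u))
    ; go-f = λ u p lt → proj₂ (crossing u p lt)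
    ; en-f = λ u p lt → proj₁ (crossing u p lt) }

  open Morphism morphism

  surjective : ∀ v → ∃ λ u → f u ≡ v
  surjective v with conn (f c) v
  ... | π , val , ends = end H c π , trans (sym (end-f c π (valid-f c π val))) ends

  -- `path c` may be a nonempty closed walk of the map. That its image also closes up has to be
  -- derived, from surjectivity and `fibre`.
  f-centre : f c ≡ c*
  f-centre with surjective c*
  ... | u , eq = trans (cong f (sym (fibre u eq))) eq

  -- The return route of `u`, walked from `u'`, ends above `c*` and hence at `c`. Reversed it is
  -- `path u`, so `path u` leads from `c` to both `u` and `u'`.
  injective : ∀ u u' → f u ≡ f u' → u ≡ u'
  injective u u' eq = trans (sym (path-end u)) (trans (cong₂ (end H) (sym w≡c) (sym back≡)) (end-back H lawH u' (ret u) val'))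
    where
    val' : Valid H u' (ret u)
    val' = valid-f u' (ret u) (subst (λ w → Valid G w (ret u)) eq (match-valid G H (f u) u (ret u) (match-f u (ret u) (ret-valid u))))
    w≡c : end H u' (ret u) ≡ c
    w≡c = fibre _ (trans (sym (end-f u' (ret u) val')) (trans (cong (λ w → end G w (ret u)) (sym eq))
      (trans (end-f u (ret u) (ret-valid u)) (trans (cong f (ret-end u)) f-centre))))
    back≡ : back H u' (ret u) ≡ path u
    back≡ = trans (sym (match-back G H (f u') u' (ret u) (match-f u' (ret u) val')))
      (trans (cong (λ w → back G w (ret u)) (sym eq)) (trans (match-back G H (f u) u (ret u) (match-f u (ret u) (ret-valid u))) (ret-back u)))

-- An isomorphism of the hypothesis with the network. No observer occurs in it, which is why the
-- verdicts of different agents coincide.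
record Truth {n : ℕ} (G : Graph n) {K : ℕ} (lab : Fin K → ℕ) (start : Fin K → Fin n) (H : Hyp) : Set where
  open Hyp H
  field
    f          : Fin nodes → Fin n
    morphism   : Morphism graph G f
    f-inj      : ∀ u u' → f u ≡ f u' → u ≡ u'
    f-surj     : ∀ v → ∃ λ u → f u ≡ v
    agent      : Fin agents → Fin K
    agent-lab  : ∀ r → lab (agent r) ≡ label r
    agent-home : ∀ r → start (agent r) ≡ f (home r)
    agent-surj : ∀ z → ∃ λ r → agent r ≡ z

other : ∀ {k} → 2 ≤ k → (i : Fin k) → ∃ λ j → j ≢ i
other {suc (suc k)} _ zero = suc zero , λ ()
other {suc (suc k)} _ (suc i) = zero , λ ()
other {suc zero} (s≤s ()) i

-- The slots of one hypothesis inside the program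

module Phase {n : ℕ} (G : Graph n) (lawG : Lawful G) {K : ℕ} (lab : Fin K → ℕ)
             (start : Fin K → Fin n) (wk : Fin K → ℕ → Bool) (h : ℕ) (wf : WellFormed (hyp h)) where
  open PlanFacts (hyp h) wf public
  open World G lab start wk public

  Cmds : Set
  Cmds = List (Fin agents × ℕ)

  B : List Slot
  B = prog h

  assembly whole : Cmds
  assembly = tours B ++ routes B
  whole = assembly ++ trials

  ⟦_⟧ : Cmds → List Slot
  ⟦ cs ⟧ = emits B cs

  ν : Cmds → ℕ
  ν cs = length B + length cs

  next-prog : prog (suc h) ≡ ⟦ whole ⟧
  next-prog = trans (trans (prog-suc h) lemma) (sym (trans (emits-++ B assembly trials) (cong (λ L → emits L trials) (emits-++ B (tours B) (routes B)))))
    where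
    lemma : extend (hyp h) B ≡ finished B
    lemma with wellFormed? (hyp h)
    ... | yes _ = refl
    ... | no ¬wf = ⊥-elim (¬wf wf)

  Prefix : Cmds → Set
  Prefix cs = ∃ λ ds → whole ≡ cs ++ ds

  prefix-++ : ∀ cs ds → Prefix (cs ++ ds) → Prefix cs
  prefix-++ cs ds (es , eq) = ds ++ es , trans eq (++-assoc cs ds es)

  ν-++ : ∀ cs ds → ν (cs ++ ds) ≡ ν cs + length ds
  ν-++ cs ds = trans (cong (length B +_) (length-++ cs)) (sym (+-assoc (length B) (length cs) (length ds)))

  ν-mono : ∀ cs ds → ν cs ≤ ν (cs ++ ds)
  ν-mono cs ds = ≤-trans (m≤m+n _ (length ds)) (≤-reflexive (sym (ν-++ cs ds)))

  ν-prefix : ∀ cs → Prefix cs → ν cs ≤ ν whole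
  ν-prefix cs (ds , eq) = ≤-trans (ν-mono cs ds) (≤-reflexive (cong ν (sym eq)))

  pre-ν : ∀ cs → Prefix cs → pre (ν cs) ≡ ⟦ cs ⟧
  pre-ν cs (ds , eq) with emits-suffix ⟦ cs ⟧ ds
  ... | new , e , _ = trans (cong pre (sym (emits-length B cs)))
        (pre-of (suc h) new ⟦ cs ⟧ (trans next-prog (trans (cong ⟦_⟧ eq) (trans (emits-++ B cs ds) e))))

  slot-prefix : ∀ y → length B ≤ y → y ≤ ν whole → ∃ λ cs → Prefix cs × ν cs ≡ y
  slot-prefix y l u = take d whole , (drop d whole , sym (take++drop≡id d whole)) ,
      trans (cong (length B +_) (trans (length-take d whole) (m≤n⇒m⊓n≡m d≤))) (m+[n∸m]≡n l)
    where
    d = y ∸ length B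
    d≤ : d ≤ length whole
    d≤ = ≤-trans (∸-monoˡ-≤ (length B) u) (≤-reflexive (m+n∸m≡n (length B) (length whole)))

  X-ν : ∀ z cs → Prefix cs → X z (ν cs) ≡ proj₁ (run G (lab z) (start z) ⟦ cs ⟧)
  X-ν z cs p = trans (X-def z (ν cs)) (cong (λ L → proj₁ (run G (lab z) (start z) L)) (pre-ν cs p))

  Outsider : Fin K → Set
  Outsider z = ∀ r → label r ≢ lab z

  X-outsider : ∀ z → Outsider z → ∀ y → length B ≤ y → y ≤ ν whole → X z y ≡ proj₁ (run G (lab z) (start z) B)
  X-outsider z out y l u with slot-prefix y l u
  ... | cs , p , refl = trans (X-ν z cs p) (outsider-stays G (lab z) (start z) out B cs)

  A : Fin agents → Cmds → Fin nodes
  A r cs = at r ⟦ cs ⟧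

  R : Fin agents → Fin n → Cmds → Fin n
  R r v cs = real G r v ⟦ cs ⟧

  Ag : Fin agents → Fin n → Cmds → Set
  Ag r v cs = Agree G r v ⟦ cs ⟧

  X-R : ∀ {z r} cs → lab z ≡ label r → Prefix cs → X z (ν cs) ≡ R r (start z) cs
  X-R {z} cs e p = trans (X-ν z cs p) (cong (λ ℓ → proj₁ (run G ℓ (start z) ⟦ cs ⟧)) e)

  A-step : ∀ r cs ds → A r cs ≡ centre → Valid graph centre (ports r ds) → A r (cs ++ ds) ≡ end graph centre (ports r ds)
  A-step r cs ds e val = trans (cong (at r) (emits-++ B cs ds)) (at-centre r ⟦ cs ⟧ ds e val)

  A-closed : ∀ r cs ds → A r cs ≡ centre → Closed ds → A r (cs ++ ds) ≡ centre
  A-closed r cs ds e c = trans (A-step r cs ds e (proj₁ (c r))) (proj₂ (c r))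

  Ag-++ : ∀ r v cs ds → Ag r v (cs ++ ds) → Ag r v cs
  Ag-++ r v cs ds ag = agree-emits G r v ⟦ cs ⟧ ds (subst (Agree G r v) (emits-++ B cs ds) ag)

  Ag-prefix : ∀ r v cs → Prefix cs → Ag r v whole → Ag r v cs
  Ag-prefix r v cs (ds , eq) ag = Ag-++ r v cs ds (subst (Ag r v) eq ag)

  R-step : ∀ r v cs ds → Ag r v (cs ++ ds) → Valid graph (A r cs) (ports r ds) →
    Match G graph (R r v cs) (A r cs) (ports r ds) × R r v (cs ++ ds) ≡ end G (R r v cs) (ports r ds)
  R-step r v cs ds ag val with agree-match G r v label-inj ⟦ cs ⟧ ds val (subst (Agree G r v) (emits-++ B cs ds) ag)
  ... | M , e = M , trans (cong (real G r v) (emits-++ B cs ds)) e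

  R-returns : ∀ r v cs ds → Ag r v (cs ++ ds) → A r cs ≡ centre → Closed ds → Returns G r ds → R r v (cs ++ ds) ≡ R r v cs
  R-returns r v cs ds ag e c ret with R-step r v cs ds ag (subst (λ w → Valid graph w (ports r ds)) (sym e) (proj₁ (c r)))
  ... | M , e' = trans e' (ret _ (subst (λ w → Match G graph (R r v cs) w (ports r ds)) e M))

  A-assembly : ∀ r → A r assembly ≡ centre
  A-assembly r = trans (cong (at r) (emits-++ B (tours B) (routes B))) (at-gathered B r)

  t₁ : ℕ
  t₁ = ν (tours B)

  module Observer (a : Fin K) (w : ℕ) (awake : clock w a ≡ 1) (i : Fin agents) (rank-a : lab a ≡ label i) where
    open Watch a w awake public

    P-a : ∀ cs → Prefix cs → P a (ν cs) ≡ R i (start a) cs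
    P-a cs p = trans (cong (X a) (Y-self (ν cs))) (X-R cs rank-a p)

    tours-valid : Valid graph (at i B) (ports i (tours B))
    tours-valid = subst (Valid graph (at i B)) (sym (ports-tours B i)) (proj₁ (tour-closed graph lawful (at i B) (radius B)))

    module _ (ag : Ag i (start a) (tours B)) where

      tour-match : Match G graph (R i (start a) []) (at i B) (tour graph (at i B) (radius B))
      tour-match = subst (Match G graph (R i (start a) []) (at i B)) (ports-tours B i) (proj₁ (R-step i (start a) [] (tours B) ag tours-valid))

      R-tours : R i (start a) (tours B) ≡ R i (start a) []
      R-tours = trans (proj₂ (R-step i (start a) [] (tours B) ag tours-valid))
        (trans (cong (end G (R i (start a) [])) (ports-tours B i)) (proj₁ (match-tour G graph lawG lawful (radius B) _ _ tour-match)))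

      -- The matched tour visits the end of every short walk, in particular `start z`; cutting the
      -- schedule at that visit gives a sample at which `a` wakes `z`.
      ball-wakes : ∀ z π → z ≢ a → length π ≤ radius B → Valid G (R i (start a) []) π → end G (R i (start a) []) π ≡ start z →
        1 ≤ S z (suc t₁)
      ball-wakes z π z≢a len val ends with proj₂ (match-tour G graph lawG lawful (radius B) _ _ tour-match) π len val
      ... | τ₁ , τ₂ , eq , ends' with ports-split i (tours B) {τ₁} {τ₂} (trans (ports-tours B i) eq)
      ...   | cs₁ , cs₂ , eq₂ , eq₃ = wakes-before z z≢a (trans (P-a cs₁ prefix) (trans visit (trans ends' ends)))
                (s≤s (≤-trans (ν-mono cs₁ cs₂) (≤-reflexive (cong ν (sym eq₂)))))
        where
        prefix : Prefix cs₁
        prefix = prefix-++ cs₁ cs₂ (routes B ++ trials , trans (++-assoc (tours B) (routes B) trials) (cong (_++ routes B ++ trials) eq₂))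
        visit : R i (start a) cs₁ ≡ end G (R i (start a) []) τ₁
        visit = trans (proj₂ (R-step i (start a) [] cs₁ (Ag-++ i (start a) cs₁ cs₂ (subst (Ag i (start a)) eq₂ ag))
                 (proj₁ (valid-++⁻ graph (at i B) (ports i cs₁) (subst (Valid graph (at i B))
                    (trans (cong (ports i) eq₂) (ports-++ i cs₁ cs₂)) tours-valid))))) (cong (end G (R i (start a) [])) eq₃)

      -- If `z` slept through the tours, it is at most `length B` steps from its start when met, as
      -- outsiders rest during this hypothesis, and `a` is at most `length cs` steps from the base
      -- of its tour. So `start z` lies in the ball toured, and `z` was woken after all.
      outsider-awake : ∀ z cs → Outsider z → Prefix (tours B ++ cs) → 1 ≤ length cs →
        P z (ν (tours B ++ cs)) ≡ R i (start a) (tours B ++ cs) → 1 ≤ S z (suc t₁)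
      outsider-awake z cs out p pos eq with 1 ≤? S z (suc t₁)
      ... | yes s = s
      ... | no ¬s = ball-wakes z (π₂ ++ back G (start z) π₁) (λ { refl → out i (sym rank-a) }) len
              (valid-++ G _ π₂ val₂ (subst (λ w → Valid G w (back G (start z) π₁)) (sym meet) (back-valid G lawG (start z) π₁ val₁)))
              (trans (end-++ G _ π₂ _) (trans (cong (λ w → end G w (back G (start z) π₁)) meet) (end-back G lawG (start z) π₁ val₁)))
        where
        x = ν (tours B ++ cs)
        suc-t₁≤x : suc t₁ ≤ x
        suc-t₁≤x = ≤-trans (≤-reflexive (+-comm 1 t₁)) (≤-trans (+-monoʳ-≤ t₁ pos) (≤-reflexive (sym (ν-++ (tours B) cs))))
        -- Asleep at sample `suc t₁`, the agent stays no faster than `a`, so it has not reached the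
        -- slots of later hypotheses.
        Y≤ : Y z x ≤ ν whole
        Y≤ = ≤-trans (dormant-slow z suc-t₁≤x (n<1⇒n≡0 (≰⇒> ¬s))) (ν-prefix (tours B ++ cs) p)
        short : ∃ λ π → Valid G (start z) π × end G (start z) π ≡ X z (Y z x) × length π ≤ length B
        short with ≤-total (Y z x) (length B)
        ... | inj₁ le with run-reach G (lab z) (start z) (pre (Y z x))
        ...   | π , val , ends , len = π , val , trans ends (sym (X-def z (Y z x))) , ≤-trans len (≤-trans (≤-reflexive (pre-length (Y z x))) le)
        short | inj₂ ge with run-reach G (lab z) (start z) B
        ...   | π , val , ends , len = π , val , trans ends (sym (X-outsider z out (Y z x) ge Y≤)) , len
        π₁ = proj₁ short
        val₁ = proj₁ (proj₂ short)
        reach : ∃ λ π → Valid G (R i (start a) []) π × end G (R i (start a) []) π ≡ R i (start a) (tours B ++ cs) × length π ≤ length cs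
        reach with emits-suffix ⟦ tours B ⟧ cs
        ... | new , e , l with run-reach-from G (label i) (start a) new ⟦ tours B ⟧
        ...   | π , val , ends , len = π , subst (λ w → Valid G w π) R-tours val ,
                  trans (cong (λ w → end G w π) (sym R-tours)) (trans ends (cong (real G i (start a)) (trans (sym e) (sym (emits-++ B (tours B) cs))))) ,
                  ≤-trans len (≤-reflexive l)
        π₂ = proj₁ reach
        val₂ = proj₁ (proj₂ reach)
        meet : end G (R i (start a) []) π₂ ≡ end G (start z) π₁
        meet = trans (proj₁ (proj₂ (proj₂ reach))) (trans (sym eq) (sym (proj₁ (proj₂ (proj₂ short)))))
        cs≤ : length cs ≤ length (routes B ++ trials)
        cs≤ = ≤-trans (≤-trans (m≤m+n (length cs) (length (proj₁ p))) (≤-reflexive (sym (length-++ cs)))) (≤-reflexive (sym (cong length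
                (++-cancelˡ (tours B) (routes B ++ trials) (cs ++ proj₁ p)
                  (trans (sym (++-assoc (tours B) (routes B) trials)) (trans (proj₂ p) (++-assoc (tours B) cs (proj₁ p))))))))
        len : length (π₂ ++ back G (start z) π₁) ≤ radius B
        len = ≤-trans (≤-reflexive (trans (length-++ π₂) (trans (cong (length π₂ +_) (back-length G (start z) π₁)) (+-comm (length π₂) (length π₁)))))
                (≤-trans (+-mono-≤ (proj₂ (proj₂ (proj₂ short))) (≤-trans (proj₂ (proj₂ (proj₂ reach))) cs≤)) (radius-ops B))

      module _ (f : Fin nodes → Fin n) (mor : Morphism graph G f) (f-surj : ∀ v → ∃ λ u → f u ≡ v) (home-a : start a ≡ f (home i)) where
        open Morphism mor

        -- With a surjective morphism at hand, going back to the centre and out again reaches every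
        -- start; these two legs are the reason for `spread + spread` in the radius.
        tour-wakes : ∀ z → z ≢ a → 1 ≤ S z (suc t₁)
        tour-wakes z z≢a = ball-wakes z π z≢a (≤-trans (≤-reflexive (length-++ (ret u₀))) (radius-paths B u₀ u))
            (subst (λ v → Valid G v π) (sym here') (match-valid G graph (f u₀) u₀ π (match-f u₀ π val)))
            (trans (cong (λ v → end G v π) here') (trans (end-f u₀ π val) (trans (cong f ends) (proj₂ (f-surj (start z))))))
          where
          u u₀ : Fin nodes
          u = proj₁ (f-surj (start z))
          u₀ = at i B
          π : List ℕ
          π = ret u₀ ++ path u
          here' : R i (start a) [] ≡ f u₀
          here' = trans (cong (λ x → R i x []) home-a) (cong proj₁ (run-f (label i) (home i) B))
          val : Valid graph u₀ π
          val = valid-++ graph u₀ (ret u₀) (ret-valid u₀) (subst (λ w → Valid graph w (path u)) (sym (ret-end u₀)) (path-valid u))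
          ends : end graph u₀ π ≡ u
          ends = trans (end-++ graph u₀ (ret u₀) (path u)) (trans (cong (λ w → end graph w (path u)) (ret-end u₀)) (path-end u))

    -- The bound is `2 + t₁` because an agent awake at sample `suc t₁` is aligned or ahead from the
    -- following sample on.
    Counts : Set
    Counts = ∀ cs → Prefix cs → 2 + t₁ ≤ ν cs → crowd (clock (τ (ν cs))) (P a (ν cs)) ≡ ♯ (λ r → A r cs Fin.≟ A i cs)

-- What an accepting observer can conclude

module Certify {n : ℕ} (G : Graph n) (lawG : Lawful G) {K : ℕ} (lab : Fin K → ℕ) (lab-inj : ∀ y z → lab y ≡ lab z → y ≡ z)
               (start : Fin K → Fin n) (wk : Fin K → ℕ → Bool) (h : ℕ) (wf : WellFormed (hyp h))
               (a : Fin K) (w : ℕ) (awake : World.clock G lab start wk w a ≡ 1) (i : Fin (Hyp.agents (hyp h))) (rank-a : lab a ≡ Hyp.label (hyp h) i)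
               (ag : Phase.Ag G lawG lab start wk h wf i (start a) (Phase.whole G lawG lab start wk h wf))
               (counts : Phase.Observer.Counts G lawG lab start wk h wf a w awake i rank-a)
               (conn : ∀ v w → ∃ λ π → Valid G v π × end G v π ≡ w) where
  open Phase G lawG lab start wk h wf
  open Observer a w awake i rank-a

  ag-tours : Ag i (start a) (tours B)
  ag-tours = Ag-prefix i (start a) (tours B) (routes B ++ trials , ++-assoc (tours B) (routes B) trials) ag

  ν-snoc : ∀ cs c → ν (cs ++ [ c ]) ≡ suc (ν cs)
  ν-snoc cs c = trans (ν-++ cs [ c ]) (+-comm (ν cs) 1)

  after-tours : ∀ cs → Prefix cs → 2 + t₁ ≤ ν cs → ∃ λ ds → cs ≡ tours B ++ ds × 1 ≤ length ds
  after-tours cs (es , eq) le = aux (tours B) cs (trans (sym (++-assoc (tours B) (routes B) trials)) eq)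
      (s≤s⁻¹ (≤-trans (+-cancelˡ-≤ (length B) _ _ (≤-trans (≤-reflexive (swap (length B) (length (tours B)))) le)) (n≤1+n _)))
    where
    swap : ∀ x y → x + (2 + y) ≡ 2 + (x + y)
    swap = solve-∀
    aux : ∀ (ts cs : Cmds) {us es} → ts ++ us ≡ cs ++ es → suc (length ts) ≤ length cs → ∃ λ ds → cs ≡ ts ++ ds × 1 ≤ length ds
    aux [] cs _ l = cs , refl , l
    aux (t ∷ ts) (c ∷ cs) eq (s≤s l) with aux ts cs (proj₂ (∷-injective eq)) l
    ... | ds , e , l' = ds , cong₂ _∷_ (sym (proj₁ (∷-injective eq))) e , l'

  met-awake : ∀ z cs → Outsider z → Prefix cs → 2 + t₁ ≤ ν cs → P z (ν cs) ≡ R i (start a) cs → 1 ≤ S z (suc t₁)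
  met-awake z cs out p le eq with after-tours cs p le
  ... | ds , refl , l = outsider-awake ag-tours z ds out p l eq

  blinks-+ : ∀ j m d → blinks j (m + d) ≡ blinks j m ++ blinks j d
  blinks-+ j zero d = refl
  blinks-+ j (suc m) d = cong (λ cs → (j , 0) ∷ (j , en graph centre 0) ∷ cs) (blinks-+ j m d)

  module _ (cs₀ : Cmds) (j : Fin agents) (j≢i : j ≢ i) (prefix : Prefix (cs₀ ++ blinks j repeats))
           (late : 2 + t₁ ≤ ν cs₀) (gathered₀ : ∀ r → A r cs₀ ≡ centre) where

    cs : ℕ → Cmds
    cs m = cs₀ ++ blinks j m

    y : ℕ
    y = ν cs₀

    x : ℕ → ℕ
    x m = ν (cs m)

    v : Fin n
    v = R i (start a) cs₀

    x-mono : ∀ {m m'} → m < m' → x m < x m'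
    x-mono {m} {m'} lt = ≤-trans (≤-reflexive (sym (ν-snoc (cs m) (j , 0))))
      (≤-trans (ν-mono (cs m ++ [ (j , 0) ]) _) (≤-reflexive (cong ν (sym split))))
      where
      split : cs m' ≡ (cs m ++ [ (j , 0) ]) ++ (j , en graph centre 0) ∷ blinks j (m' ∸ suc m)
      split = trans (cong (λ k → cs₀ ++ blinks j k) (sym (trans (+-suc m (m' ∸ suc m)) (m+[n∸m]≡n lt))))
        (trans (cong (cs₀ ++_) (blinks-+ j m (suc (m' ∸ suc m)))) (trans (sym (++-assoc cs₀ (blinks j m) _)) (sym (++-assoc (cs m) [ (j , 0) ] _))))

    out-prefix : ∀ m → m < repeats → Prefix (cs m ++ [ (j , 0) ])
    out-prefix m lt = prefix-++ _ ((j , en graph centre 0) ∷ blinks j (repeats ∸ suc m)) (subst Prefix split prefix)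
      where
      split : cs repeats ≡ (cs m ++ [ (j , 0) ]) ++ (j , en graph centre 0) ∷ blinks j (repeats ∸ suc m)
      split = trans (cong (λ k → cs₀ ++ blinks j k) (sym (trans (+-suc m (repeats ∸ suc m)) (m+[n∸m]≡n lt))))
        (trans (cong (cs₀ ++_) (blinks-+ j m (suc (repeats ∸ suc m)))) (trans (sym (++-assoc cs₀ (blinks j m) _)) (sym (++-assoc (cs m) [ (j , 0) ] _))))

    in-prefix : ∀ m → m < repeats → Prefix (cs m)
    in-prefix m lt = prefix-++ (cs m) [ (j , 0) ] (out-prefix m lt)

    A-in : ∀ m r → A r (cs m) ≡ centre
    A-in m r = A-closed r cs₀ (blinks j m) (gathered₀ r) (closed-blinks j m)

    A-out-self : ∀ m → A j (cs m ++ [ (j , 0) ]) ≢ centre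
    A-out-self m e = no-loop (trans (sym (trans (A-step j (cs m) (by j [ 0 ]) (A-in m j) (subst (Valid graph centre) (sym (ports-by j [ 0 ])) (centre-deg , tt)))
      (cong (end graph centre) (ports-by j [ 0 ])))) e)

    A-out-other : ∀ m r → r ≢ j → A r (cs m ++ [ (j , 0) ]) ≡ centre
    A-out-other m r r≢ = trans (A-step r (cs m) (by j [ 0 ]) (A-in m r) (subst (Valid graph centre) (sym (ports-by-other r≢ [ 0 ])) tt))
      (cong (end graph centre) (ports-by-other r≢ [ 0 ]))

    i≢j : i ≢ j
    i≢j e = j≢i (sym e)

    R-in : ∀ m → m < repeats → R i (start a) (cs m) ≡ v
    R-in m lt = R-returns i (start a) cs₀ (blinks j m) (Ag-prefix i (start a) (cs m) (in-prefix m lt) ag) (gathered₀ i) (closed-blinks j m) (returns-blinks G lawG i j m)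

    R-out : ∀ m → m < repeats → R i (start a) (cs m ++ [ (j , 0) ]) ≡ v
    R-out m lt = trans (proj₂ (R-step i (start a) (cs m) (by j [ 0 ]) (Ag-prefix i (start a) _ (out-prefix m lt) ag)
        (subst (Valid graph (A i (cs m))) (sym (ports-by-other i≢j [ 0 ])) tt)))
      (trans (cong (end G (R i (start a) (cs m))) (ports-by-other i≢j [ 0 ])) (R-in m lt))

    late-in : ∀ m → 2 + t₁ ≤ x m
    late-in m = ≤-trans late (ν-mono cs₀ (blinks j m))

    count-in : ∀ m → m < repeats → crowd (clock (τ (x m))) v ≡ ♯ (λ r → A r (cs m) Fin.≟ A i (cs m))
    count-in m lt = trans (cong (crowd (clock (τ (x m)))) (sym (trans (P-a (cs m) (in-prefix m lt)) (R-in m lt)))) (counts (cs m) (in-prefix m lt) (late-in m))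

    count-out : ∀ m → m < repeats → crowd (clock (τ (suc (x m)))) v ≡ ♯ (λ r → A r (cs m ++ [ (j , 0) ]) Fin.≟ A i (cs m ++ [ (j , 0) ]))
    count-out m lt = subst (λ k → crowd (clock (τ k)) v ≡ ♯ (λ r → A r (cs m ++ [ (j , 0) ]) Fin.≟ A i (cs m ++ [ (j , 0) ]))) (ν-snoc (cs m) (j , 0))
      (trans (cong (crowd (clock (τ (ν (cs m ++ [ (j , 0) ]))))) (sym (trans (P-a _ (out-prefix m lt)) (R-out m lt))))
        (counts _ (out-prefix m lt) (≤-trans (late-in m) (ν-mono (cs m) _))))

    -- In the simulation only `j` leaves, and the observer stays at `v`. The observed count at `v`
    -- drops accordingly, so somebody really leaves, though not necessarily the agent labelled
    -- `label j`.
    departure : ∀ m → m < repeats → ∃ λ z → P z (x m) ≡ v × P z (suc (x m)) ≢ v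
    departure m lt = ♯-drop (λ z → P z (x m) Fin.≟ v) (λ z → P z (suc (x m)) Fin.≟ v)
      (subst₂ _<_ (trans (sym (count-out m lt)) (crowd-def (clock (τ (suc (x m)))) v)) (trans (sym (count-in m lt)) (crowd-def (clock (τ (x m))) v))
        (♯-inject-extra (λ r → A r (cs m ++ [ (j , 0) ]) Fin.≟ A i (cs m ++ [ (j , 0) ])) (λ r → A r (cs m) Fin.≟ A i (cs m)) (λ r → r)
          (λ {r} _ → trans (A-in m r) (sym (A-in m i))) (λ _ _ e → e) j (trans (A-in m j) (sym (A-in m i)))
          (λ {r} e r≡j → A-out-self m (trans (subst (λ r → A r (cs m ++ [ (j , 0) ]) ≡ A i (cs m ++ [ (j , 0) ])) r≡j e) (A-out-other m i i≢j)))))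

    Certified : ℕ → Fin K → Set
    Certified m b = lab b ≡ label j × Ag j (start b) (cs m) × Aligned b (x m) × R j (start b) (cs m) ≡ v

    -- Why an unaligned agent could leave v in blink m; the two constructors have 3k + k codes in total.
    data Excuse (m : ℕ) (z : Fin K) : Set where
      insider  : ∀ r e → label r ≡ lab z → Event y e z (x m) → Excuse m z
      outsider : ∀ c → member (λ z → P z y Fin.≟ v) c ≡ z → Event y (suc (suc zero)) z (x m) → Excuse m z

    y≤x : ∀ m → y ≤ x m
    y≤x m = ν-mono cs₀ (blinks j m)

    -- An aligned agent leaves only if the slot names it, which certifies it as `j`. An unaligned
    -- outsider at `v` has been awake since the tours, hence is ahead; that leaves only the third
    -- kind of event.
    explain : ∀ m → m < repeats → ∃ (Certified m) ⊎ ∃ (Excuse m)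
    explain m lt with departure m lt
    ... | z , here' , gone with (1 ≤? S z (x m)) ×-dec (Y z (x m) ℕ.≟ x m)
    ...   | yes al = inj₁ (z , sym who≡ , trace , al ,
              trans (sym (trans (X-ν z (cs m) (in-prefix m lt)) (cong (λ ℓ → proj₁ (run G ℓ (start z) ⟦ cs m ⟧)) (sym who≡)))) (trans (cong (X z) (sym (proj₂ al))) here'))
      where
      sl : Slot
      sl = mkSlot (label j) (proj₂ (sim j ⟦ cs m ⟧)) 0
      stays = trans (sym (X-ν z (cs m) (in-prefix m lt))) (trans (cong (X z) (sym (proj₂ al))) here')
      leaves : proj₁ (advance G (lab z) sl (run G (lab z) (start z) ⟦ cs m ⟧)) ≢ v
      leaves e = gone (trans (cong (X z) (trans (proj₂ (aligned-later z (n≤1+n (x m)) al)) (sym (ν-snoc (cs m) (j , 0)))))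
        (trans (X-ν z _ (out-prefix m lt)) (trans (cong (λ L → proj₁ (run G (lab z) (start z) L)) (emits-++ B (cs m) [ (j , 0) ])) e)))
      match = advance-departs G (lab z) sl (run G (lab z) (start z) ⟦ cs m ⟧) (λ e → leaves (trans e stays))
      who≡ : label j ≡ lab z
      who≡ = proj₁ match
      trace : Ag j (start z) (cs m)
      trace = trans (cong (λ ℓ → proj₂ (run G ℓ (start z) ⟦ cs m ⟧)) who≡) (sym (proj₂ match))
    ...   | no ¬al with Fin.any? (λ r → label r ℕ.≟ lab z)
    ...     | yes (r , e) with event y z (y≤x m) (λ eq → gone (trans (cong (X z) (sym eq)) here')) ¬al
    ...       | k , ev = inj₂ (z , insider r k e ev)
    explain m lt | z , here' , gone | no ¬al | no ¬part = inj₂ (z , outsider (member-index at-y? z at-y) (member-member-index at-y? z at-y) ev)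
      where
      at-y? = λ z → P z y Fin.≟ v
      out : Outsider z
      out r e = ¬part (r , e)
      roused : 1 ≤ S z (suc t₁)
      roused = met-awake z (cs m) out (in-prefix m lt) (late-in m) (trans here' (sym (R-in m lt)))
      later : suc t₁ < x m
      later = late-in m
      old : x m < Y z (x m)
      old = ≤∧≢⇒< (not-young z later roused) (λ e → ¬al (≤-trans roused (S-mono z (<⇒≤ later)) , sym e))
      ev : Event y (suc (suc zero)) z (x m)
      ev = old-event y z (y≤x m) old (λ eq → gone (trans (cong (X z) (sym eq)) here'))
      -- No slot has been passed since sample `y`, so this outsider already stood at `v` then and is
      -- among the agents counted there.
      at-y : P z y ≡ v
      at-y = trans (cong (X z) (sym (proj₁ ev))) here'

    present : ℕ
    present = ♯ (λ z → P z y Fin.≟ v)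

    code : ∀ {m} → ∃ (Excuse m) → Fin (agents * 3 + present)
    code (z , insider r e _ _) = join (agents * 3) present (inj₁ (combine r e))
    code (z , outsider c _ _) = join (agents * 3) present (inj₂ c)

    code-once : ∀ {m m'} → m < m' → (p : ∃ (Excuse m)) (q : ∃ (Excuse m')) → code p ≢ code q
    code-once {m} {m'} lt (z , insider r e l ev) (z' , insider r' e' l' ev') eq =
      event-once y e z (y≤x m) (x-mono lt) ev (subst₂ (λ e z → Event y e z (x m')) (sym (proj₂ same)) (sym same-agent) ev')
      where
      same : r ≡ r' × e ≡ e'
      same = Fin.combine-injective r e r' e' (inj₁-injective (join-injective {agents * 3} {present} eq))
      same-agent : z ≡ z'
      same-agent = lab-inj z z' (trans (sym l) (trans (cong label (proj₁ same)) l'))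
    code-once lt (z , insider r e l ev) (z' , outsider c' l' ev') eq with () ← join-injective {agents * 3} {present} {inj₁ (combine r e)} {inj₂ c'} eq
    code-once lt (z , outsider c l ev) (z' , insider r' e' l' ev') eq with () ← join-injective {agents * 3} {present} {inj₂ c} {inj₁ (combine r' e')} eq
    code-once {m} {m'} lt (z , outsider c l ev) (z' , outsider c' l' ev') eq =
      event-once y (suc (suc zero)) z (y≤x m) (x-mono lt) ev (subst (λ z → Event y (suc (suc zero)) z (x m')) (sym same-agent) ev')
      where
      same-agent : z ≡ z'
      same-agent = trans (sym l) (trans (cong (member (λ z → P z y Fin.≟ v)) (inj₂-injective (join-injective {agents * 3} {present} {inj₂ c} {inj₂ c'} eq))) l')

    certify : ∃ λ m → m < repeats × ∃ (Certified m)
    certify = [ (λ r → toℕ (proj₁ r) , Fin.toℕ<n (proj₁ r) , proj₂ r) ,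
                (λ bad → ⊥-elim (no-injective-codes {E = λ m → ∃ (Excuse m)} few code code-once bad)) ]′
              (choose repeats (λ m → explain (toℕ m) (Fin.toℕ<n m)))
      where
      here₀ : present ≡ ♯ (λ r → A r (cs 0) Fin.≟ A i (cs 0))
      here₀ = trans (sym (crowd-def (clock (τ y)) v)) (trans (cong (λ k → crowd (clock (τ k)) v) (cong ν (sym (++-identityʳ cs₀))))
        (count-in 0 (subst (0 <_) (sym repeats-def) (s≤s z≤n))))
      -- `K` is unknown to the hypothesis, but `present` equals a simulated count and so is at most
      -- `agents`.
      few : agents * 3 + present < repeats
      few = subst (agents * 3 + present <_) (sym repeats-def) (s≤s (≤-trans
        (+-monoʳ-≤ (agents * 3) (≤-trans (≤-reflexive here₀) (♯≤ (λ r → A r (cs 0) Fin.≟ A i (cs 0)))))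
        (≤-reflexive (cong (_+ agents) (*-comm agents 3)))))

  ag-a : ∀ cs → Prefix cs → Ag i (start a) cs
  ag-a cs p = Ag-prefix i (start a) cs p ag

  Gathered : Cmds → Set
  Gathered cs = ∀ r → A r cs ≡ centre

  gathered-++ : ∀ cs ds → Gathered cs → Closed ds → Gathered (cs ++ ds)
  gathered-++ cs ds g c r = A-closed r cs ds (g r) c

  Witness : Cmds → Fin agents → Fin K → Set
  Witness cs j b = lab b ≡ label j × Ag j (start b) cs × R j (start b) cs ≡ R i (start a) cs × Aligned b (ν (cs ++ roll))

  -- The certifying blink is unknown. Since blinks bring everybody back, the meeting is transported
  -- to the beginning of the roll; alignment persists and is transported to its end.
  roll-certify : ∀ cs j → j ≢ i → Prefix (cs ++ roll) → 2 + t₁ ≤ ν cs → Gathered cs → ∃ (Witness cs j)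
  roll-certify cs j j≢i p late g = conclude (roll-split G lawG j)
    where
    conclude : (∃₂ λ R₁ R₂ → roll ≡ R₁ ++ blinks j repeats ++ R₂ × Closed R₁ × (∀ r → Returns G r R₁)) → ∃ (Witness cs j)
    conclude (R₁ , R₂ , eq , cl , rt) = finish (certify cs₁ j j≢i p₁ (≤-trans late (ν-mono cs R₁)) g₁)
      where
      cs₁ = cs ++ R₁
      eq₁ : cs ++ roll ≡ (cs₁ ++ blinks j repeats) ++ R₂
      eq₁ = trans (cong (cs ++_) eq) (trans (sym (++-assoc cs R₁ _)) (sym (++-assoc cs₁ (blinks j repeats) R₂)))
      p₁ : Prefix (cs₁ ++ blinks j repeats)
      p₁ = prefix-++ _ R₂ (subst Prefix eq₁ p)
      g₁ : Gathered cs₁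
      g₁ = gathered-++ cs R₁ g cl
      finish : (∃ λ m → m < repeats × ∃ (Certified cs₁ j j≢i p₁ (≤-trans late (ν-mono cs R₁)) g₁ m)) → ∃ (Witness cs j)
      finish (m , m< , b , lb , agb , al , meet) = b , lb , Ag-++ j (start b) cs R₁ agb₁ ,
          trans (sym (trans (R-returns j (start b) cs₁ (blinks j m) agb (g₁ j) (closed-blinks j m) (returns-blinks G lawG j j m))
                       (R-returns j (start b) cs R₁ agb₁ (g j) cl (rt j))))
            (trans meet (R-returns i (start a) cs R₁ (ag-a cs₁ (prefix-++ cs₁ (blinks j repeats) p₁)) (g i) cl (rt i))) ,
          aligned-later b x≤ al
        where
        agb₁ : Ag j (start b) cs₁
        agb₁ = Ag-++ j (start b) cs₁ (blinks j m) agb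
        x≤ : ν (cs₁ ++ blinks j m) ≤ ν (cs ++ roll)
        x≤ = ≤-trans (ν-mono (cs₁ ++ blinks j m) (blinks j (repeats ∸ m) ++ R₂)) (≤-reflexive (cong ν (sym
               (trans eq₁ (trans (cong (λ k → (cs₁ ++ blinks j k) ++ R₂) (sym (m+[n∸m]≡n (<⇒≤ m<))))
                 (trans (cong (λ bs → (cs₁ ++ bs) ++ R₂) (blinks-+ j m (repeats ∸ m)))
                   (trans (cong (_++ R₂) (sym (++-assoc cs₁ (blinks j m) _))) (++-assoc (cs₁ ++ blinks j m) _ R₂))))))))

  s₁ s₂ s₃ s₄ : Cmds
  s₁ = assembly ++ roll
  s₂ = s₁ ++ roll
  s₃ = s₂ ++ exploreAll
  s₄ = s₃ ++ exploreAll

  whole≡s₄ : whole ≡ s₄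
  whole≡s₄ = trans (sym (++-assoc assembly roll _)) (trans (sym (++-assoc s₁ roll _)) (sym (++-assoc s₂ exploreAll exploreAll)))

  p₄ : Prefix s₄
  p₄ = [] , trans whole≡s₄ (sym (++-identityʳ s₄))

  p₃ : Prefix s₃
  p₃ = prefix-++ s₃ exploreAll p₄

  p₂ : Prefix s₂
  p₂ = prefix-++ s₂ exploreAll p₃

  g₁ : Gathered s₁
  g₁ = gathered-++ assembly roll A-assembly closed-roll

  g₂ : Gathered s₂
  g₂ = gathered-++ s₁ roll g₁ closed-roll

  g₃ : Gathered s₃
  g₃ = gathered-++ s₂ exploreAll g₂ closed-exploreAll

  late₁ : 2 + t₁ ≤ ν s₁
  late₁ = ≤-trans (≤-reflexive (+-comm 2 t₁)) (≤-trans (+-mono-≤ (ν-mono (tours B) (routes B)) two≤roll) (≤-reflexive (sym (ν-++ assembly roll))))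

  late₂ : 2 + t₁ ≤ ν s₂
  late₂ = ≤-trans late₁ (ν-mono s₁ roll)

  late₃ : 2 + t₁ ≤ ν s₃
  late₃ = ≤-trans late₂ (ν-mono s₂ exploreAll)

  -- Stated for an arbitrary `base`, because a stranger has to be caught in whichever of the two
  -- explorations it rests.
  module Tour (base : Cmds) (pb : Prefix (base ++ exploreAll)) (gb : Gathered base) (lb : 2 + t₁ ≤ ν base) where

    E₁ : Cmds
    E₁ = proj₁ (exploreAll-split G lawG i)

    e₀ : Cmds
    e₀ = base ++ E₁

    private
      E₂ = proj₁ (proj₂ (exploreAll-split G lawG i))
      e-eq = proj₁ (proj₂ (proj₂ (exploreAll-split G lawG i)))

    module At {ω : List ℕ} (ω∈ : ω ∈ tests) where

      private
        T₁ = proj₁ (explore-split G lawG i ω∈)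
        T₂ = proj₁ (proj₂ (explore-split G lawG i ω∈))
        t-eq = proj₁ (proj₂ (proj₂ (explore-split G lawG i ω∈)))
        cl₁ = proj₁ (proj₂ (proj₂ (proj₂ (explore-split G lawG i ω∈))))
        rt₁ = proj₂ (proj₂ (proj₂ (proj₂ (explore-split G lawG i ω∈))))

      t t' t'' : Cmds
      t = e₀ ++ T₁
      t' = t ++ roll
      t'' = t' ++ by i ω

      full : base ++ exploreAll ≡ (t'' ++ roll) ++ T₂ ++ E₂
      full = trans (cong (base ++_) (trans e-eq (cong (λ es → E₁ ++ es ++ E₂) t-eq)))
        (trans (sym (++-assoc base E₁ _)) (trans (cong (e₀ ++_) (trans (++-assoc T₁ _ E₂) (cong (T₁ ++_) (++-assoc (trial i ω) T₂ E₂))))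
          (trans (sym (++-assoc e₀ T₁ _)) (trans (cong (t ++_) (trans (++-assoc roll _ (T₂ ++ E₂)) (cong (roll ++_) (++-assoc (by i ω) roll (T₂ ++ E₂)))))
            (trans (sym (++-assoc t roll _)) (trans (sym (++-assoc t' (by i ω) _)) (sym (++-assoc t'' roll _))))))))

      pr : Prefix (t'' ++ roll)
      pr = prefix-++ (t'' ++ roll) (T₂ ++ E₂) (subst Prefix full pb)

      pt'' : Prefix t''
      pt'' = prefix-++ t'' roll pr

      pt' : Prefix t'
      pt' = prefix-++ t' (by i ω) pt''

      pt : Prefix t
      pt = prefix-++ t roll pt'

      gt : Gathered t
      gt = gathered-++ e₀ T₁ (gathered-++ base E₁ gb (proj₂ (proj₂ (proj₂ (exploreAll-split G lawG i))))) cl₁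

      gt' : Gathered t'
      gt' = gathered-++ t roll gt closed-roll

      closed-ω : Closed (by i ω)
      closed-ω = closed-by i ω (proj₁ (tests-closed ω ω∈)) (proj₂ (tests-closed ω ω∈))

      gt'' : Gathered t''
      gt'' = gathered-++ t' (by i ω) gt' closed-ω

      base≤t : ν base ≤ ν t
      base≤t = ≤-trans (ν-mono base E₁) (ν-mono e₀ T₁)

      late-t : 2 + t₁ ≤ ν t
      late-t = ≤-trans lb base≤t

      t''≤ : ν t'' ≤ ν (base ++ exploreAll)
      t''≤ = ≤-trans (ν-mono t'' roll) (≤-trans (ν-mono (t'' ++ roll) (T₂ ++ E₂)) (≤-reflexive (cong ν (sym full))))

      -- During the trials of `i` the agent `b` returns to `c*` by itself. The rolls around `ω` put
      -- `a` beside it both times, so `b` marks the node at which `ω` has to close up.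
      module Token (j : Fin agents) (j≢i : j ≢ i) (b : Fin K) (lab-b : lab b ≡ label j) where

        before : Witness t j b
        before = identify (roll-certify t j j≢i pt' late-t gt)
          where
          identify : ∃ (Witness t j) → Witness t j b
          identify (b' , wit) = subst (Witness t j) (lab-inj b' b (trans (proj₁ wit) (sym lab-b))) wit

        after : Witness t'' j b
        after = identify (roll-certify t'' j j≢i pr (≤-trans late-t (≤-trans (ν-mono t roll) (ν-mono t' (by i ω)))) gt'')
          where
          identify : ∃ (Witness t'' j) → Witness t'' j b
          identify (b' , wit) = subst (Witness t'' j) (lab-inj b' b (trans (proj₁ wit) (sym lab-b))) wit

        c* : Fin n
        c* = R j (start b) e₀

        ag-t'' : Ag j (start b) t''
        ag-t'' = proj₁ (proj₂ after)

        ag-t' : Ag j (start b) t'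
        ag-t' = Ag-++ j (start b) t' (by i ω) ag-t''

        b-t : R j (start b) t ≡ c*
        b-t = R-returns j (start b) e₀ T₁ (Ag-++ j (start b) t roll ag-t') (gathered-++ base E₁ gb (proj₂ (proj₂ (proj₂ (exploreAll-split G lawG i)))) j) cl₁ (rt₁ j≢i)

        b-t' : R j (start b) t' ≡ c*
        b-t' = trans (R-returns j (start b) t roll ag-t' (gt j) closed-roll (returns-roll G lawG j)) b-t

        b-t'' : R j (start b) t'' ≡ c*
        b-t'' = trans (R-returns j (start b) t' (by i ω) ag-t'' (gt' j) closed-ω (returns-by-other G j≢i ω)) b-t'

        a-t : R i (start a) t ≡ c*
        a-t = trans (sym (proj₁ (proj₂ (proj₂ before)))) b-t

        a-t' : R i (start a) t' ≡ c*
        a-t' = trans (R-returns i (start a) t roll (ag-a t' pt') (gt i) closed-roll (returns-roll G lawG i)) a-t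

        walk : Match G graph c* centre ω × end G c* ω ≡ c*
        walk = subst₂ (λ v ps → Match G graph v centre ps) a-t' (ports-by i ω) (subst (λ u → Match G graph (R i (start a) t') u (ports i (by i ω))) (gt' i) (proj₁ st)) ,
            trans (sym (trans (proj₂ st) (cong₂ (end G) a-t' (ports-by i ω)))) (trans (sym (proj₁ (proj₂ (proj₂ after)))) b-t'')
          where
          st = R-step i (start a) t' (by i ω) (ag-a t'' pt'') (subst (λ u → Valid graph u (ports i (by i ω))) (sym (gt' i)) (proj₁ (closed-ω i)))

        aligned-t' : Aligned b (ν t')
        aligned-t' = proj₂ (proj₂ (proj₂ before))

    module Node (u : Fin nodes) where
      open At (test-node u) public

      q : Cmds
      q = t' ++ by i (path u)

      t''≡ : t'' ≡ q ++ by i (ret u)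
      t''≡ = trans (cong (t' ++_) (map-++ (i ,_) (path u) (ret u))) (sym (++-assoc t' (by i (path u)) (by i (ret u))))

      pq : Prefix q
      pq = prefix-++ q (by i (ret u)) (subst Prefix t''≡ pt'')

      late-q : 2 + t₁ ≤ ν q
      late-q = ≤-trans late-t (≤-trans (ν-mono t roll) (ν-mono t' (by i (path u))))

      q-self : A i q ≡ u
      q-self = trans (A-step i t' (by i (path u)) (gt' i) (subst (Valid graph centre) (sym (ports-by i (path u))) (path-valid u)))
        (trans (cong (end graph centre) (ports-by i (path u))) (path-end u))

      q-other : ∀ r → r ≢ i → A r q ≡ centre
      q-other r r≢ = trans (A-step r t' (by i (path u)) (gt' r) (subst (Valid graph centre) (sym (ports-by-other r≢ (path u))) tt))
        (cong (end graph centre) (ports-by-other r≢ (path u)))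

      base≤q : ν base ≤ ν q
      base≤q = ≤-trans base≤t (≤-trans (ν-mono t roll) (ν-mono t' (by i (path u))))

      q≤ : ν q ≤ ν (base ++ exploreAll)
      q≤ = ≤-trans (≤-trans (ν-mono q (by i (ret u))) (≤-reflexive (cong ν (sym t''≡)))) t''≤

      -- If another node of the map lay over `c*`, the observer would meet the token on arriving
      -- there, whereas the simulation has it alone, all others waiting at the centre.
      fibre : ∀ j → j ≢ i → ∀ b → lab b ≡ label j → end G (R j (start b) e₀) (path u) ≡ R j (start b) e₀ → u ≡ centre
      fibre j j≢i b lab-b eq = decidable-stable (u Fin.≟ centre) λ u≢c →
          1+n≰n (≤-trans (≤-trans two' (≤-reflexive (trans (sym (crowd-def (clock (τ (ν q))) (P a (ν q)))) (counts q pq late-q)))) (single u≢c))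
        where
        open Token j j≢i b lab-b
        b≢a : b ≢ a
        b≢a refl = j≢i (label-inj j i (trans (sym lab-b) rank-a))
        b-q : R j (start b) q ≡ c*
        b-q = trans (proj₂ (R-step j (start b) t' (by i (path u)) (Ag-++ j (start b) q (by i (ret u)) (subst (Ag j (start b)) t''≡ ag-t''))
                 (subst (Valid graph (A j t')) (sym (ports-by-other j≢i (path u))) tt)))
               (trans (cong (end G (R j (start b) t')) (ports-by-other j≢i (path u))) b-t')
        a-q : R i (start a) q ≡ c*
        a-q = trans (proj₂ (R-step i (start a) t' (by i (path u)) (ag-a q pq)
                 (subst₂ (Valid graph) (sym (gt' i)) (sym (ports-by i (path u))) (path-valid u))))
               (trans (cong₂ (end G) a-t' (ports-by i (path u))) eq)
        P-b : P b (ν q) ≡ P a (ν q)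
        P-b = trans (cong (X b) (proj₂ (aligned-later b (ν-mono t' (by i (path u))) aligned-t'))) (trans (X-R q lab-b pq) (trans b-q (trans (sym a-q) (sym (P-a q pq)))))
        two' : 2 ≤ ♯ (λ z → P z (ν q) Fin.≟ P a (ν q))
        two' = ♯-two (λ z → P z (ν q) Fin.≟ P a (ν q)) b a b≢a P-b refl
        single : u ≢ centre → ♯ (λ r → A r q Fin.≟ A i q) ≤ 1
        single u≢c = ♯-single (λ r → A r q Fin.≟ A i q) i λ r e → decidable-stable (r Fin.≟ i) λ r≢ →
          u≢c (trans (sym q-self) (trans (sym e) (q-other r r≢)))

  opaque
    -- Certifies all hypothesised agents before the explorations begin, so that they are aligned
    -- from `s₂` on.
    partner : ∀ j → j ≢ i → ∃ (Witness s₁ j)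
    partner j j≢i = roll-certify s₁ j j≢i p₂ late₁ g₁

    j₀ : Fin agents
    j₀ = proj₁ (other two i)

    j₀≢i : j₀ ≢ i
    j₀≢i = proj₂ (other two i)

    b₀ : Fin K
    b₀ = proj₁ (partner j₀ j₀≢i)

    lab-b₀ : lab b₀ ≡ label j₀
    lab-b₀ = proj₁ (proj₂ (partner j₀ j₀≢i))

  module First = Tour s₂ p₃ g₂ late₂

  c* : Fin n
  c* = R j₀ (start b₀) First.e₀

  module Iso = Cover graph G lawful lawG centre c* path path-valid path-end conn
    (λ u → proj₁ (match-++⁻ G graph c* centre (path u) (proj₁ (First.At.Token.walk (test-node u) j₀ j₀≢i b₀ lab-b₀))))
    (λ u p lt → First.At.Token.walk (test-edge u p lt) j₀ j₀≢i b₀ lab-b₀)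
    (λ u → First.Node.fibre u j₀ j₀≢i b₀ lab-b₀)
  open Iso using (f; morphism; surjective; injective; f-centre)
  open Morphism morphism

  R-f : ∀ r v → v ≡ f (home r) → ∀ cs → R r v cs ≡ f (A r cs)
  R-f r v eq cs = trans (cong (λ x → R r x cs) eq) (cong proj₁ (run-f (label r) (home r) ⟦ cs ⟧))

  start-f : ∀ r v cs → Ag r v cs → R r v cs ≡ f (A r cs) → v ≡ f (home r)
  start-f r v cs = run-f-start lawG lawful (label r) v (home r) ⟦ cs ⟧

  -- The positions correspond at `t` and the traces agree, so both runs can be reversed in parallel
  -- down to the starts.
  home-a : start a ≡ f (home i)
  home-a = start-f i (start a) t (ag-a t pt) (trans (Token.a-t j₀ j₀≢i b₀ lab-b₀) (trans (sym f-centre) (cong f (sym (gt i)))))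
    where open First.At (test-node centre)

  Enrolled : Fin agents → Fin K → Set
  Enrolled r z = lab z ≡ label r × start z ≡ f (home r) × Aligned z (ν s₂)

  enrolled : ∀ r → ∃ (Enrolled r)
  enrolled r = [ (λ { refl → a , rank-a , home-a , subst (1 ≤_) (sym (S-self (ν s₂))) (4^-pos (ν s₂)) , Y-self (ν s₂) }) , found ]′ (toSum (r Fin.≟ i))
    where
    found : r ≢ i → ∃ (Enrolled r)
    found r≢ with partner r r≢
    ... | b , lb , agb , meet , al = b , lb , start-f r (start b) s₁ agb
            (trans meet (trans (R-f i (start a) home-a s₁) (cong f (trans (g₁ i) (sym (g₁ r)))))) , al

  agent : Fin agents → Fin K
  agent r = proj₁ (enrolled r)

  agent-lab : ∀ r → lab (agent r) ≡ label r
  agent-lab r = proj₁ (proj₂ (enrolled r))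

  agent-home : ∀ r → start (agent r) ≡ f (home r)
  agent-home r = proj₁ (proj₂ (proj₂ (enrolled r)))

  P-agent : ∀ r cs → Prefix cs → ν s₂ ≤ ν cs → P (agent r) (ν cs) ≡ f (A r cs)
  P-agent r cs p le = trans (cong (X (agent r)) (proj₂ (aligned-later (agent r) le (proj₂ (proj₂ (proj₂ (enrolled r)))))))
    (trans (X-R cs (agent-lab r) p) (R-f r (start (agent r)) (agent-home r) cs))

  module Stranger (z : Fin K) (out : Outsider z) where

    roused : 1 ≤ S z (suc t₁)
    roused = tour-wakes ag-tours f morphism surjective home-a z (λ { refl → out i (sym rank-a) })

    -- No slot of this hypothesis names a stranger, so an aligned one would rest. One that moves is
    -- ahead of the observer, and then this is its first passage of a slot since `ν s₂`.
    changes : ∀ x → ν s₂ ≤ x → x < ν whole → P z x ≢ P z (suc x) → Y z x ≡ Y z (ν s₂)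
    changes x le lt ch = proj₁ (old-event (ν s₂) z le old (λ e → ch (cong (X z) e)))
      where
      later : suc t₁ < x
      later = ≤-trans late₂ le
      lB : length B ≤ x
      lB = ≤-trans (m≤m+n _ _) le
      aligned⇒⊥ : Y z x ≢ x
      aligned⇒⊥ e = ch (trans (cong (X z) e) (trans (X-outsider z out x lB (<⇒≤ lt)) (sym (trans (cong (X z) (proj₂ (aligned-later z (n≤1+n x) (≤-trans roused (S-mono z (<⇒≤ later)) , e))))
        (X-outsider z out (suc x) (m≤n⇒m≤1+n lB) lt)))))
      old : x < Y z x
      old = ≤∧≢⇒< (not-young z later roused) (λ e → aligned⇒⊥ (sym e))

    -- The observer's walk to the node where the stranger rests finds it there in addition to the
    -- images of all agents expected: one too many.
    meets : ∀ base → Prefix (base ++ exploreAll) → Gathered base → 2 + t₁ ≤ ν base → ν s₂ ≤ ν base →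
      (∀ x → ν base ≤ x → x ≤ ν (base ++ exploreAll) → P z x ≡ P z (ν base)) → ⊥
    meets base pb gb lb s₂≤ const = 1+n≰n (≤-trans more (≤-reflexive (trans (sym (crowd-def (clock (τ (ν q))) (P a (ν q)))) (counts q pq late-q))))
      where
      u : Fin nodes
      u = proj₁ (surjective (P z (ν base)))
      open Tour base pb gb lb
      open Node u
      P-a-q : P a (ν q) ≡ f (A i q)
      P-a-q = trans (P-a q pq) (R-f i (start a) home-a q)
      P-z-q : P z (ν q) ≡ P a (ν q)
      P-z-q = trans (const (ν q) base≤q q≤) (trans (sym (proj₂ (surjective (P z (ν base))))) (trans (cong f (sym q-self)) (sym P-a-q)))
      more : suc (♯ (λ r → A r q Fin.≟ A i q)) ≤ ♯ (λ y → P y (ν q) Fin.≟ P a (ν q))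
      more = ♯-inject-extra (λ r → A r q Fin.≟ A i q) (λ y → P y (ν q) Fin.≟ P a (ν q)) agent
        (λ {r} e → trans (P-agent r q pq (≤-trans s₂≤ base≤q)) (trans (cong f e) (sym P-a-q)))
        (λ {r} {r'} _ _ e → label-inj r r' (trans (sym (agent-lab r)) (trans (cong lab e) (agent-lab r'))))
        z P-z-q (λ {r} _ e → out r (trans (sym (agent-lab r)) (cong lab e)))

    still : Y z (ν s₃) ≢ Y z (ν s₂) → ∀ d → d + ν s₃ ≤ ν s₄ → P z (d + ν s₃) ≡ P z (ν s₃)
    still ne zero _ = refl
    still ne (suc d) le = trans (sym (decidable-stable (P z (d + ν s₃) Fin.≟ P z (suc (d + ν s₃))) λ ch →
        ne (≤-antisym (≤-trans (Y-mono z (m≤n+m _ d)) (≤-reflexive (changes (d + ν s₃) (≤-trans (ν-mono s₂ exploreAll) (m≤n+m _ d))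
          (≤-trans le (≤-reflexive (cong ν (sym whole≡s₄)))) ch))) (Y-mono z (ν-mono s₂ exploreAll)))))
      (still ne d (≤-trans (n≤1+n _) le))

    impossible : ⊥
    impossible = [ (λ eq → meets s₂ p₃ g₂ late₂ ≤-refl (λ x l u → cong (X z) (≤-antisym (≤-trans (Y-mono z u) (≤-reflexive eq)) (Y-mono z l)))) ,
                   (λ ne → meets s₃ p₄ g₃ late₃ (ν-mono s₂ exploreAll) (λ x l u →
                      subst (λ k → P z k ≡ P z (ν s₃)) (m∸n+n≡m l) (still ne (x ∸ ν s₃) (≤-trans (≤-reflexive (m∸n+n≡m l)) u)))) ]′
                 (toSum (Y z (ν s₃) ℕ.≟ Y z (ν s₂)))

  truth : Truth G lab start (hyp h)
  truth = record
    { f = f ; morphism = morphism ; f-inj = injective ; f-surj = surjective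
    ; agent = agent ; agent-lab = agent-lab ; agent-home = agent-home
    ; agent-surj = λ z → [ (λ { (r , e) → r , lab-inj (agent r) z (trans (agent-lab r) e) }) ,
                           (λ no-rank → ⊥-elim (Stranger.impossible z (λ r e → no-rank (r , e)))) ]′
                         (toSum (Fin.any? (λ r → label r ℕ.≟ lab z))) }

open Obs

-- The algorithm

nth : List Obs → ℕ → Obs
nth [] _ = obs 0 nothing 0
nth (o ∷ os) zero = o
nth (o ∷ os) (suc i) = nth os i

nth-last : ∀ os o → nth (os ∷ʳ o) (length os) ≡ o
nth-last [] o = refl
nth-last (_ ∷ os) o = nth-last os o

nth-init : ∀ os o i → i < length os → nth (os ∷ʳ o) i ≡ nth os i
nth-init (_ ∷ os) o zero _ = refl
nth-init (_ ∷ os) o (suc i) (s≤s lt) = nth-init os o i lt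

length-∷ʳ : ∀ (os : List Obs) o → length (os ∷ʳ o) ≡ suc (length os)
length-∷ʳ os o = trans (length-++ os) (+-comm (length os) 1)

recordOf : Obs → ℕ × Maybe ℕ
recordOf o = degree o , entry o

-- The record of slot y + 1 is the observation made right after the move of slot y.
traceOf : List Obs → ℕ → Trace
traceOf os zero = recordOf (nth os 0) ∷ []
traceOf os (suc y) = recordOf (nth os (suc (slotTime y))) ∷ traceOf os y

finish : ℕ → ℕ
finish h = length (prog (suc h))

tourEnd : ℕ → ℕ
tourEnd h = length (prog h) + length (Plan.tours (hyp h) (prog h))

simAt : ∀ H → Fin (Hyp.agents H) → ℕ → Fin (Hyp.nodes H) × Trace
simAt H r x = Plan.sim H r (pre x)

simCount : ∀ H → Fin (Hyp.agents H) → ℕ → ℕ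
simCount H r x = ♯ (λ r' → proj₁ (simAt H r' x) Fin.≟ proj₁ (simAt H r x))

Accepts : ℕ → ℕ → List Obs → Set
Accepts h ℓ os = WellFormed (hyp h) × ∃ λ r → Hyp.label (hyp h) r ≡ ℓ × traceOf os (finish h) ≡ proj₂ (simAt (hyp h) r (finish h)) ×
  (∀ {x} → x < suc (finish h) → 2 + tourEnd h ≤ x → count (nth os (4 ^ x)) ≡ simCount (hyp h) r x)

accepts? : ∀ h ℓ os → Dec (Accepts h ℓ os)
accepts? h ℓ os = wellFormed? (hyp h) ×-dec Fin.any? λ r → (Hyp.label (hyp h) r ℕ.≟ ℓ) ×-dec
  (traceOf os (finish h) ≟ᵗ proj₂ (simAt (hyp h) r (finish h))) ×-dec
  allUpTo? (λ x → (2 + tourEnd h ≤? x) →-dec (count (nth os (4 ^ x)) ℕ.≟ simCount (hyp h) r x)) (suc (finish h))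

-- `h < length os` makes the search finite and loses nothing, since `h` is at most `4 ^ finish h`.
Verdict : ℕ → List Obs → Set
Verdict ℓ os = ∃ λ h → h < length os × pred (length os) ≡ 4 ^ finish h × Accepts h ℓ os

opaque
  verdict? : ∀ ℓ os → Dec (Verdict ℓ os)
  verdict? ℓ os = anyUpTo? (λ h → (pred (length os) ℕ.≟ 4 ^ finish h) ×-dec accepts? h ℓ os) (length os)

obey : ∀ {P : Set} → Dec P → ℕ → Action
obey (yes _) p = move p
obey (no _) p = stay

follow : ℕ → List Obs → ℕ → Action
follow ℓ os y with pred (length os) ℕ.≟ slotTime y
... | no _ = stay
... | yes _ = obey ((who (slotAt y) ℕ.≟ ℓ) ×-dec (expect (slotAt y) ≟ᵗ traceOf os y)) (port (slotAt y))

decide : ∀ {ℓ os} → Dec (Verdict ℓ os) → Action → Action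
decide (yes (h , _)) _ = stop (Hyp.label (hyp h) (Hyp.leader (hyp h))) (Hyp.nodes (hyp h))
decide (no _) a = a

opaque
  algorithm : Algorithm
  algorithm ℓ os = decide (verdict? ℓ os) (follow ℓ os (σ (pred (length os))))

  algorithm-def : ∀ ℓ os → algorithm ℓ os ≡ decide (verdict? ℓ os) (follow ℓ os (σ (pred (length os))))
  algorithm-def ℓ os = refl

entryOf : Trace → Maybe ℕ
entryOf [] = nothing
entryOf ((_ , e) ∷ _) = e

-- The history seen by an agent in the model

module History {n : ℕ} (G : Graph n) {K : ℕ} (lab : Fin K → ℕ) (start : Fin K → Fin n) (wk : Fin K → ℕ → Bool) where
  open World G lab start wk

  trace : Fin K → ℕ → Trace
  trace z x = proj₂ (run G (lab z) (start z) (pre x))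

  trace-suc : ∀ z y → trace z (suc y) ≡ (deg G (X z (suc y)) , entryOf (trace z (suc y))) ∷ trace z y
  trace-suc z y = lemma (X z (suc y)) (pre (suc y)) (X-def z (suc y)) (pre-suc y)
    where
    lemma : ∀ v L → v ≡ proj₁ (run G (lab z) (start z) L) → L ≡ slotAt y ∷ pre y →
      proj₂ (run G (lab z) (start z) L) ≡ (deg G v , entryOf (proj₂ (run G (lab z) (start z) L))) ∷ trace z y
    lemma v L refl refl with advance-shape G (lab z) (slotAt y) (run G (lab z) (start z) (pre y))
    ... | e , eq = trans eq (cong (λ e' → (deg G (proj₁ (advance G (lab z) (slotAt y) (run G (lab z) (start z) (pre y)))) , e') ∷ trace z y) (sym (cong entryOf eq)))

  trace-zero : ∀ z → trace z 0 ≡ (deg G (X z 0) , nothing) ∷ []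
  trace-zero z = trans (cong (λ L → proj₂ (run G (lab z) (start z) L)) pre-zero) (cong (λ v → (deg G v , nothing) ∷ []) (sym (X-start z)))

  entryAt : Fin K → ℕ → Maybe ℕ
  entryAt z zero = nothing
  entryAt z (suc s) with s ℕ.≟ slotTime (σ s)
  ... | yes _ = entryOf (trace z (suc (σ s)))
  ... | no _  = nothing

  entryAt-move : ∀ z y → entryAt z (suc (slotTime y)) ≡ entryOf (trace z (suc y))
  entryAt-move z y with slotTime y ℕ.≟ slotTime (σ (slotTime y))
  ... | yes _ = cong (λ x → entryOf (trace z (suc x))) (σ-slotTime y)
  ... | no ne = ⊥-elim (ne (cong slotTime (sym (σ-slotTime y))))

  view : ℕ → Fin K → Obs
  view t z = obs (deg G (pos t z)) (entryAt z (clock t z)) (crowd (clock t) (pos t z))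

  -- The clock advances exactly in the rounds in which the agent acts, the round of its wake-up
  -- included.
  Acting : ℕ → Fin K → Set
  Acting t z = clock (suc t) z ≡ suc (clock t z)

  append : ℕ → List Obs → Obs → List Obs
  append zero os o = []
  append (suc _) os o = os ∷ʳ o

  hist : ℕ → Fin K → List Obs
  hist zero z = []
  hist (suc t) z = append (clock (suc t) z) (hist t z) (view t z)

  seen : ℕ → Fin K → List Obs
  seen t z = hist t z ∷ʳ view t z

  hist-acting : ∀ t z → Acting t z → hist (suc t) z ≡ seen t z
  hist-acting t z ac = cong (λ s → append s (hist t z) (view t z)) ac

  hist-asleep : ∀ t z → clock t z ≡ 0 → hist t z ≡ []
  hist-asleep zero z _ = refl
  hist-asleep (suc t) z e = cong (λ s → append s (hist t z) (view t z)) e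

  acting : ∀ t z → 1 ≤ clock (suc t) z → Acting t z
  acting t z pos with 1 ≤? clock t z
  ... | yes p = clock-next t z p
  ... | no ¬p = ≤-antisym (clock-step t z) (≤-trans (s≤s (≤-reflexive (n<1⇒n≡0 (≰⇒> ¬p)))) pos)

  hist-length : ∀ t z → length (hist t z) ≡ clock t z
  hist-length zero z = sym (clock-zero z)
  hist-length (suc t) z with 1 ≤? clock (suc t) z
  ... | no ¬p = trans (cong length (hist-asleep (suc t) z (n<1⇒n≡0 (≰⇒> ¬p)))) (sym (n<1⇒n≡0 (≰⇒> ¬p)))
  ... | yes p = trans (cong length (hist-acting t z (acting t z p))) (trans (length-∷ʳ (hist t z) (view t z))
                  (trans (cong suc (hist-length t z)) (sym (acting t z p))))

  seen-length : ∀ t z → length (seen t z) ≡ suc (clock t z)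
  seen-length t z = trans (length-∷ʳ (hist t z) (view t z)) (cong suc (hist-length t z))

  nth-seen : ∀ t t' z → t' ≤ t → Acting t' z → nth (seen t z) (clock t' z) ≡ view t' z
  nth-seen t t' z le ac with m≤n⇒m<n∨m≡n le
  ... | inj₂ refl = subst (λ i → nth (seen t z) i ≡ view t z) (hist-length t z) (nth-last (hist t z) (view t z))
  nth-seen (suc t) t' z le ac | inj₁ (s≤s lt) = trans (nth-init (hist (suc t) z) (view (suc t) z) (clock t' z)
        (≤-trans (≤-trans (≤-reflexive (sym ac)) (clock-mono z (s≤s lt))) (≤-reflexive (sym (hist-length (suc t) z)))))
      (trans (cong (λ os → nth os (clock t' z)) (hist-acting t z (acting t z (≤-trans (≤-trans (s≤s z≤n) (≤-reflexive (sym ac))) (clock-mono z (s≤s lt)))))) (nth-seen t t' z lt ac))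

  acted : ∀ t z s → Acting t z → s ≤ clock t z → ∃ λ t' → t' ≤ t × clock t' z ≡ s × Acting t' z
  acted t z s ac le with m≤n⇒m<n∨m≡n le
  ... | inj₂ e = t , ≤-refl , sym e , ac
  acted zero z s ac le | inj₁ lt = ⊥-elim (n≮0 (≤-trans lt (≤-reflexive (clock-zero z))))
  acted (suc t) z s ac le | inj₁ lt with acted t z s (acting t z (≤-trans (s≤s z≤n) lt)) (s≤s⁻¹ (≤-trans lt (clock-step t z)))
  ... | t' , l , e , ac' = t' , m≤n⇒m≤1+n l , e , ac'

  record-seen : ∀ t z s → Acting t z → s ≤ clock t z → recordOf (nth (seen t z) s) ≡ (deg G (X z (σ s)) , entryAt z s)
  record-seen t z s ac le with acted t z s ac le
  ... | t' , l , refl , ac' = cong recordOf (nth-seen t t' z l ac')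

  traceOf-seen : ∀ t z y → Acting t z → y ≤ σ (clock t z) → traceOf (seen t z) y ≡ trace z y
  traceOf-seen t z zero ac le = trans (cong (_∷ []) (record-seen t z 0 ac z≤n)) (sym (trace-zero z))
  traceOf-seen t z (suc y) ac le = trans (cong₂ _∷_ (trans (record-seen t z (suc (slotTime y)) ac (σ-lower (clock t z) le))
      (cong₂ _,_ (cong (λ x → deg G (X z x)) σ≡) (entryAt-move z y))) (traceOf-seen t z y ac (≤-trans (n≤1+n y) le))) (sym (trace-suc z y))
    where
    σ≡ : σ (suc (slotTime y)) ≡ suc y
    σ≡ = ≤-antisym (σ-before (slotTime-< y)) (σ-after ≤-refl)

open Obs

-- Completeness

module Bridge {n : ℕ} (G : Graph n) (lawG : Lawful G) {K : ℕ} (lab : Fin K → ℕ) (lab-inj : ∀ y z → lab y ≡ lab z → y ≡ z)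
              (start : Fin K → Fin n) (wk : Fin K → ℕ → Bool) (h : ℕ) (wf : WellFormed (hyp h)) where
  open Phase G lawG lab start wk h wf
  open History G lab start wk

  finish≡ : finish h ≡ ν whole
  finish≡ = trans (cong length next-prog) (emits-length B whole)

  whole-prefix : Prefix whole
  whole-prefix = [] , sym (++-identityʳ whole)

  pre-finish : pre (finish h) ≡ ⟦ whole ⟧
  pre-finish = trans (cong pre finish≡) (pre-ν whole whole-prefix)

  module _ (a : Fin K) (w : ℕ) (awake : clock w a ≡ 1) (i : Fin agents) (rank-a : lab a ≡ label i) where
    open Observer a w awake i rank-a

    τ≤ : ∀ x t → 4 ^ x ≤ clock t a → τ x ≤ t
    τ≤ x t le = ≮⇒≥ λ lt → <⇒≱ (≤-trans (+-monoˡ-≤ (clock t a) (m<n⇒0<n∸m lt)) (≤-reflexive (trans (sym (clock-≡ (τ x ∸ t) t a (≤-trans (4^-pos x) le)))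
      (trans (cong (λ u → clock u a) (m∸n+n≡m (<⇒≤ lt))) (S-self x))))) le

    acting-τ : ∀ x → Acting (τ x) a
    acting-τ x = clock-next (τ x) a (subst (1 ≤_) (sym (S-self x)) (4^-pos x))

    sample : ∀ t x → 4 ^ x ≤ clock t a → count (nth (seen t a) (4 ^ x)) ≡ crowd (clock (τ x)) (P a x)
    sample t x le = trans (cong (λ s → count (nth (seen t a) s)) (sym (S-self x))) (cong count (nth-seen t (τ x) a (τ≤ x t le) (acting-τ x)))

    simCount-ν : ∀ cs → Prefix cs → simCount (hyp h) i (ν cs) ≡ ♯ (λ r → A r cs Fin.≟ A i cs)
    simCount-ν cs p = cong (λ L → ♯ (λ r → at r L Fin.≟ at i L)) (pre-ν cs p)

    module _ (t : ℕ) (now : clock t a ≡ 4 ^ finish h) where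

      acting-now : Acting t a
      acting-now = clock-next t a (subst (1 ≤_) (sym now) (4^-pos (finish h)))

      trace-now : traceOf (seen t a) (finish h) ≡ proj₂ (run G (label i) (start a) ⟦ whole ⟧)
      trace-now = trans (traceOf-seen t a (finish h) acting-now (≤-reflexive (sym (trans (cong σ now) (σ-sample (finish h))))))
        (cong₂ (λ ℓ L → proj₂ (run G ℓ (start a) L)) rank-a pre-finish)

      sampled : ∀ x → x ≤ finish h → 4 ^ x ≤ clock t a
      sampled x le = ≤-trans (4^-mono le) (≤-reflexive (sym now))

      accepted-agrees : traceOf (seen t a) (finish h) ≡ proj₂ (simAt (hyp h) i (finish h)) → Ag i (start a) whole
      accepted-agrees eq = trans (sym trace-now) (trans eq (cong (λ L → proj₂ (sim i L)) pre-finish))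

      agrees-accepted : Ag i (start a) whole → traceOf (seen t a) (finish h) ≡ proj₂ (simAt (hyp h) i (finish h))
      agrees-accepted ag = trans trace-now (trans ag (cong (λ L → proj₂ (sim i L)) (sym pre-finish)))

      accepted-counts : (∀ {x} → x < suc (finish h) → 2 + tourEnd h ≤ x → count (nth (seen t a) (4 ^ x)) ≡ simCount (hyp h) i x) → Counts
      accepted-counts eqs cs p late = trans (sym (sample t (ν cs) (sampled (ν cs) ν≤))) (trans (eqs (s≤s ν≤) late) (simCount-ν cs p))
        where
        ν≤ : ν cs ≤ finish h
        ν≤ = ≤-trans (ν-prefix cs p) (≤-reflexive (sym finish≡))

      counts-accepted : Counts → ∀ {x} → x < suc (finish h) → 2 + tourEnd h ≤ x → count (nth (seen t a) (4 ^ x)) ≡ simCount (hyp h) i x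
      counts-accepted counts {x} (s≤s x≤) late = at-prefix (slot-prefix x (≤-trans (m≤m+n (length B) _) (≤-trans (m≤n+m _ 2) late)) (≤-trans x≤ (≤-reflexive finish≡)))
        where
        at-prefix : (∃ λ cs → Prefix cs × ν cs ≡ x) → count (nth (seen t a) (4 ^ x)) ≡ simCount (hyp h) i x
        at-prefix (cs , p , refl) = trans (sample t (ν cs) (sampled (ν cs) x≤)) (trans (counts cs p late) (sym (simCount-ν cs p)))

      accepted-truth : (∀ v w → ∃ λ π → Valid G v π × end G v π ≡ w) →
        traceOf (seen t a) (finish h) ≡ proj₂ (simAt (hyp h) i (finish h)) →
        (∀ {x} → x < suc (finish h) → 2 + tourEnd h ≤ x → count (nth (seen t a) (4 ^ x)) ≡ simCount (hyp h) i x) →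
        Truth G lab start (hyp h)
      accepted-truth conn tr eqs = Certify.truth G lawG lab lab-inj start wk h wf a w awake i rank-a (accepted-agrees tr) (accepted-counts eqs) conn

  module Completeness (tru : Truth G lab start (hyp h)) (z₀ : Fin K) (t₀ : ℕ) (awake₀ : 1 ≤ clock t₀ z₀) where
    open Truth tru
    open Morphism morphism

    rank : Fin K → Fin agents
    rank z = proj₁ (agent-surj z)

    lab-rank : ∀ z → lab z ≡ label (rank z)
    lab-rank z = trans (cong lab (sym (proj₂ (agent-surj z)))) (agent-lab (rank z))

    home-rank : ∀ z → start z ≡ f (home (rank z))
    home-rank z = trans (cong start (sym (proj₂ (agent-surj z)))) (agent-home (rank z))

    run-rank : ∀ z L → run G (label (rank z)) (start z) L ≡ (f (at (rank z) L) , proj₂ (sim (rank z) L))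
    run-rank z L = trans (cong (λ v → run G (label (rank z)) v L) (home-rank z)) (run-f (label (rank z)) (home (rank z)) L)

    agrees : ∀ z cs → Ag (rank z) (start z) cs
    agrees z cs = cong proj₂ (run-rank z ⟦ cs ⟧)

    X-rank : ∀ z cs → Prefix cs → X z (ν cs) ≡ f (A (rank z) cs)
    X-rank z cs p = trans (X-R cs (lab-rank z) p) (cong proj₁ (run-rank z ⟦ cs ⟧))

    module From (a : Fin K) (w : ℕ) (awake : clock w a ≡ 1) where
      open Observer a w awake (rank a) (lab-rank a) public

      all-awake : ∀ z → 1 ≤ S z (suc t₁)
      all-awake z = [ (λ { refl → subst (1 ≤_) (sym (S-self (suc t₁))) (4^-pos (suc t₁)) }) ,
                      (λ z≢a → tour-wakes (agrees a (tours B)) f morphism f-surj (home-rank a) z z≢a) ]′ (toSum (z Fin.≟ a))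

    first-tick : ∀ z t → 1 ≤ clock t z → ∃ λ w → clock w z ≡ 1
    first-tick z t le with clock-reach t z 1 le
    ... | w , _ , e = w , e

    opaque
      -- The tour of `z₀` wakes everybody; afterwards each agent can take the role of the observer.
      wake-time : ∀ z → ∃ λ w → clock w z ≡ 1
      wake-time z = first-tick z _ (From.all-awake z₀ (proj₁ (first-tick z₀ t₀ awake₀)) (proj₂ (first-tick z₀ t₀ awake₀)) z)

    gap : ℕ
    gap = 4 ^ suc t₁

    -- Seen from `z`: by the time its own clock reads `gap` everybody is awake, and from then on all
    -- clocks advance together.
    clocks-close : ∀ y z t → clock t z ≤ clock t y + gap
    clocks-close y z t = [ before , after ]′ (≤-total t (τ (suc t₁)))
      where
      open From z (proj₁ (wake-time z)) (proj₂ (wake-time z))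
      before : t ≤ τ (suc t₁) → clock t z ≤ clock t y + gap
      before le = ≤-trans (clock-mono z le) (≤-trans (≤-reflexive (S-self (suc t₁))) (m≤n+m gap (clock t y)))
      after : τ (suc t₁) ≤ t → clock t z ≤ clock t y + gap
      after le = ≤-trans (≤-reflexive (trans (since z) (cong (d +_) (S-self (suc t₁)))))
          (+-monoˡ-≤ gap (≤-trans (m≤m+n d _) (≤-reflexive (sym (since y)))))
        where
        d = t ∸ τ (suc t₁)
        since : ∀ y → clock t y ≡ d + S y (suc t₁)
        since y = trans (cong (λ u → clock u y) (sym (m∸n+n≡m le))) (clock-≡ d (τ (suc t₁)) y (all-awake y))

    -- gap ≤ 4 ^ (E - 1) for every slot E ≥ t₁ + 2, so clocks at most one gap below and four gaps above 4 ^ E lie in slot E.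
    in-slot : ∀ x s → 2 + t₁ ≤ x → 4 ^ x ≤ s + gap → s ≤ 4 ^ x + 4 * gap → σ s ≡ x
    in-slot (suc x) s (s≤s le) low high = ≤-antisym (σ-before (≤-trans high (begin
        4 ^ suc x + 4 * gap       ≤⟨ +-monoʳ-≤ (4 ^ suc x) (*-monoʳ-≤ 4 (4^-mono le)) ⟩
        4 ^ suc x + 4 * 4 ^ x     ≡⟨ lemma (4 ^ x) ⟩
        slotTime (suc x)          ∎)))
      (σ-after {x} {s} (+-cancelʳ-< gap (2 * 4 ^ x) s (begin-strict
        2 * 4 ^ x + gap           ≤⟨ +-monoʳ-≤ (2 * 4 ^ x) (4^-mono le) ⟩
        2 * 4 ^ x + 4 ^ x         <⟨ +-monoʳ-< (2 * 4 ^ x) (m<m+n (4 ^ x) (4^-pos x)) ⟩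
        2 * 4 ^ x + (4 ^ x + 4 ^ x) ≡⟨ lemma' (4 ^ x) ⟩
        4 ^ suc x                 ≤⟨ low ⟩
        s + gap                   ∎)))
      where
      open ≤-Reasoning
      lemma : ∀ q → 4 * q + 4 * q ≡ 2 * (4 * q)
      lemma = solve-∀
      lemma' : ∀ q → 2 * q + (q + q) ≡ 4 * q
      lemma' = solve-∀

    module _ (a : Fin K) where
      open From a (proj₁ (wake-time a)) (proj₂ (wake-time a))

      P-rank : ∀ z cs → Prefix cs → 2 + t₁ ≤ ν cs → P z (ν cs) ≡ f (A (rank z) cs)
      P-rank z cs p late = trans (cong (X z) (in-slot (ν cs) (S z (ν cs)) late
          (≤-trans (≤-reflexive (sym (S-self (ν cs)))) (clocks-close z a (τ (ν cs))))
          (≤-trans (clocks-close a z (τ (ν cs))) (+-mono-≤ (≤-reflexive (S-self (ν cs))) (m≤m+n gap _)))))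
        (X-rank z cs p)

      counted : Counts
      counted cs p late = trans (crowd-def (clock (τ (ν cs))) (P a (ν cs))) (≤-antisym
        (♯-inject (λ z → P z (ν cs) Fin.≟ P a (ν cs)) (λ r → A r cs Fin.≟ A (rank a) cs) rank
          (λ {z} e → f-inj _ _ (trans (sym (P-rank z cs p late)) (trans e (P-rank a cs p late))))
          (λ {z} {z'} _ _ e → lab-inj z z' (trans (lab-rank z) (trans (cong label e) (sym (lab-rank z'))))))
        (♯-inject (λ r → A r cs Fin.≟ A (rank a) cs) (λ z → P z (ν cs) Fin.≟ P a (ν cs)) agent
          (λ {r} e → trans (P-rank (agent r) cs p late) (trans (cong f (trans (cong (λ r → A r cs) (rank-agent r)) e)) (sym (P-rank a cs p late))))
          (λ {r} {r'} _ _ e → label-inj r r' (trans (sym (agent-lab r)) (trans (cong lab e) (agent-lab r'))))))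
        where
        rank-agent : ∀ r → rank (agent r) ≡ r
        rank-agent r = label-inj _ r (trans (sym (lab-rank (agent r))) (agent-lab r))

      accepts : ∀ t → clock t a ≡ 4 ^ finish h → Accepts h (lab a) (seen t a)
      accepts t now = wf , rank a , sym (lab-rank a) ,
        agrees-accepted a w awake (rank a) (lab-rank a) t now (agrees a whole) ,
        counts-accepted a w awake (rank a) (lab-rank a) t now counted
        where
        w = proj₁ (wake-time a)
        awake = proj₂ (wake-time a)

    late-finish : 2 + t₁ ≤ finish h
    late-finish = ≤-trans (≤-trans (≤-reflexive (+-comm 2 t₁)) (≤-trans (+-mono-≤ (ν-mono (tours B) (routes B)) two≤roll)
      (≤-trans (≤-reflexive (sym (ν-++ assembly roll))) (≤-trans (ν-mono (assembly ++ roll) _) (≤-reflexive (cong ν (++-assoc assembly roll _)))))))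
      (≤-reflexive (sym finish≡))

    A-whole : ∀ r → A r whole ≡ centre
    A-whole r = A-closed r assembly trials (A-assembly r)
      (closed-++ roll _ closed-roll (closed-++ roll _ closed-roll (closed-++ exploreAll exploreAll closed-exploreAll closed-exploreAll)))

    -- In this window all clocks, at most one `gap` apart, lie between the last slot of the
    -- hypothesis and the slot after it.
    gather : ∀ t y z → 4 ^ finish h ≤ clock t y → clock t y ≤ 4 ^ finish h + 3 * gap → pos t z ≡ f centre
    gather t y z low high = trans (cong (X z) (in-slot (finish h) (clock t z) late-finish
        (≤-trans low (clocks-close z y t))
        (≤-trans (clocks-close y z t) (≤-trans (+-monoˡ-≤ gap high) (≤-reflexive (lemma (4 ^ finish h) gap))))))
      (trans (cong (X z) finish≡) (trans (X-rank z whole whole-prefix) (cong f (A-whole (rank z)))))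
      where
      lemma : ∀ e g → e + 3 * g + g ≡ e + 4 * g
      lemma = solve-∀

    final-time : ∃ λ T → ∀ z → 4 ^ finish h < clock T z × clock T z ≤ 4 ^ finish h + 3 * gap
    final-time = T , λ z → low z , high z
      where
      w = proj₁ (wake-time z₀)
      E = finish h
      -- The clock of `z₀` then reads `4 ^ E + gap + 1`, so even the slowest agent is past `4 ^ E`,
      -- while the fastest is at most `2 * gap + 1` beyond it.
      T = (4 ^ E + gap) + w
      here₀ : clock T z₀ ≡ 4 ^ E + (gap + 1)
      here₀ = trans (clock-≡ (4 ^ E + gap) w z₀ (≤-reflexive (sym (proj₂ (wake-time z₀)))))
        (trans (cong (4 ^ E + gap +_) (proj₂ (wake-time z₀))) (+-assoc (4 ^ E) gap 1))
      low : ∀ z → 4 ^ E < clock T z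
      low z = +-cancelʳ-≤ gap _ _ (≤-trans (≤-reflexive (lemma (4 ^ E) gap)) (≤-trans (≤-reflexive (sym here₀)) (clocks-close z z₀ T)))
        where
        lemma : ∀ e g → suc e + g ≡ e + (g + 1)
        lemma = solve-∀
      high : ∀ z → clock T z ≤ 4 ^ E + 3 * gap
      high z = ≤-trans (clocks-close z₀ z T) (≤-trans (≤-reflexive (trans (cong (_+ gap) here₀) (lemma (4 ^ E) gap)))
        (+-monoʳ-≤ (4 ^ E) (≤-trans (+-monoʳ-≤ (gap + gap) (4^-pos (suc t₁))) (≤-reflexive (lemma' gap)))))
        where
        lemma : ∀ e g → e + (g + 1) + g ≡ e + (g + g + 1)
        lemma = solve-∀
        lemma' : ∀ g → g + g + g ≡ 3 * g
        lemma' = solve-∀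

-- The first accepted hypothesis

least : ∀ {Q : ℕ → Set} → (∀ m → Dec (Q m)) → ∀ b m → m ≤ b → Q m → ∃ λ m → Q m × (∀ m' → m' < m → ¬ Q m')
least Q? b m le q with anyUpTo? Q? m
... | no none = m , q , λ m' lt q' → none (m' , lt , q')
least Q? (suc b) m le q | yes (m' , lt , q') = least Q? b m' (s≤s⁻¹ (≤-trans lt le)) q'
least Q? zero m le q | yes (m' , lt , q') = ⊥-elim (n≮0 (≤-trans lt le))

record Outcome {n : ℕ} (G : Graph n) {K : ℕ} (lab : Fin K → ℕ) (start : Fin K → Fin n) (wk : Fin K → ℕ → Bool) : Set where
  open World G lab start wk
  open History G lab start wk
  field
    h        : ℕ
    elected  : Fin K
    leader≡  : Hyp.label (hyp h) (Hyp.leader (hyp h)) ≡ lab elected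
    nodes≡   : Hyp.nodes (hyp h) ≡ n
    accepts  : ∀ z t → clock t z ≡ 4 ^ finish h → Accepts h (lab z) (seen t z)
    rejects  : ∀ h' → h' < h → ∀ z t → clock t z ≡ 4 ^ finish h' → ¬ Accepts h' (lab z) (seen t z)
    T        : ℕ
    all-past : ∀ z → 4 ^ finish h < clock T z
    hub      : Fin n
    -- Only up to `T`, because later the model without stopping leaves the hub; by then every real
    -- agent has declared.
    at-hub   : ∀ t y z → t ≤ T → 4 ^ finish h ≤ clock t y → pos t z ≡ hub

module _ {n : ℕ} (G : Graph n) (lawG : Lawful G) (conn : ∀ v w → ∃ λ π → Valid G v π × end G v π ≡ w)
         {K : ℕ} (lab : Fin K → ℕ) (lab-inj : ∀ y z → lab y ≡ lab z → y ≡ z) (start : Fin K → Fin n) (wk : Fin K → ℕ → Bool)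
         (z₀ : Fin K) (t₀ : ℕ) (awake₀ : 1 ≤ World.clock G lab start wk t₀ z₀) where
  open World G lab start wk
  open History G lab start wk

  opaque
    accepts⇒truth : ∀ h a t → clock t a ≡ 4 ^ finish h → Accepts h (lab a) (seen t a) → WellFormed (hyp h) × Truth G lab start (hyp h)
    accepts⇒truth h a t now (wf , r , e , tr , eqs) with clock-reach t a 1 (subst (1 ≤_) (sym now) (4^-pos (finish h)))
    ... | w , _ , awake = wf , Bridge.accepted-truth G lawG lab lab-inj start wk h wf a w awake r (sym e) t now conn tr eqs

    truth⇒accepts : ∀ h → WellFormed (hyp h) → Truth G lab start (hyp h) → ∀ z t → clock t z ≡ 4 ^ finish h → Accepts h (lab z) (seen t z)
    truth⇒accepts h wf tru = Bridge.Completeness.accepts G lawG lab lab-inj start wk h wf tru z₀ t₀ awake₀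

    awake : ∃ λ w → clock w z₀ ≡ 1
    awake with clock-reach t₀ z₀ 1 awake₀
    ... | w , _ , e = w , e

  open Watch z₀ (proj₁ awake) (proj₂ awake)

  -- Acceptance by one agent implies truth, and truth implies acceptance by all. So the least
  -- hypothesis accepted by `z₀` is the least one accepted by anybody.
  truth⇒outcome : ∀ h₀ → WellFormed (hyp h₀) → Truth G lab start (hyp h₀) → Outcome G lab start wk
  truth⇒outcome h₀ wf₀ tru₀ = conclude (least {Q = λ h → Accepts h (lab z₀) (seen (τ (finish h)) z₀)}
      (λ h → accepts? h (lab z₀) (seen (τ (finish h)) z₀)) h₀ h₀ ≤-refl (truth⇒accepts h₀ wf₀ tru₀ z₀ (τ (finish h₀)) (S-self (finish h₀))))
    where
    conclude : (∃ λ h → Accepts h (lab z₀) (seen (τ (finish h)) z₀) × (∀ h' → h' < h → ¬ Accepts h' (lab z₀) (seen (τ (finish h')) z₀))) → Outcome G lab start wk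
    conclude (h , acc , minimal) = record
      { h = h
      ; elected = agent (Hyp.leader (hyp h))
      ; leader≡ = sym (agent-lab (Hyp.leader (hyp h)))
      ; nodes≡ = ≤-antisym (Fin.injective⇒≤ {f = f} (λ {u} {u'} → f-inj u u'))
          (Fin.injective⇒≤ {f = λ v → proj₁ (f-surj v)} (λ {v} {v'} e → trans (sym (proj₂ (f-surj v))) (trans (cong f e) (proj₂ (f-surj v')))))
      ; accepts = truth⇒accepts h wf tru
      ; rejects = λ h' lt z t now acc' → minimal h' lt (truth⇒accepts h' (proj₁ (accepts⇒truth h' z t now acc')) (proj₂ (accepts⇒truth h' z t now acc')) z₀ (τ (finish h')) (S-self (finish h')))
      ; T = proj₁ final
      ; all-past = λ z → proj₁ (proj₂ final z)
      ; hub = f (Hyp.centre (hyp h))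
      ; at-hub = λ t y z le low → Bridge.Completeness.gather G lawG lab lab-inj start wk h wf tru z₀ t₀ awake₀ t y z low
          (≤-trans (clock-mono y le) (proj₂ (proj₂ final y)))
      }
      where
      wf = proj₁ (accepts⇒truth h z₀ (τ (finish h)) (S-self (finish h)) acc)
      tru = proj₂ (accepts⇒truth h z₀ (τ (finish h)) (S-self (finish h)) acc)
      final = Bridge.Completeness.final-time G lawG lab lab-inj start wk h wf tru z₀ t₀ awake₀
      open Truth tru

-- The hypothesis describing a given network

module Encoding {n : ℕ} (PG : PortGraph n) where
  private module PG = PortGraph PG

  row : Fin n → Row n
  row v = PG.deg v , tabulate (λ p → proj₁ (PG.opp (v , p)) , toℕ (proj₂ (PG.opp (v , p))))

  -- Built with `entry-of`, as decoded graphs are, so that both agree on all ports, even those out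
  -- of range.
  toGraph : Graph n
  toGraph = record { deg = PG.deg ; to = λ v → entry-of v (row v) }

  to-valid : ∀ v p (lt : p < PG.deg v) → to toGraph v p ≡ (proj₁ (PG.opp (v , fromℕ< lt)) , toℕ (proj₂ (PG.opp (v , fromℕ< lt))))
  to-valid v p lt with p <? PG.deg v
  ... | yes lt' = lookup∘tabulate _ (fromℕ< lt')
  ... | no ¬lt = ⊥-elim (¬lt lt)

  to-dart : ∀ v (p : Fin (PG.deg v)) → to toGraph v (toℕ p) ≡ (proj₁ (PG.opp (v , p)) , toℕ (proj₂ (PG.opp (v , p))))
  to-dart v p = trans (to-valid v (toℕ p) (Fin.toℕ<n p)) (cong (λ q → proj₁ (PG.opp (v , q)) , toℕ (proj₂ (PG.opp (v , q)))) (Fin.fromℕ<-toℕ p (Fin.toℕ<n p)))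

  lawful : Lawful toGraph
  lawful v p lt = subst (λ w → proj₂ w < PG.deg (proj₁ w) × to toGraph (proj₁ w) (proj₂ w) ≡ (v , p)) (sym (to-valid v p lt))
    (Fin.toℕ<n (proj₂ (PG.opp d)) , trans (to-dart _ (proj₂ (PG.opp d)))
      (trans (cong (λ e → proj₁ e , toℕ (proj₂ e)) (PG.opp-invol d)) (cong (v ,_) (Fin.toℕ-fromℕ< lt))))
    where d = v , fromℕ< lt

  reach-path : ∀ {u v} → Reach PG u v → ∃ λ π → Valid toGraph u π × end toGraph u π ≡ v
  reach-path here = [] , tt , refl
  reach-path {u} (step {v} r p) with reach-path r
  ... | π , val , refl = π ++ [ toℕ p ] , valid-++ toGraph u π val (Fin.toℕ<n p , tt) ,
        trans (end-++ toGraph u π _) (cong proj₁ (to-dart _ p))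

  module _ (connected : Connected PG) {k : ℕ} (two : 2 ≤ k) (lab : Fin k → ℕ) (lab-inj : ∀ y z → lab y ≡ lab z → y ≡ z)
           (start : Fin k → Fin n) (start-inj : ∀ y z → start y ≡ start z → y ≡ z) (i₀ : Fin k) where

    conn : ∀ v w → ∃ λ π → Valid toGraph v π × end toGraph v π ≡ w
    conn v w = reach-path (connected v w)

    c : Fin n
    c = start i₀

    route : Fin n → List ℕ
    route u = proj₁ (conn c u)

    code : Code
    code = n , k , tabulate row , tabulate lab , tabulate start , tabulate (λ u → length (route u) , fromList (route u)) , c , i₀

    private module H = Hyp (decode code)

    deg-H : ∀ v → deg H.graph v ≡ PG.deg v
    deg-H v = cong proj₁ (lookup∘tabulate row v)

    to-H : ∀ v p → to H.graph v p ≡ to toGraph v p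
    to-H v p = cong (λ r → entry-of v r p) (lookup∘tabulate row v)

    path-H : ∀ u → H.path u ≡ route u
    path-H u = trans (cong (λ (r : Σ ℕ (Vec ℕ)) → toList (proj₂ r)) (lookup∘tabulate (λ u → length (route u) , fromList (route u)) u)) (toList∘fromList (route u))

    identity : Morphism H.graph toGraph (λ u → u)
    identity = record { deg-f = λ u → sym (deg-H u) ; go-f = λ u p _ → cong proj₁ (sym (to-H u p)) ; en-f = λ u p _ → cong proj₂ (sym (to-H u p)) }

    -- Some other agent starts elsewhere, and the route to its start has to leave `c`.
    c-deg : 0 < PG.deg c
    c-deg = first (route (start j)) (proj₁ (proj₂ (conn c (start j)))) (proj₂ (proj₂ (conn c (start j))))
      where
      j = proj₁ (other two i₀)
      first : ∀ π → Valid toGraph c π → end toGraph c π ≡ start j → 0 < PG.deg c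
      first [] _ e = ⊥-elim (proj₂ (other two i₀) (start-inj j i₀ (sym e)))
      first (p ∷ π) (lt , _) _ = ≤-trans (s≤s z≤n) lt

    wellFormed : WellFormed (decode code)
    wellFormed = record
      { two = two
      ; label-inj = λ r r' e → lab-inj r r' (trans (sym (lookup∘tabulate lab r)) (trans e (lookup∘tabulate lab r')))
      ; path-valid = λ u → Morphism.valid-f identity c (H.path u) (subst (Valid toGraph c) (sym (path-H u)) (proj₁ (proj₂ (conn c u))))
      ; path-end = λ u → trans (sym (Morphism.end-f identity c (H.path u) (Morphism.valid-f identity c (H.path u) (subst (Valid toGraph c) (sym (path-H u)) (proj₁ (proj₂ (conn c u)))))))
          (trans (cong (end toGraph c) (path-H u)) (proj₂ (proj₂ (conn c u))))
      ; lawful = λ v p lt → subst₂ (λ w d → proj₂ w < d × to H.graph (proj₁ w) (proj₂ w) ≡ (v , p)) (sym (to-H v p)) (trans (sym (deg-H _)) (cong (λ w → deg H.graph (proj₁ w)) (sym (to-H v p))))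
          (proj₁ (lawful v p (subst (p <_) (deg-H v) lt)) , trans (to-H _ _) (proj₂ (lawful v p (subst (p <_) (deg-H v) lt))))
      ; centre-deg = subst (0 <_) (sym (deg-H c)) c-deg
      ; no-loop = λ e → PG.no-loop (c , fromℕ< c-deg) (trans (sym (cong proj₁ (to-valid c 0 c-deg))) (trans (cong proj₁ (sym (to-H c 0))) e))
      }

    truth : Truth toGraph lab start (decode code)
    truth = record
      { f = λ u → u ; morphism = identity ; f-inj = λ _ _ e → e ; f-surj = λ v → v , refl
      ; agent = λ r → r ; agent-lab = λ r → sym (lookup∘tabulate lab r) ; agent-home = λ r → sym (lookup∘tabulate start r) ; agent-surj = λ z → z , refl }

    outcome : ∀ wk z₀ t₀ → 1 ≤ World.clock toGraph lab start wk t₀ z₀ → Outcome toGraph lab start wk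
    outcome wk z₀ t₀ awake₀ = truth⇒outcome toGraph lawful conn lab lab-inj start wk z₀ t₀ awake₀ (proj₁ (hyp-onto code))
      (subst WellFormed (sym (proj₂ (hyp-onto code))) wellFormed) (subst (Truth toGraph lab start) (sym (proj₂ (hyp-onto code))) truth)

-- Correctness of the execution

n≤4^n : ∀ m → m ≤ 4 ^ m
n≤4^n zero = z≤n
n≤4^n (suc m) = ≤-trans (+-mono-≤ (4^-pos m) (n≤4^n m)) (+-monoʳ-≤ (4 ^ m) (m≤m+n (4 ^ m) _))

finish-< : ∀ {h h'} → h < h' → finish h < finish h'
finish-< {h} {suc h'} (s≤s le) with m≤n⇒m<n∨m≡n le
... | inj₁ lt = <-trans (finish-< lt) (prog-grows (suc h'))
... | inj₂ refl = prog-grows (suc h)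

finish-≤ : ∀ {h h'} → h ≤ h' → finish h ≤ finish h'
finish-≤ le = [ (λ lt → <⇒≤ (finish-< lt)) , (λ { refl → ≤-refl }) ]′ (m≤n⇒m<n∨m≡n le)

finish-injective : ∀ {h h'} → 4 ^ finish h ≡ 4 ^ finish h' → h ≡ h'
finish-injective e = ≤-antisym (≮⇒≥ λ lt → <-irrefl (sym e) (^-monoʳ-< 4 (s≤s (s≤s z≤n)) (finish-< lt)))
  (≮⇒≥ λ lt → <-irrefl e (^-monoʳ-< 4 (s≤s (s≤s z≤n)) (finish-< lt)))

decide-no : ∀ {ℓ os} (d : Dec (Verdict ℓ os)) → ¬ Verdict ℓ os → ∀ a → decide d a ≡ a
decide-no (yes v) ¬v a = ⊥-elim (¬v v)
decide-no (no _) ¬v a = refl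

decide-yes : ∀ {ℓ os} (d : Dec (Verdict ℓ os)) (v : Verdict ℓ os) → ∀ a →
  decide d a ≡ stop (Hyp.label (hyp (proj₁ v)) (Hyp.leader (hyp (proj₁ v)))) (Hyp.nodes (hyp (proj₁ v)))
decide-yes (no ¬v) v a = ⊥-elim (¬v v)
decide-yes (yes (h' , _ , e' , _)) (h , _ , e , _) a =
  cong (λ h → stop (Hyp.label (hyp h) (Hyp.leader (hyp h))) (Hyp.nodes (hyp h))) (finish-injective (trans (sym e') e))

module _ {n : ℕ} (PG : PortGraph n) (connected : Connected PG) (k : ℕ) (two : 2 ≤ k)
         (lab : Fin k → ℕ) (lab-inj : ∀ y z → lab y ≡ lab z → y ≡ z)
         (start : Fin k → Fin n) (start-inj : ∀ y z → start y ≡ start z → y ≡ z)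
         (wake : Fin k → Maybe ℕ) (i₀ : Fin k) (r₀ : ℕ) (wake₀ : wake i₀ ≡ just r₀) where
  private module PG = PortGraph PG
  open AgentState using (pos; status)
  open Execution PG algorithm k lab start wake
  open Encoding PG

  wk : Fin k → ℕ → Bool
  wk i t = adversaryWakes (wake i) t

  open World toGraph lab start wk renaming (pos to place)
  open History toGraph lab start wk

  woken₀ : 1 ≤ clock (suc r₀) i₀
  woken₀ = subst (1 ≤_) (sym (clock-suc r₀ i₀)) (lemma _ (clock r₀ i₀) (trans (cong (λ m → adversaryWakes m r₀) wake₀) (same r₀)))
    where
    same : ∀ r → (r ≡ᵇ r) ≡ true
    same zero = refl
    same (suc r) = same r
    lemma : ∀ {b} b' s → b ≡ true → 1 ≤ tick (b ∨ b') s
    lemma b' zero refl = ≤-refl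
    lemma b' (suc s) _ = s≤s z≤n

  opaque
    result : Outcome toGraph lab start wk
    result = outcome connected two lab lab-inj start start-inj i₀ wk i₀ (suc r₀) woken₀

  open Outcome result renaming (T to end-time)

  L N deadline : ℕ
  L = Hyp.label (hyp h) (Hyp.leader (hyp h))
  N = Hyp.nodes (hyp h)
  deadline = 4 ^ finish h

  -- The effect of `act` as a function of the chosen action, so that the action can be replaced by
  -- an equal one.
  post : Action → Fin n → List Obs → AgentState n
  post stay v os = ast v nothing (active os)
  post (stop L m) v os = ast v nothing (done L m)
  post (move p) v os with p <? PG.deg v
  ... | no _ = ast v nothing (active os)
  ... | yes q = ast (proj₁ (PG.opp (v , fromℕ< q))) (just (toℕ (proj₂ (PG.opp (v , fromℕ< q))))) (active os)

  act≡post : ∀ c i v e os → act c i v e os ≡ post (algorithm (lab i) (os ∷ʳ obs (PG.deg v) e (countAt c v))) v (os ∷ʳ obs (PG.deg v) e (countAt c v))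
  act≡post c i v e os with algorithm (lab i) (os ∷ʳ obs (PG.deg v) e (countAt c v))
  ... | stay = refl
  ... | stop L m = refl
  ... | move p with p <? PG.deg v
  ...   | no _ = refl
  ...   | yes q = refl

  post-valid : ∀ p v os (lt : p < PG.deg v) →
    post (move p) v os ≡ ast (proj₁ (PG.opp (v , fromℕ< lt))) (just (toℕ (proj₂ (PG.opp (v , fromℕ< lt))))) (active os)
  post-valid p v os lt with p <? PG.deg v
  ... | yes lt' = refl
  ... | no ¬lt = ⊥-elim (¬lt lt)

  post-invalid : ∀ p v os → ¬ p < PG.deg v → post (move p) v os ≡ ast v nothing (active os)
  post-invalid p v os ¬lt with p <? PG.deg v
  ... | yes lt = ⊥-elim (¬lt lt)
  ... | no _ = refl

  post-stay : ∀ ℓ sl v tr os → ¬ (who sl ≡ ℓ × expect sl ≡ tr) →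
    post stay v os ≡ ast (proj₁ (advance toGraph ℓ sl (v , tr))) (entryOf (proj₂ (advance toGraph ℓ sl (v , tr)))) (active os)
  post-stay ℓ sl v tr os ¬m = cong (λ st → ast (proj₁ st) (entryOf (proj₂ st)) (active os))
    (sym (advance-stays toGraph ℓ sl v tr (λ m → ¬m (proj₁ m , proj₁ (proj₂ m)))))

  post-move : ∀ ℓ sl v tr os → who sl ≡ ℓ → expect sl ≡ tr →
    post (move (port sl)) v os ≡ ast (proj₁ (advance toGraph ℓ sl (v , tr))) (entryOf (proj₂ (advance toGraph ℓ sl (v , tr)))) (active os)
  post-move ℓ sl v tr os a b = [ valid , invalid ]′ (toSum (port sl <? PG.deg v))
    where
    valid : port sl < PG.deg v → post (move (port sl)) v os ≡ ast (proj₁ (advance toGraph ℓ sl (v , tr))) (entryOf (proj₂ (advance toGraph ℓ sl (v , tr)))) (active os)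
    valid lt = trans (post-valid (port sl) v os lt) (trans (cong (λ d → ast (proj₁ d) (just (proj₂ d)) (active os)) (sym (to-valid v (port sl) lt)))
      (cong (λ st → ast (proj₁ st) (entryOf (proj₂ st)) (active os)) (sym (advance-moves toGraph ℓ sl v tr a b lt))))
    invalid : ¬ port sl < PG.deg v → post (move (port sl)) v os ≡ ast (proj₁ (advance toGraph ℓ sl (v , tr))) (entryOf (proj₂ (advance toGraph ℓ sl (v , tr)))) (active os)
    invalid ¬lt = trans (post-invalid (port sl) v os ¬lt)
      (cong (λ st → ast (proj₁ st) (entryOf (proj₂ st)) (active os)) (sym (advance-stays toGraph ℓ sl v tr (λ m → ¬lt (proj₂ (proj₂ m))))))

  follow-step : ∀ z os → traceOf os (σ (pred (length os))) ≡ trace z (σ (pred (length os))) →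
    post (follow (lab z) os (σ (pred (length os)))) (X z (σ (pred (length os)))) os
      ≡ ast (X z (σ (suc (pred (length os))))) (entryAt z (suc (pred (length os)))) (active os)
  follow-step z os tr with pred (length os) ℕ.≟ slotTime (σ (pred (length os)))
  ... | no _ = refl
  ... | yes _ = trans (moved ((who sl ℕ.≟ lab z) ×-dec (expect sl ≟ᵗ traceOf os y)))
          (cong₂ (λ v e → ast v e (active os)) (sym (trans (X-def z (suc y)) (cong proj₁ next-state))) (cong entryOf (cong proj₂ (sym next-state))))
    where
    y : ℕ
    y = σ (pred (length os))
    sl : Slot
    sl = slotAt y
    old : Fin n × Trace
    old = run toGraph (lab z) (start z) (pre y)
    next-state : run toGraph (lab z) (start z) (pre (suc y)) ≡ advance toGraph (lab z) sl old
    next-state = cong (run toGraph (lab z) (start z)) (pre-suc y)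
    moved : (d : Dec (who sl ≡ lab z × expect sl ≡ traceOf os y)) →
      post (obey d (port sl)) (X z y) os ≡ ast (proj₁ (advance toGraph (lab z) sl old)) (entryOf (proj₂ (advance toGraph (lab z) sl old))) (active os)
    moved (yes (a , b)) = trans (cong (λ v → post (move (port sl)) v os) (X-def z y)) (post-move (lab z) sl (proj₁ old) (proj₂ old) os a (trans b tr))
    moved (no ¬m) = trans (cong (λ v → post stay v os) (X-def z y)) (post-stay (lab z) sl (proj₁ old) (proj₂ old) os (λ m → ¬m (proj₁ m , trans (proj₂ m) (sym tr))))

  -- Before the deadline only hypotheses earlier than `h` can be judged, and these are rejected by
  -- minimality.
  follow-early : ∀ t z → Acting t z → clock t z < deadline → algorithm (lab z) (seen t z) ≡ follow (lab z) (seen t z) (σ (pred (length (seen t z))))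
  follow-early t z ac lt = trans (algorithm-def (lab z) (seen t z)) (decide-no (verdict? (lab z) (seen t z)) none _)
    where
    none : ¬ Verdict (lab z) (seen t z)
    none (h' , _ , e , acc) with h' <? h
    ... | yes h'<h = rejects h' h'<h z t (trans (sym (cong pred (seen-length t z))) e) acc
    ... | no h'≮h = <⇒≱ lt (≤-trans (4^-mono (finish-≤ (≮⇒≥ h'≮h))) (≤-reflexive (trans (sym e) (cong pred (seen-length t z)))))

  stop-now : ∀ t z → clock t z ≡ deadline → algorithm (lab z) (seen t z) ≡ stop L N
  stop-now t z now = trans (algorithm-def (lab z) (seen t z)) (decide-yes (verdict? (lab z) (seen t z))
    (h , ≤-trans (s≤s (≤-trans (≤-trans (n≤1+n h) (prog-long (suc h))) (≤-trans (n≤4^n (finish h)) (≤-reflexive (sym now))))) (≤-reflexive (sym (seen-length t z))) ,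
     trans (cong pred (seen-length t z)) now , accepts z t now) _)

  statusOf : ℕ → List Obs → Status
  statusOf zero os = dormant
  statusOf (suc _) os = active os

  -- A stopped agent is compared with its copy that never stops, which remains at the hub up to
  -- `end-time`. `Early` includes `clock t z` equal to `deadline`, as the agent declares in that
  -- very round.
  Early Late : ℕ → Fin k → Set
  Early t z = clock t z ≤ deadline × config t z ≡ ast (place t z) (entryAt z (clock t z)) (statusOf (clock t z) (hist t z))
  Late t z = deadline < clock t z × config t z ≡ ast (place t z) nothing (done L N)

  Faithful : ℕ → Set
  Faithful t = ∀ z → Early t z ⊎ Late t z

  faithful-pos : ∀ t → Faithful t → ∀ z → pos (config t z) ≡ place t z
  faithful-pos t F z = [ (λ e → cong pos (proj₂ e)) , (λ l → cong pos (proj₂ l)) ]′ (F z)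

  faithful-count : ∀ t → Faithful t → ∀ v → countAt (config t) v ≡ crowd (clock t) v
  faithful-count t F v = trans (sym (♯-length real?)) (trans (≤-antisym
      (♯-inject real? model? (λ z → z) (λ {z} e → trans (sym (faithful-pos t F z)) e) (λ _ _ e → e))
      (♯-inject model? real? (λ z → z) (λ {z} e → trans (faithful-pos t F z) e) (λ _ _ e → e))) (sym (crowd-def (clock t) v)))
    where
    real? = λ z → pos (config t z) Fin.≟ v
    model? = λ z → place t z Fin.≟ v

  act-seen : ∀ t z → Faithful t → act (config t) z (place t z) (entryAt z (clock t z)) (hist t z) ≡ post (algorithm (lab z) (seen t z)) (place t z) (seen t z)
  act-seen t z F = trans (act≡post (config t) z (place t z) (entryAt z (clock t z)) (hist t z))
    (cong (λ c → post (algorithm (lab z) (hist t z ∷ʳ obs (PG.deg (place t z)) (entryAt z (clock t z)) c)) (place t z) (hist t z ∷ʳ obs (PG.deg (place t z)) (entryAt z (clock t z)) c))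
      (faithful-count t F (place t z)))

  act-early : ∀ t z → Faithful t → Acting t z → clock t z < deadline →
    act (config t) z (place t z) (entryAt z (clock t z)) (hist t z) ≡ ast (place (suc t) z) (entryAt z (clock (suc t) z)) (statusOf (clock (suc t) z) (hist (suc t) z))
  act-early t z F ac lt = trans (act-seen t z F) (trans (cong (λ a → post a (place t z) (seen t z)) (follow-early t z ac lt))
      (trans (cong (λ s → post (follow (lab z) (seen t z) (σ (pred (length (seen t z))))) (X z (σ s)) (seen t z)) (sym s≡))
        (trans (follow-step z (seen t z) (traceOf-seen t z (σ (pred (length (seen t z)))) ac (≤-reflexive (cong σ s≡))))
          (trans (cong (λ s → ast (X z (σ (suc s))) (entryAt z (suc s)) (active (seen t z))) s≡)
            (trans (cong (λ os → ast (X z (σ (suc (clock t z)))) (entryAt z (suc (clock t z))) (active os)) (sym (hist-acting t z ac)))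
              (cong (λ s → ast (X z (σ s)) (entryAt z s) (statusOf s (hist (suc t) z))) (sym ac)))))))
    where
    s≡ : pred (length (seen t z)) ≡ clock t z
    s≡ = cong pred (seen-length t z)

  act-stop : ∀ t z → Faithful t → clock t z ≡ deadline → act (config t) z (place t z) (entryAt z (clock t z)) (hist t z) ≡ ast (place t z) nothing (done L N)
  act-stop t z F now = trans (act-seen t z F) (cong (λ a → post a (place t z) (seen t z)) (stop-now t z now))

  step-done : ∀ t c z {v e L m} → c z ≡ ast v e (done L m) → stepAgent t c z ≡ ast v e (done L m)
  step-done t c z eq with c z
  step-done t c z refl | _ = refl

  step-active : ∀ t c z {v e os} → c z ≡ ast v e (active os) → stepAgent t c z ≡ act c z v e os
  step-active t c z eq with c z
  step-active t c z refl | _ = refl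

  step-dormant : ∀ t c z {v e} → c z ≡ ast v e dormant → stepAgent t c z ≡
    (if wk z t ∨ (2 ≤ᵇ countAt c v) then act c z v nothing [] else ast v e dormant)
  step-dormant t c z eq with c z
  step-dormant t c z refl | _ = refl

  late-stays : ∀ t z → suc t ≤ end-time → deadline ≤ clock t z → deadline < clock (suc t) z → place t z ≡ place (suc t) z
  late-stays t z le now later = trans (at-hub t z z (≤-trans (n≤1+n t) le) now) (sym (at-hub (suc t) z z le (<⇒≤ later)))

  faithful-suc : ∀ t → suc t ≤ end-time → Faithful t → Faithful (suc t)
  faithful-suc t le F z = [ from-early , from-late ]′ (F z)
    where
    from-late : Late t z → Early (suc t) z ⊎ Late (suc t) z
    from-late (lt , eq) = inj₂ (later , trans (step-done t (config t) z eq) (cong (λ v → ast v nothing (done L N)) (late-stays t z le (<⇒≤ lt) later)))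
      where
      later : deadline < clock (suc t) z
      later = ≤-trans lt (clock-mono z (n≤1+n t))

    running : ∀ s → clock t z ≡ suc s → config t z ≡ ast (place t z) (entryAt z (clock t z)) (active (hist t z)) → clock t z ≤ deadline → Early (suc t) z ⊎ Late (suc t) z
    running s e eq cl≤ with m≤n⇒m<n∨m≡n cl≤
    ... | inj₁ lt = inj₁ (subst (_≤ deadline) (sym ac) lt , trans (step-active t (config t) z eq) (act-early t z F ac lt))
      where
      ac : Acting t z
      ac = clock-next t z (subst (1 ≤_) (sym e) (s≤s z≤n))
    ... | inj₂ now = inj₂ (later , trans (step-active t (config t) z eq) (trans (act-stop t z F now)
              (cong (λ v → ast v nothing (done L N)) (late-stays t z le (≤-reflexive (sym now)) later))))
      where
      later : deadline < clock (suc t) z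
      later = ≤-reflexive (trans (cong suc (sym now)) (sym (clock-next t z (subst (1 ≤_) (sym e) (s≤s z≤n)))))

    asleep : clock t z ≡ 0 → config t z ≡ ast (place t z) nothing dormant → Early (suc t) z ⊎ Late (suc t) z
    asleep e eq = inj₁ (≤-trans (clock-step t z) (≤-trans (s≤s (≤-reflexive e)) (4^-pos (finish h))) ,
        trans (step-dormant t (config t) z eq) (trans (cong (λ c → if wk z t ∨ (2 ≤ᵇ c) then act (config t) z (place t z) nothing [] else ast (place t z) nothing dormant)
            (faithful-count t F (place t z))) (cases (wk z t ∨ (2 ≤ᵇ crowd (clock t) (place t z))) (trans (clock-suc t z) (cong (tick _) e)))))
      where
      cases : ∀ b → clock (suc t) z ≡ tick b 0 → (if b then act (config t) z (place t z) nothing [] else ast (place t z) nothing dormant)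
        ≡ ast (place (suc t) z) (entryAt z (clock (suc t) z)) (statusOf (clock (suc t) z) (hist (suc t) z))
      cases false e' = trans (cong (λ s → ast (X z (σ s)) nothing dormant) e) (sym (cong (λ s → ast (X z (σ s)) (entryAt z s) (statusOf s (hist (suc t) z))) e'))
      cases true e' = trans (cong₂ (λ s os → act (config t) z (place t z) (entryAt z s) os) (sym e) (sym (hist-asleep t z e)))
        (act-early t z F (trans e' (cong suc (sym e))) (subst (_< deadline) (sym e) (4^-pos (finish h))))

    from-early : Early t z → Early (suc t) z ⊎ Late (suc t) z
    from-early (cl≤ , eq) = split (clock t z) refl
      where
      split : ∀ s → clock t z ≡ s → Early (suc t) z ⊎ Late (suc t) z
      split zero e = asleep e (trans eq (cong (λ s → ast (place t z) (entryAt z s) (statusOf s (hist t z))) e))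
      split (suc s) e = running s e (trans eq (cong (λ s → ast (place t z) (entryAt z (clock t z)) (statusOf s (hist t z))) e)) cl≤

  faithful : ∀ t → t ≤ end-time → Faithful t
  faithful zero _ z = inj₁ (subst (_≤ deadline) (sym (clock-zero z)) z≤n ,
    sym (trans (cong (λ s → ast (X z (σ s)) (entryAt z s) (statusOf s [])) (clock-zero z)) (cong (λ v → ast v nothing dormant) (X-start z))))
  faithful (suc t) le = faithful-suc t le (faithful t (≤-trans (n≤1+n t) le))

  finished-config : ∀ d z → config (d + end-time) z ≡ ast hub nothing (done L N)
  finished-config zero z = [ (λ e → ⊥-elim (<⇒≱ (all-past z) (proj₁ e))) ,
      (λ l → trans (proj₂ l) (cong (λ v → ast v nothing (done L N)) (at-hub end-time z z ≤-refl (<⇒≤ (proj₁ l))))) ]′ (faithful end-time ≤-refl z)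
  finished-config (suc d) z = step-done (d + end-time) (config (d + end-time)) z (finished-config d z)

  finished-after : ∀ t z → end-time ≤ t → config t z ≡ ast hub nothing (done L N)
  finished-after t z le = subst (λ t → config t z ≡ ast hub nothing (done L N)) (m∸n+n≡m le) (finished-config (t ∸ end-time) z)

  early-not-done : ∀ s os → ¬ IsDone (statusOf s os)
  early-not-done zero os ()
  early-not-done (suc s) os ()

  all-done : ∀ z → IsDone (status (config end-time z))
  all-done z = subst (λ a → IsDone (status a)) (sym (finished-after end-time z ≤-refl)) tt

  together : ∀ t i j → IsDone (status (config (suc t) i)) → (pos (config t j) ≡ pos (config t i)) × (pos (config (suc t) j) ≡ pos (config (suc t) i))
  together t i j dn with suc t ≤? end-time
  ... | no ¬le = trans (cong pos (finished-after t j le)) (sym (cong pos (finished-after t i le))) ,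
                 trans (cong pos (finished-after (suc t) j (m≤n⇒m≤1+n le))) (sym (cong pos (finished-after (suc t) i (m≤n⇒m≤1+n le))))
    where
    le : end-time ≤ t
    le = s≤s⁻¹ (≰⇒> ¬le)
  ... | yes le = [ (λ e → ⊥-elim (early-not-done (clock (suc t) i) (hist (suc t) i) (subst (λ a → IsDone (status a)) (proj₂ e) dn))) , meet ]′ (faithful (suc t) le i)
    where
    meet : Late (suc t) i → (pos (config t j) ≡ pos (config t i)) × (pos (config (suc t) j) ≡ pos (config (suc t) i))
    meet (lt , _) = trans (at₀ j) (sym (at₀ i)) , trans (at₁ j) (sym (at₁ i))
      where
      at₀ : ∀ z → pos (config t z) ≡ hub
      at₀ z = trans (faithful-pos t (faithful t (≤-trans (n≤1+n t) le)) z) (at-hub t i z (≤-trans (n≤1+n t) le) (s≤s⁻¹ (≤-trans lt (clock-step t i))))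
      at₁ : ∀ z → pos (config (suc t) z) ≡ hub
      at₁ z = trans (faithful-pos (suc t) (faithful (suc t) le) z) (at-hub (suc t) i z le (<⇒≤ lt))

  done-injective : ∀ {L m L' m'} → Status.done L m ≡ done L' m' → L ≡ L' × m ≡ m'
  done-injective refl = refl , refl

  outputs : ∀ t i L' m → status (config t i) ≡ done L' m → (L' ≡ lab elected) × (m ≡ n)
  outputs t i L' m e = conclude (done-injective (trans (sym (final (≤-total t end-time))) e))
    where
    conclude : L ≡ L' × N ≡ m → (L' ≡ lab elected) × (m ≡ n)
    conclude (a , b) = trans (sym a) leader≡ , trans (sym b) nodes≡
    final : t ≤ end-time ⊎ end-time ≤ t → status (config t i) ≡ done L N
    final (inj₂ le) = cong status (finished-after t i le)
    final (inj₁ le) = [ (λ er → ⊥-elim (early-not-done (clock t i) (hist t i) (subst IsDone (trans (sym e) (cong status (proj₂ er))) tt))) ,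
                        (λ l → cong status (proj₂ l)) ]′ (faithful t le i)

  solved : (Σ ℕ λ T → ∀ i → IsDone (status (config T i)))
    × (∀ t i j → IsDone (status (config (suc t) i)) → (pos (config t j) ≡ pos (config t i)) × (pos (config (suc t) j) ≡ pos (config (suc t) i)))
    × (Σ (Fin k) λ ℓ → ∀ t i L m → status (config t i) ≡ done L m → (L ≡ lab ℓ) × (m ≡ n))
  solved = (end-time , all-done) , together , (elected , outputs)

theorem2 : Σ Algorithm Solves
theorem2 = algorithm , λ n PG connected k two lab lab-inj _ start start-inj wake (i₀ , woken) →
  solved PG connected k two lab (λ _ _ → lab-inj) start (λ _ _ → start-inj) wake i₀ (proj₁ (round woken)) (proj₂ (round woken))
  where
  round : ∀ {m : Maybe ℕ} → Is-just m → ∃ λ r → m ≡ just r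
  round {just r} _ = r , refl
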